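{- Let $P,Q\in\mathrm{Mat}_d(\mathbb{Z})$ be irreducible and let $p(x)\in\mathbb{Q}[x]$ be the characteristic polynomial of $P^{ -1}Q$. Then $P,Q$ are coprime if and only if $c=|\det P|$ is the smallest positive integer such that $c\,p(x)\in \mathbb{Z}[x]$.
   Context: Irreducible: there are no non-trivial subspaces $U,V$ of $\mathbb{Q}^d$ of the same dimension (non-trivial meaning neither $\{0\}$ nor $\mathbb{Q}^d$) with $PU\subseteq V$ and $QU\subseteq V$; irreducible matrices are invertible over $\mathbb{Q}$. Coprime: there are no $R,S\in \mathrm{GL}_d(\mathbb{Q})$ with $0<|\det(R)\det(S)|<1$ such that $RPS,RQS\in\mathrm{Mat}_d(\mathbb{Z})$. -}

module Defs where

open import Algebra.Bundles.Raw using (RawRing)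
import Algebra.Definitions.RawMonoid as RawMonoidDefinitions
open import Data.Bool.Base using (if_then_else_)
open import Data.Fin.Base using (Fin; zero; suc; toℕ; punchIn)
open import Data.Fin.Properties using (_≟_)
open import Data.Integer.Base as ℤ using (ℤ)
open import Data.List.Base as List using (List; []; _∷_)
open import Data.Nat.Base as ℕ using (ℕ; zero; suc)
open import Data.Product.Base using (Σ-syntax; ∃-syntax; _×_)
open import Data.Rational.Base as ℚ using (ℚ; 0ℚ; 1ℚ; _/_)
open import Data.Vec.Functional using (Vector)
open import Level using (0ℓ)
open import Relation.Binary.PropositionalEquality.Core using (_≡_; _≗_)
open import Relation.Nullary.Decidable.Core using (⌊_⌋)
open import Relation.Nullary.Negation.Core using (¬_)
open import Relation.Unary using (Pred; _∈_)

Matrix : ∀ {a} → Set a → ℕ → Set a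
Matrix A d = Fin d → Fin d → A

module MatrixOver {a ℓ} (R : RawRing a ℓ) where
  open RawRing R
  open RawMonoidDefinitions +-rawMonoid public using (sum)

  infix  4 _≈ᴹ_
  infixl 7 _*ᴹ_ _*ⱽ_

  _≈ᴹ_ : ∀ {d} → Matrix Carrier d → Matrix Carrier d → Set ℓ
  A ≈ᴹ B = ∀ i j → A i j ≈ B i j

  0ᴹ : ∀ {d} → Matrix Carrier d
  0ᴹ i j = 0#

  1ᴹ : ∀ {d} → Matrix Carrier d
  1ᴹ i j = if ⌊ i ≟ j ⌋ then 1# else 0#

  _*ᴹ_ : ∀ {d} → Matrix Carrier d → Matrix Carrier d → Matrix Carrier d
  (A *ᴹ B) i j = sum (λ k → A i k * B k j)

  _*ⱽ_ : ∀ {d} → Matrix Carrier d → Vector Carrier d → Vector Carrier d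
  (A *ⱽ v) i = sum (λ k → A i k * v k)

  [-1]^_ : ℕ → Carrier
  [-1]^ zero  = 1#
  [-1]^ suc n = - ([-1]^ n)

  -- Laplace expansion along the first row.
  det : ∀ {d} → Matrix Carrier d → Carrier
  det {zero}  A = 1#
  det {suc d} A =
    sum (λ j → ([-1]^ toℕ j) * A zero j * det (λ i k → A (suc i) (punchIn j k)))

  IsInverse : ∀ {d} → Matrix Carrier d → Matrix Carrier d → Set ℓ
  IsInverse A B = (A *ᴹ B ≈ᴹ 1ᴹ) × (B *ᴹ A ≈ᴹ 1ᴹ)

-- Polynomials as coefficient lists, constant term first; trailing zeros are
-- allowed, so equality is equality of all coefficients.
module PolynomialOver {a ℓ} (R : RawRing a ℓ) where
  open RawRing R

  Poly : Set a
  Poly = List Carrier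

  coeff : Poly → ℕ → Carrier
  coeff []      n       = 0#
  coeff (a ∷ p) zero    = a
  coeff (a ∷ p) (suc n) = coeff p n

  infix  4 _≈ᴾ_
  infixl 6 _+ᴾ_
  infixl 7 _*ᴾ_

  _≈ᴾ_ : Poly → Poly → Set ℓ
  p ≈ᴾ q = ∀ n → coeff p n ≈ coeff q n

  _+ᴾ_ : Poly → Poly → Poly
  []      +ᴾ q       = q
  (a ∷ p) +ᴾ []      = a ∷ p
  (a ∷ p) +ᴾ (b ∷ q) = (a + b) ∷ (p +ᴾ q)

  -ᴾ_ : Poly → Poly
  -ᴾ_ = List.map (-_)

  _*ᴾ_ : Poly → Poly → Poly
  []      *ᴾ q = []
  (a ∷ p) *ᴾ q = List.map (a *_) q +ᴾ (0# ∷ (p *ᴾ q))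

  const : Carrier → Poly
  const a = a ∷ []

  X : Poly
  X = 0# ∷ 1# ∷ []

  polyRawRing : RawRing a ℓ
  polyRawRing = record
    { Carrier = Poly
    ; _≈_     = _≈ᴾ_
    ; _+_     = _+ᴾ_
    ; _*_     = _*ᴾ_
    ; -_      = -ᴾ_
    ; 0#      = []
    ; 1#      = const 1#
    }

  -- det (X·I − A), computed in R[X].
  charPoly : ∀ {d} → Matrix Carrier d → Poly
  charPoly A = det (λ i j → (X *ᴾ 1ᴹ i j) +ᴾ (-ᴾ const (A i j)))
    where open MatrixOver polyRawRing using (det; 1ᴹ)

module Matℤ = MatrixOver ℤ.+-*-rawRing
module Matℚ = MatrixOver ℚ.+-*-rawRing
module Polyℚ = PolynomialOver ℚ.+-*-rawRing

fromℤ : ℤ → ℚ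
fromℤ z = z / 1

toMatℚ : ∀ {d} → Matrix ℤ d → Matrix ℚ d
toMatℚ A i j = fromℤ (A i j)

IsInteger : ℚ → Set
IsInteger q = ∃[ z ] q ≡ fromℤ z

Integral : ∀ {d} → Matrix ℚ d → Set
Integral A = ∀ i j → IsInteger (A i j)

Invertible : ∀ {d} → Matrix ℚ d → Set
Invertible A = ∃[ B ] Matℚ.IsInverse A B

0ⱽ : ∀ {d} → Vector ℚ d
0ⱽ i = 0ℚ

_+ⱽ_ : ∀ {d} → Vector ℚ d → Vector ℚ d → Vector ℚ d
(u +ⱽ v) i = u i ℚ.+ v i

_·ⱽ_ : ∀ {d} → ℚ → Vector ℚ d → Vector ℚ d
(a ·ⱽ v) i = a ℚ.* v i

linComb : ∀ {d k} → Vector ℚ k → Vector (Vector ℚ d) k → Vector ℚ d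
linComb a b i = Matℚ.sum (λ j → a j ℚ.* b j i)

-- Vectors are functions, so membership has to respect pointwise equality.
record Subspace (d : ℕ) : Set₁ where
  field
    member   : Pred (Vector ℚ d) 0ℓ
    resp     : ∀ {u v} → u ≗ v → u ∈ member → v ∈ member
    0-closed : 0ⱽ ∈ member
    +-closed : ∀ {u v} → u ∈ member → v ∈ member → (u +ⱽ v) ∈ member
    ·-closed : ∀ a {v} → v ∈ member → (a ·ⱽ v) ∈ member

open Subspace public using (member)

record IsBasis {d k} (U : Subspace d) (b : Vector (Vector ℚ d) k) : Set where
  field
    inside      : ∀ j → b j ∈ member U
    independent : ∀ a → linComb a b ≗ 0ⱽ → ∀ j → a j ≡ 0ℚ
    spanning    : ∀ {u} → u ∈ member U → ∃[ a ] u ≗ linComb a b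

HasDimension : ∀ {d} → Subspace d → ℕ → Set
HasDimension {d} U k = Σ[ b ∈ Vector (Vector ℚ d) k ] IsBasis U b

SameDimension : ∀ {d} → Subspace d → Subspace d → Set
SameDimension U V = ∃[ k ] HasDimension U k × HasDimension V k

NonTrivial : ∀ {d} → Subspace d → Set
NonTrivial U = ¬ (∀ u → u ∈ member U → u ≗ 0ⱽ) × ¬ (∀ u → u ∈ member U)

MapsInto : ∀ {d} → Matrix ℚ d → Subspace d → Subspace d → Set
MapsInto A U V = ∀ u → u ∈ member U → (A Matℚ.*ⱽ u) ∈ member V

Irreducible : ∀ {d} → Matrix ℤ d → Matrix ℤ d → Set₁
Irreducible {d} P Q =
  ¬ (Σ[ U ∈ Subspace d ] Σ[ V ∈ Subspace d ]
       NonTrivial U × NonTrivial V × SameDimension U V ×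
       MapsInto (toMatℚ P) U V × MapsInto (toMatℚ Q) U V)

Coprime : ∀ {d} → Matrix ℤ d → Matrix ℤ d → Set
Coprime {d} P Q =
  ¬ (Σ[ R ∈ Matrix ℚ d ] Σ[ S ∈ Matrix ℚ d ]
       Invertible R × Invertible S ×
       0ℚ ℚ.< ℚ.∣ Matℚ.det R ℚ.* Matℚ.det S ∣ ×
       ℚ.∣ Matℚ.det R ℚ.* Matℚ.det S ∣ ℚ.< 1ℚ ×
       Integral (R Matℚ.*ᴹ toMatℚ P Matℚ.*ᴹ S) ×
       Integral (R Matℚ.*ᴹ toMatℚ Q Matℚ.*ᴹ S))

-- c · p ∈ ℤ[x].
ClearsDenominators : Polyℚ.Poly → ℕ → Set
ClearsDenominators p c = ∀ n → IsInteger (fromℤ (ℤ.+ c) ℚ.* Polyℚ.coeff p n)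

IsSmallestPositive : Pred ℕ 0ℓ → ℕ → Set
IsSmallestPositive C c =
  0 ℕ.< c × C c × (∀ c′ → 0 ℕ.< c′ → C c′ → c ℕ.≤ c′)

{-# OPTIONS --safe #-}

-- Let f(x) = det (xP − Q) ∈ ℤ[x].  Since f = det P · p, the number |det P| always
-- clears the denominators of p, and it is the smallest one that does iff the
-- coefficients of f have no common prime factor.
--
-- If R and S contradict coprimality, then |det (RPS)| = |det R det S| · |det P| is
-- a smaller number clearing the denominators of p.
--
-- Conversely, let a prime ℓ divide f.  Then det Q = 0 mod ℓ, so unimodular column
-- operations make the first column of Q vanish mod ℓ, and unimodular row operations
-- make the first column of P equal to (u, 0, …, 0).  If u = 0 mod ℓ, dividing the
-- first column by ℓ violates coprimality.  Otherwise f = u x det (xP′ − Q′) mod ℓ,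
-- where P′, Q′ arise by deleting the first row and column, so P′, Q′ are again a
-- singular pencil.  To avoid fractions, the induction produces R and T = ℓ S with
-- RPT = RQT = 0 mod ℓ and det R · det T = ± ℓ^(d−1).
--
-- Irreducibility yields det P ≠ 0: a kernel vector v of P would give the lines
-- U = ⟨v⟩ and V ∋ Qv.
module Submission where

open import Defs
open import Algebra.Bundles using (CommutativeRing)
open import Algebra.Bundles.Raw using (RawRing)
open import Algebra.Morphism.Structures using (IsRingHomomorphism)
import Algebra.Properties.Group as GroupProperties
import Algebra.Properties.Ring as RingProperties
import Algebra.Properties.Semiring.Sum as SemiringSum
import Algebra.Solver.Ring.NaturalCoefficients.Default as SemiringSolver
open import Algebra.Structures using (IsAbelianGroup; IsCommutativeRing)
open import Data.Empty using (⊥-elim)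
open import Data.Fin.Base using (Fin; zero; suc; toℕ; punchIn; punchOut)
open import Data.Fin.Properties using (_≟_; all?; punchInᵢ≢i; punchIn-injective; punchIn-punchOut; suc-injective)
open import Data.Integer.Base as ℤ using (ℤ; +_; -[1+_]; ∣_∣; 0ℤ; 1ℤ)
import Data.Integer.DivMod as ℤ
import Data.Integer.Divisibility.Signed as Signed
import Data.Integer.Properties as ℤ
open import Data.Integer.Tactic.RingSolver using (solve-∀)
open import Data.List.Base as List using ([]; _∷_)
open import Data.List.Relation.Unary.All using (_∷_)
open import Data.Nat.Base as ℕ using (ℕ; zero; suc; z≤n; s≤s)
import Data.Nat.Coprimality as Coprimality
open import Data.Nat.Divisibility as ℕ∣ using (_∣_)
open import Data.Nat.GCD using (gcd; gcd-greatest; gcd[m,n]∣m; gcd[m,n]∣n; gcd[m,n]≤n; gcd[m,n]≢0)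
open import Data.Nat.Primality using (Prime; euclidsLemma; ¬prime[1]; prime⇒nonTrivial)
open import Data.Nat.Primality.Factorisation using (factorise)
import Data.Nat.Properties as ℕ
open import Data.Product.Base using (Σ; _×_; _,_; proj₁; proj₂; ∃-syntax)
open import Data.Rational.Base as ℚ using (ℚ; 0ℚ; 1ℚ)
import Data.Rational.Properties as ℚ
open import Data.Rational.Unnormalised.Base as ℚᵘ using (mkℚᵘ; *≡*; *<*)
import Data.Rational.Unnormalised.Properties as ℚᵘ
open import Data.Sum.Base using (_⊎_; inj₁; inj₂; [_,_]′)
open import Data.Vec.Functional using (Vector; insertAt) renaming (_∷_ to _∷ᵛ_)
open import Function.Base using (_∘_; id)
open import Function.Bundles using (_⇔_; mk⇔)
open import Level using (0ℓ; _⊔_)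
open import Relation.Binary.Bundles using (Setoid)
open import Relation.Binary.Core using (Rel)
open import Relation.Binary.PropositionalEquality as ≡ using (_≡_; _≢_; _≗_)
import Relation.Binary.Reasoning.Setoid as SetoidReasoning
open import Relation.Binary.Structures using (IsEquivalence)
open import Relation.Nullary.Decidable using (Dec; yes; no; map′)
open import Relation.Nullary.Negation using (¬_; contradiction)

-- Determinants

-- Everything rests on multiplicativity of `det`, which is used over ℤ, ℚ, ℤ modulo m and polynomial
-- rings. It is therefore proved over an arbitrary commutative ring, from the Laplace expansion
-- alone: both sides are alternating in the columns of the right factor and agree at the identity,
-- and an alternating form is determined by that value. No permutations occur. No residue field is
-- constructed and nothing is inverted modulo ℓ. All transformations are integer matrices of
-- determinant ±1 found by Euclid's algorithm; the congruence only decides which entries count as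
-- zero, and primality serves to cancel nonzero factors. Matrices merely invertible modulo ℓ would
-- not do, because |det R det S| has to come out as exactly 1/ℓ. Since 0 also generates a prime
-- ideal of ℤ, the same elimination with modulus 0 finds integer kernel vectors. A one-dimensional
-- space has no non-trivial subspaces, so irreducibility says nothing for d = 1, and P ≠ 0 is
-- assumed there.

data Adjacent : ∀ {n} → Fin n → Fin n → Set where
  here  : ∀ {n} → Adjacent {suc (suc n)} zero (suc zero)
  there : ∀ {n} {p q : Fin n} → Adjacent p q → Adjacent (suc p) (suc q)

adjacent-toℕ : ∀ {n} {p q : Fin n} → Adjacent p q → toℕ q ≡ suc (toℕ p)
adjacent-toℕ here        = ≡.refl
adjacent-toℕ (there adj) = ≡.cong suc (adjacent-toℕ adj)

-- A minor of the Laplace expansion that deletes neither of two equal neighbouring columns still has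
-- them as neighbours, so the induction in `det-repeated` can continue.
adjacent-punchIn⁻¹ : ∀ {n} {p q : Fin (suc n)} → Adjacent p q → ∀ k → k ≢ p → k ≢ q →
  ∃[ p′ ] ∃[ q′ ] (Adjacent p′ q′ × punchIn k p′ ≡ p × punchIn k q′ ≡ q)
adjacent-punchIn⁻¹ here zero          k≢p k≢q = ⊥-elim (k≢p ≡.refl)
adjacent-punchIn⁻¹ here (suc zero)    k≢p k≢q = ⊥-elim (k≢q ≡.refl)
adjacent-punchIn⁻¹ here (suc (suc {suc _} k)) k≢p k≢q = zero , suc zero , here , ≡.refl , ≡.refl
adjacent-punchIn⁻¹ (there adj) zero k≢p k≢q = _ , _ , adj , ≡.refl , ≡.refl
adjacent-punchIn⁻¹ (there {suc _} adj) (suc k) k≢p k≢q =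
  let p′ , q′ , adj′ , eq , eq′ = adjacent-punchIn⁻¹ adj k (k≢p ∘ ≡.cong suc) (k≢q ∘ ≡.cong suc)
  in  suc p′ , suc q′ , there adj′ , ≡.cong suc eq , ≡.cong suc eq′

-- Compares the minors that omit `p` and `q`: a column comes from the same place in both, or from
-- `p` and `q` interchanged, so the minors coincide once these two columns are equal.
adjacent-punchIn : ∀ {n} {p q : Fin (suc n)} → Adjacent p q → ∀ l →
  punchIn p l ≡ punchIn q l ⊎ (punchIn p l ≡ q × punchIn q l ≡ p)
adjacent-punchIn here        zero    = inj₂ (≡.refl , ≡.refl)
adjacent-punchIn here        (suc l) = inj₁ ≡.refl
adjacent-punchIn (there adj) zero    = inj₁ ≡.refl
adjacent-punchIn (there {suc _} adj) (suc l) with adjacent-punchIn adj l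
... | inj₁ eq         = inj₁ (≡.cong suc eq)
... | inj₂ (eq , eq′) = inj₂ (≡.cong suc eq , ≡.cong suc eq′)

module MatrixProperties {c ℓ} (R : CommutativeRing c ℓ) where
  open CommutativeRing R hiding (zero)
  open MatrixOver rawRing public
  open SemiringSum semiring using (sum-cong-≋; ∑-distrib-+; ∑-comm; *-distribˡ-sum; *-distribʳ-sum; sum-replicate-zero)
  open SetoidReasoning setoid

  sum-cong : ∀ {n} {f g : Vector Carrier n} → (∀ i → f i ≈ g i) → sum f ≈ sum g
  sum-cong = sum-cong-≋

  sum-0 : ∀ {n} {f : Vector Carrier n} → (∀ i → f i ≈ 0#) → sum f ≈ 0#
  sum-0 {n} f≈0 = trans (sum-cong f≈0) (sum-replicate-zero n)

  1ᴹ-suc : ∀ {n} (i j : Fin n) → 1ᴹ (suc i) (suc j) ≡ 1ᴹ i j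
  1ᴹ-suc i j with i ≟ j
  ... | yes _ = ≡.refl
  ... | no  _ = ≡.refl

  1ᴹ-sym : ∀ {n} (i j : Fin n) → 1ᴹ i j ≡ 1ᴹ j i
  1ᴹ-sym zero    zero    = ≡.refl
  1ᴹ-sym zero    (suc j) = ≡.refl
  1ᴹ-sym (suc i) zero    = ≡.refl
  1ᴹ-sym (suc i) (suc j) = ≡.trans (1ᴹ-suc i j) (≡.trans (1ᴹ-sym i j) (≡.sym (1ᴹ-suc j i)))

  sum-1ᴹˡ : ∀ {n} (i : Fin n) (v : Vector Carrier n) → sum (λ k → 1ᴹ i k * v k) ≈ v i
  sum-1ᴹˡ zero v = begin
    1# * v zero + sum (λ k → 0# * v (suc k)) ≈⟨ +-cong (*-identityˡ _) (sum-0 (λ k → zeroˡ (v (suc k)))) ⟩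
    v zero + 0#                              ≈⟨ +-identityʳ _ ⟩
    v zero                                   ∎
  sum-1ᴹˡ (suc i) v = begin
    0# * v zero + sum (λ k → 1ᴹ (suc i) (suc k) * v (suc k))
      ≈⟨ +-cong (zeroˡ _) (sum-cong (λ k → *-congʳ (reflexive (1ᴹ-suc i k)))) ⟩
    0# + sum (λ k → 1ᴹ i k * v (suc k))
      ≈⟨ +-identityˡ _ ⟩
    sum (λ k → 1ᴹ i k * v (suc k))
      ≈⟨ sum-1ᴹˡ i (v ∘ suc) ⟩
    v (suc i) ∎

  sum-1ᴹʳ : ∀ {n} (j : Fin n) (v : Vector Carrier n) → sum (λ k → v k * 1ᴹ k j) ≈ v j
  sum-1ᴹʳ j v = trans (sum-cong (λ k → trans (*-comm _ _) (*-congʳ (reflexive (1ᴹ-sym k j))))) (sum-1ᴹˡ j v)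

  ≈ᴹ-refl : ∀ {n} {A : Matrix Carrier n} → A ≈ᴹ A
  ≈ᴹ-refl i j = refl

  ≈ᴹ-sym : ∀ {n} {A B : Matrix Carrier n} → A ≈ᴹ B → B ≈ᴹ A
  ≈ᴹ-sym p i j = sym (p i j)

  *ᴹ-cong : ∀ {n} {A A′ B B′ : Matrix Carrier n} → A ≈ᴹ A′ → B ≈ᴹ B′ → A *ᴹ B ≈ᴹ A′ *ᴹ B′
  *ᴹ-cong p q i j = sum-cong (λ k → *-cong (p i k) (q k j))

  *ᴹ-identityˡ : ∀ {n} (A : Matrix Carrier n) → 1ᴹ *ᴹ A ≈ᴹ A
  *ᴹ-identityˡ A i j = sum-1ᴹˡ i (λ k → A k j)

  *ᴹ-identityʳ : ∀ {n} (A : Matrix Carrier n) → A *ᴹ 1ᴹ ≈ᴹ A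
  *ᴹ-identityʳ A i j = sum-1ᴹʳ j (A i)

  -- Rectangular shapes let it serve kernel vectors of wide matrices; with a column of a third
  -- matrix for `v` it becomes associativity.
  *ᴹ-*ⱽ-assoc : ∀ {m n o} (A : Fin m → Fin n → Carrier) (B : Fin n → Fin o → Carrier) (v : Vector Carrier o) i →
    sum (λ k → sum (λ l → A i l * B l k) * v k) ≈ sum (λ l → A i l * sum (λ k → B l k * v k))
  *ᴹ-*ⱽ-assoc A B v i = begin
    sum (λ k → sum (λ l → A i l * B l k) * v k)   ≈⟨ sum-cong (λ k → *-distribʳ-sum (v k) (λ l → A i l * B l k)) ⟩
    sum (λ k → sum (λ l → A i l * B l k * v k))   ≈⟨ ∑-comm (λ k l → A i l * B l k * v k) ⟩
    sum (λ l → sum (λ k → A i l * B l k * v k))   ≈⟨ sum-cong (λ l → sum-cong (λ k → *-assoc (A i l) (B l k) (v k))) ⟩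
    sum (λ l → sum (λ k → A i l * (B l k * v k))) ≈⟨ sum-cong (λ l → *-distribˡ-sum (A i l) (λ k → B l k * v k)) ⟨
    sum (λ l → A i l * sum (λ k → B l k * v k))   ∎

  *ᴹ-assoc : ∀ {n} (A B C : Matrix Carrier n) → (A *ᴹ B) *ᴹ C ≈ᴹ A *ᴹ (B *ᴹ C)
  *ᴹ-assoc A B C i j = *ᴹ-*ⱽ-assoc A B (λ k → C k j) i

  det-cong : ∀ {n} {A B : Matrix Carrier n} → A ≈ᴹ B → det A ≈ det B
  det-cong {zero}  p = refl
  det-cong {suc n} p = sum-cong (λ j → *-cong (*-congˡ {[-1]^ toℕ j} (p zero j))
                                              (det-cong (λ i k → p (suc i) (punchIn j k))))

  minor : ∀ {n} → Matrix Carrier (suc n) → Fin (suc n) → Matrix Carrier n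
  minor A j i k = A (suc i) (punchIn j k)

  -- Deleting any column other than the first leaves the zero column at the front of the minor.
  det-zero-column : ∀ {n} (A : Matrix Carrier (suc n)) → (∀ i → A i zero ≈ 0#) → det A ≈ 0#
  det-zero-column A A₀≈0 = sum-0 term
    where
    term : ∀ j → [-1]^ toℕ j * A zero j * det (minor A j) ≈ 0#
    term zero = trans (*-congʳ (trans (*-congˡ (A₀≈0 zero)) (zeroʳ _))) (zeroˡ _)
    term (suc {suc _} j) = trans (*-congˡ (det-zero-column (minor A (suc j)) (A₀≈0 ∘ suc))) (zeroʳ _)

  submatrix : ∀ {n} → Matrix Carrier (suc n) → Matrix Carrier n
  submatrix A i j = A (suc i) (suc j)

  -- Both block formulas discard the same terms for different reasons: a zero entry in the first
  -- row, or a minor whose first column vanishes.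
  det-first-term : ∀ {n} (A : Matrix Carrier (suc n)) →
    (∀ j → A zero (suc j) * det (minor A (suc j)) ≈ 0#) → det A ≈ A zero zero * det (submatrix A)
  det-first-term A rest = begin
    1# * A zero zero * det (submatrix A) + sum (λ j → [-1]^ toℕ (suc j) * A zero (suc j) * det (minor A (suc j)))
      ≈⟨ +-cong (*-congʳ (*-identityˡ _)) (sum-0 (λ j → trans (*-assoc _ _ _) (trans (*-congˡ (rest j)) (zeroʳ _)))) ⟩
    A zero zero * det (submatrix A) + 0#
      ≈⟨ +-identityʳ _ ⟩
    A zero zero * det (submatrix A) ∎

  det-blockˡ : ∀ {n} (A : Matrix Carrier (suc n)) → (∀ j → A zero (suc j) ≈ 0#) →
    det A ≈ A zero zero * det (submatrix A)
  det-blockˡ A row≈0 = det-first-term A (λ j → trans (*-congʳ (row≈0 j)) (zeroˡ _))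

  det-blockᵘ : ∀ {n} (A : Matrix Carrier (suc n)) → (∀ i → A (suc i) zero ≈ 0#) →
    det A ≈ A zero zero * det (submatrix A)
  det-blockᵘ {zero}  A col≈0 = det-first-term A (λ ())
  det-blockᵘ {suc n} A col≈0 =
    det-first-term A (λ j → trans (*-congˡ (det-zero-column (minor A (suc j)) col≈0)) (zeroʳ _))

  det-1ᴹ : ∀ n → det (1ᴹ {n}) ≈ 1#
  det-1ᴹ zero    = refl
  det-1ᴹ (suc n) = begin
    det (1ᴹ {suc n})                  ≈⟨ det-blockˡ (1ᴹ {suc n}) (λ j → refl) ⟩
    1# * det (submatrix (1ᴹ {suc n})) ≈⟨ *-identityˡ _ ⟩
    det (submatrix (1ᴹ {suc n}))      ≈⟨ det-cong {n} (λ i j → reflexive (1ᴹ-suc i j)) ⟩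
    det (1ᴹ {n})                      ≈⟨ det-1ᴹ n ⟩
    1#                                ∎

  -- Multilinear and alternating forms

  open SemiringSolver commutativeSemiring using (solve; _:=_; _:+_; _:*_)
  open GroupProperties +-group using (x∙y⁻¹≈ε⇒x≈y)
  open RingProperties ring using (-‿distribˡ-*)

  infix 4 _≈ⱽ_
  _≈ⱽ_ : ∀ {n} → Vector Carrier n → Vector Carrier n → Set ℓ
  u ≈ⱽ v = ∀ i → u i ≈ v i

  -- The number `n` of arguments and the dimension `m` are independent, so that fixing an argument
  -- stays in the class. One axiom covers additivity and homogeneity; stating it for columns that
  -- agree off `j` avoids an update operation.
  record IsMultilinear {n m} (D : Vector (Vector Carrier m) n → Carrier) : Set (c ⊔ ℓ) where
    field
      cong   : ∀ {C C′} → (∀ j → C j ≈ⱽ C′ j) → D C ≈ D C′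
      linear : ∀ j {C C′ C″} a → (∀ k → k ≢ j → C k ≈ⱽ C′ k) → (∀ k → k ≢ j → C k ≈ⱽ C″ k) →
               (∀ i → C j i ≈ C′ j i + a * C″ j i) → D C ≈ D C′ + a * D C″

  -- Equality is demanded of neighbouring arguments only, which is what the Laplace expansion yields
  -- directly; `repeated-head` derives the case of a first argument that recurs anywhere.
  record IsAlternating {n m} (D : Vector (Vector Carrier m) n → Carrier) : Set (c ⊔ ℓ) where
    field
      isMultilinear : IsMultilinear D
      repeated      : ∀ {p q} → Adjacent p q → ∀ {C} → C p ≈ⱽ C q → D C ≈ 0#
    open IsMultilinear isMultilinear public

  module _ {n m} {D : Vector (Vector Carrier m) (suc n) → Carrier} where

    linear-head : IsMultilinear D → ∀ {u u′ u″} a w → (∀ i → u i ≈ u′ i + a * u″ i) →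
      D (u ∷ᵛ w) ≈ D (u′ ∷ᵛ w) + a * D (u″ ∷ᵛ w)
    linear-head ml a w eq = IsMultilinear.linear ml zero a rest rest eq
      where
      rest : ∀ {u u′ : Vector Carrier m} k → k ≢ zero → (u ∷ᵛ w) k ≈ⱽ (u′ ∷ᵛ w) k
      rest zero    k≢0 = ⊥-elim (k≢0 ≡.refl)
      rest (suc k) k≢0 = λ i → refl

    tail-multilinear : IsMultilinear D → ∀ v → IsMultilinear (λ w → D (v ∷ᵛ w))
    tail-multilinear ml v = record
      { cong   = λ p → cong (λ { zero i → refl ; (suc j) → p j })
      ; linear = λ j a p q r → linear (suc j) a
          (λ { zero _ i → refl ; (suc k) k≢j → p k (k≢j ∘ ≡.cong suc) })
          (λ { zero _ i → refl ; (suc k) k≢j → q k (k≢j ∘ ≡.cong suc) }) r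
      }
      where open IsMultilinear ml

    tail-alternating : IsAlternating D → ∀ v → IsAlternating (λ w → D (v ∷ᵛ w))
    tail-alternating alt v = record
      { isMultilinear = tail-multilinear isMultilinear v
      ; repeated      = λ adj → repeated (there adj)
      }
      where open IsAlternating alt

    cong-∷ : IsMultilinear D → ∀ {u u′ w w′} → u ≈ⱽ u′ → (∀ j → w j ≈ⱽ w′ j) → D (u ∷ᵛ w) ≈ D (u′ ∷ᵛ w′)
    cong-∷ ml p q = IsMultilinear.cong ml (λ { zero → p ; (suc j) → q j })

  -- Expands `D (u + v, u + v, w) = 0`. Only the transfer of vanishing is recorded, so no sign has
  -- to be tracked.
  antisymmetric : ∀ {n m} {D : Vector (Vector Carrier m) (suc (suc n)) → Carrier} → IsAlternating D →
    ∀ u v w → D (v ∷ᵛ u ∷ᵛ w) ≈ 0# → D (u ∷ᵛ v ∷ᵛ w) ≈ 0#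
  antisymmetric {D = D} alt u v w vu≈0 = begin
    D (u ∷ᵛ v ∷ᵛ w)                                                ≈⟨ +-identityˡ _ ⟨
    0# + D (u ∷ᵛ v ∷ᵛ w)                                           ≈⟨ +-cong (repeated here (λ _ → refl)) (*-identityˡ _) ⟨
    D (u ∷ᵛ u ∷ᵛ w) + 1# * D (u ∷ᵛ v ∷ᵛ w)                         ≈⟨ linear-head (ml-tail u) 1# w (λ _ → refl) ⟨
    D (u ∷ᵛ s ∷ᵛ w)                                                ≈⟨ +-identityʳ _ ⟨
    D (u ∷ᵛ s ∷ᵛ w) + 0#                                           ≈⟨ +-congˡ vs≈0 ⟨
    D (u ∷ᵛ s ∷ᵛ w) + 1# * D (v ∷ᵛ s ∷ᵛ w)                         ≈⟨ linear-head isMultilinear 1# (s ∷ᵛ w) (λ _ → refl) ⟨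
    D (s ∷ᵛ s ∷ᵛ w)                                                ≈⟨ repeated here (λ _ → refl) ⟩
    0#                                                             ∎
    where
    open IsAlternating alt
    ml-tail = tail-multilinear isMultilinear
    s : Vector Carrier _
    s i = u i + 1# * v i
    vs≈0 : 1# * D (v ∷ᵛ s ∷ᵛ w) ≈ 0#
    vs≈0 = begin
      1# * D (v ∷ᵛ s ∷ᵛ w)                   ≈⟨ *-identityˡ _ ⟩
      D (v ∷ᵛ s ∷ᵛ w)                        ≈⟨ linear-head (ml-tail v) 1# w (λ _ → refl) ⟩
      D (v ∷ᵛ u ∷ᵛ w) + 1# * D (v ∷ᵛ v ∷ᵛ w) ≈⟨ +-cong vu≈0 (trans (*-congˡ (repeated here (λ _ → refl))) (zeroʳ _)) ⟩
      0# + 0#                                ≈⟨ +-identityˡ _ ⟩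
      0#                                     ∎

  -- `antisymmetric` carries `u` past the arguments in between until it stands next to its copy.
  repeated-head : ∀ {n m} {D : Vector (Vector Carrier m) (suc n) → Carrier} → IsAlternating D →
    ∀ u w k → w k ≈ⱽ u → D (u ∷ᵛ w) ≈ 0#
  repeated-head alt u w zero wk≈u = IsAlternating.repeated alt here (λ i → sym (wk≈u i))
  repeated-head {D = D} alt u w (suc k) wk≈u = begin
    D (u ∷ᵛ w)                     ≈⟨ cong-∷ isMultilinear (λ _ → refl) (λ { zero _ → refl ; (suc _) _ → refl }) ⟩
    D (u ∷ᵛ w zero ∷ᵛ (w ∘ suc))   ≈⟨ antisymmetric alt u (w zero) (w ∘ suc)
                                        (repeated-head (tail-alternating alt (w zero)) u (w ∘ suc) k wk≈u) ⟩
    0#                             ∎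
    where open IsAlternating alt

  linear-vanishes : ∀ {n} (L : Vector Carrier n → Carrier) → (∀ {u v} → u ≈ⱽ v → L u ≈ L v) →
    (∀ {u u′ u″} a → (∀ i → u i ≈ u′ i + a * u″ i) → L u ≈ L u′ + a * L u″) →
    (∀ i → L (1ᴹ i) ≈ 0#) → ∀ v → L v ≈ 0#
  linear-vanishes {zero} L L-cong L-lin L-basis v = begin
    -- In dimension 0 every equation between vectors holds, in particular `v = v + (- 1#) v`, whence
    -- `L v = L v - L v`.
    L v              ≈⟨ L-lin {u′ = v} {v} (- 1#) (λ ()) ⟩
    L v + - 1# * L v ≈⟨ +-congˡ (trans (sym (-‿distribˡ-* _ _)) (-‿cong (*-identityˡ _))) ⟩
    L v + - L v      ≈⟨ -‿inverseʳ _ ⟩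
    0#               ∎
  linear-vanishes {suc n} L L-cong L-lin L-basis v = begin
    L v                                          ≈⟨ L-lin {u′ = 0# ∷ᵛ (v ∘ suc)} {1ᴹ zero} (v zero) split ⟩
    L (0# ∷ᵛ (v ∘ suc)) + v zero * L (1ᴹ zero)   ≈⟨ +-cong tail≈0 (trans (*-congˡ (L-basis zero)) (zeroʳ _)) ⟩
    0# + 0#                                      ≈⟨ +-identityˡ _ ⟩
    0#                                           ∎
    where
    split : ∀ i → v i ≈ (0# ∷ᵛ (v ∘ suc)) i + v zero * 1ᴹ zero i
    split zero    = sym (trans (+-identityˡ _) (*-identityʳ _))
    split (suc i) = sym (trans (+-congˡ (zeroʳ _)) (+-identityʳ _))
    tail≈0 : L (0# ∷ᵛ (v ∘ suc)) ≈ 0#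
    tail≈0 = linear-vanishes (λ w → L (0# ∷ᵛ w))
      (λ p → L-cong (λ { zero → refl ; (suc i) → p i }))
      (λ a p → L-lin a (λ { zero → sym (trans (+-identityˡ _) (zeroʳ _)) ; (suc i) → p i }))
      (λ i → trans (L-cong (λ { zero → refl ; (suc j) → reflexive (≡.sym (1ᴹ-suc i j)) })) (L-basis (suc i)))
      (v ∘ suc)

  -- An argument `w′ + a e` splits the value into two terms, and the one containing `e` vanishes;
  -- the arguments are treated one after the other.
  multilinear-project : ∀ {n m} {F : Vector (Vector Carrier m) n → Carrier} → IsMultilinear F →
    ∀ (e : Vector Carrier m) → (∀ w k → w k ≈ⱽ e → F w ≈ 0#) →
    ∀ w w′ (a : Vector Carrier n) → (∀ k i → w k i ≈ w′ k i + a k * e i) → F w ≈ F w′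
  multilinear-project {zero} ml e F-e w w′ a eq = IsMultilinear.cong ml (λ ())
  multilinear-project {suc n} {F = F} ml e F-e w w′ a eq = begin
    F w                                            ≈⟨ cong (λ { zero _ → refl ; (suc k) _ → refl }) ⟩
    F (w zero ∷ᵛ w ∘ suc)                          ≈⟨ linear-head ml (a zero) (w ∘ suc) (eq zero) ⟩
    F (w′ zero ∷ᵛ w ∘ suc) + a zero * F (e ∷ᵛ w ∘ suc)
      ≈⟨ +-congˡ (trans (*-congˡ (F-e _ zero (λ _ → refl))) (zeroʳ _)) ⟩
    F (w′ zero ∷ᵛ w ∘ suc) + 0#                    ≈⟨ +-identityʳ _ ⟩
    F (w′ zero ∷ᵛ w ∘ suc)
      ≈⟨ multilinear-project (tail-multilinear ml (w′ zero)) e (λ v k → F-e _ (suc k)) (w ∘ suc) (w′ ∘ suc) (a ∘ suc) (eq ∘ suc) ⟩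
    F (w′ zero ∷ᵛ w′ ∘ suc)                        ≈⟨ cong (λ { zero _ → refl ; (suc k) _ → refl }) ⟩
    F w′                                           ∎
    where open IsMultilinear ml

  -- The inclusion of the coordinate hyperplane on which the `i`-th coordinate is zero.
  insert0 : ∀ {n} → Fin (suc n) → Vector Carrier n → Vector Carrier (suc n)
  insert0 i v = insertAt v i 0#

  insert0-cong : ∀ {n} (i : Fin (suc n)) {u v : Vector Carrier n} → u ≈ⱽ v → insert0 i u ≈ⱽ insert0 i v
  insert0-cong zero              p zero    = refl
  insert0-cong zero              p (suc l) = p l
  insert0-cong {suc n} (suc i)   p zero    = p zero
  insert0-cong {suc n} (suc i)   p (suc l) = insert0-cong i (p ∘ suc) l

  insert0-linear : ∀ {n} (i : Fin (suc n)) a {u v w : Vector Carrier n} → (∀ k → u k ≈ v k + a * w k) →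
    ∀ l → insert0 i u l ≈ insert0 i v l + a * insert0 i w l
  insert0-linear zero            a p zero    = sym (trans (+-identityˡ _) (zeroʳ _))
  insert0-linear zero            a p (suc l) = p l
  insert0-linear {suc n} (suc i) a p zero    = p zero
  insert0-linear {suc n} (suc i) a p (suc l) = insert0-linear i a (p ∘ suc) l

  insert0-0 : ∀ {n} (i : Fin (suc n)) {v : Vector Carrier n} → (∀ k → v k ≈ 0#) → ∀ l → insert0 i v l ≈ 0#
  insert0-0 zero            p zero    = refl
  insert0-0 zero            p (suc l) = p l
  insert0-0 {suc n} (suc i) p zero    = p zero
  insert0-0 {suc n} (suc i) p (suc l) = insert0-0 i (p ∘ suc) l

  insert0-1ᴹ : ∀ {n} (i : Fin (suc n)) (k : Fin n) → insert0 i (1ᴹ k) ≈ⱽ 1ᴹ (punchIn i k)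
  insert0-1ᴹ zero    k       zero    = refl
  insert0-1ᴹ zero    k       (suc l) = reflexive (≡.sym (1ᴹ-suc k l))
  insert0-1ᴹ (suc i) zero    zero    = refl
  insert0-1ᴹ (suc i) zero    (suc l) = insert0-0 i (λ _ → refl) l
  insert0-1ᴹ (suc i) (suc k) zero    = refl
  insert0-1ᴹ (suc i) (suc k) (suc l) = begin
    insert0 i (1ᴹ (suc k) ∘ suc) l    ≈⟨ insert0-cong i (λ j → reflexive (1ᴹ-suc k j)) l ⟩
    insert0 i (1ᴹ k) l                ≈⟨ insert0-1ᴹ i k l ⟩
    1ᴹ (punchIn i k) l                ≈⟨ reflexive (1ᴹ-suc (punchIn i k) l) ⟨
    1ᴹ (suc (punchIn i k)) (suc l)    ∎

  insert0-removeAt : ∀ {n} (i : Fin (suc n)) (v : Vector Carrier (suc n)) →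
    ∀ l → v l ≈ insert0 i (v ∘ punchIn i) l + v i * 1ᴹ i l
  insert0-removeAt zero            v zero    = sym (trans (+-identityˡ _) (*-identityʳ _))
  insert0-removeAt zero            v (suc l) = sym (trans (+-congˡ (zeroʳ _)) (+-identityʳ _))
  insert0-removeAt {suc n} (suc i) v zero    = sym (trans (+-congˡ (zeroʳ _)) (+-identityʳ _))
  insert0-removeAt {suc n} (suc i) v (suc l) =
    trans (insert0-removeAt i (v ∘ suc) l) (+-congˡ (*-congˡ (reflexive (≡.sym (1ᴹ-suc i l)))))

  -- After expanding the first column into unit vectors eᵢ, the other columns can be
  -- projected along eᵢ, which leaves an alternating form in one dimension less.
  alternating-vanishes : ∀ {n} {D : Vector (Vector Carrier n) n → Carrier} → IsAlternating D →
    D 1ᴹ ≈ 0# → ∀ C → D C ≈ 0#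
  alternating-vanishes {zero} alt D1≈0 C = trans (IsAlternating.cong alt (λ ())) D1≈0
  alternating-vanishes {suc n} {D} alt D1≈0 C = begin
    D C                     ≈⟨ cong (λ { zero _ → refl ; (suc _) _ → refl }) ⟩
    D (C zero ∷ᵛ C ∘ suc)   ≈⟨ linear-vanishes (λ u → D (u ∷ᵛ C ∘ suc)) (λ p → cong-∷ isMultilinear p (λ _ _ → refl))
                                 (λ a → linear-head isMultilinear a (C ∘ suc)) (λ i → onBasis i (C ∘ suc)) (C zero) ⟩
    0#                      ∎
    where
    open IsAlternating alt

    restricted : ∀ i → IsAlternating (λ w → D (1ᴹ i ∷ᵛ insert0 i ∘ w))
    restricted i = record
      { isMultilinear = record
        { cong   = λ p → T.cong (λ j → insert0-cong i (p j))
        ; linear = λ j a p q r → T.linear j a (λ k k≢j → insert0-cong i (p k k≢j))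
            (λ k k≢j → insert0-cong i (q k k≢j)) (insert0-linear i a r)
        }
      ; repeated = λ adj p → T.repeated adj (insert0-cong i p)
      }
      where module T = IsAlternating (tail-alternating alt (1ᴹ i))

    restricted-zero : ∀ w → D (1ᴹ zero ∷ᵛ insert0 zero ∘ w) ≈ 0#
    restricted-zero = alternating-vanishes (restricted zero) (begin
      D (1ᴹ zero ∷ᵛ insert0 zero ∘ 1ᴹ) ≈⟨ cong (λ { zero _ → refl ; (suc k) → insert0-1ᴹ zero k }) ⟩
      D 1ᴹ                             ≈⟨ D1≈0 ⟩
      0#                               ∎)

    onUnits : ∀ i → D (1ᴹ i ∷ᵛ insert0 i ∘ 1ᴹ) ≈ 0#
    onUnits zero = restricted-zero 1ᴹ
    -- The second column is the unit vector at `zero`. Once it is swapped to the front, the others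
    -- lie in the hyperplane of first coordinate zero, where `restricted-zero` accepts arbitrary
    -- arguments.
    onUnits (suc {suc _} i) = begin
      D (1ᴹ (suc i) ∷ᵛ insert0 (suc i) ∘ 1ᴹ)
        ≈⟨ cong-∷ isMultilinear (λ _ → refl) (λ { zero → insert0-1ᴹ (suc i) zero ; (suc k) l →
             trans (insert0-1ᴹ (suc i) (suc k) l) (sym (insert0-1ᴹ zero (punchIn i k) l)) }) ⟩
      D (1ᴹ (suc i) ∷ᵛ 1ᴹ zero ∷ᵛ insert0 zero ∘ 1ᴹ ∘ punchIn i)
        ≈⟨ antisymmetric alt _ _ _ (begin
             D (1ᴹ zero ∷ᵛ 1ᴹ (suc i) ∷ᵛ insert0 zero ∘ 1ᴹ ∘ punchIn i)
               ≈⟨ cong-∷ isMultilinear (λ _ → refl) (λ { zero l → sym (insert0-1ᴹ zero i l) ; (suc _) _ → refl }) ⟩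
             D (1ᴹ zero ∷ᵛ insert0 zero ∘ (1ᴹ i ∷ᵛ 1ᴹ ∘ punchIn i))
               ≈⟨ restricted-zero _ ⟩
             0# ∎) ⟩
      0# ∎

    onBasis : ∀ i w → D (1ᴹ i ∷ᵛ w) ≈ 0#
    onBasis i w = begin
      D (1ᴹ i ∷ᵛ w)
        ≈⟨ multilinear-project (tail-multilinear isMultilinear (1ᴹ i)) (1ᴹ i)
             (λ v k → repeated-head alt (1ᴹ i) v k) w _ (λ k → w k i) (λ k → insert0-removeAt i (w k)) ⟩
      D (1ᴹ i ∷ᵛ insert0 i ∘ (λ k → w k ∘ punchIn i))
        ≈⟨ alternating-vanishes (restricted i) (onUnits i) _ ⟩
      0# ∎

  -- In the Laplace term `k`, column `j` enters exactly once: through the entry of the first row if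
  -- `k` is `j`, otherwise through the minor, which is linear by induction.
  det-multilinear : ∀ {n} → IsMultilinear {n} {n} (λ C → det (λ i j → C j i))
  det-multilinear {zero}  = record { cong = λ _ → refl ; linear = λ () }
  det-multilinear {suc n} = record
    { cong   = λ p → det-cong (λ i j → p j i)
    ; linear = λ j {C} {C′} {C″} a p q r → begin
        sum (term C)                        ≈⟨ sum-cong (term-linear j {C} {C′} {C″} a p q r) ⟩
        sum (λ k → term C′ k + a * term C″ k) ≈⟨ ∑-distrib-+ (term C′) (λ k → a * term C″ k) ⟩
        sum (term C′) + sum (λ k → a * term C″ k) ≈⟨ +-congˡ (*-distribˡ-sum a (term C″)) ⟨
        sum (term C′) + a * sum (term C″)   ∎
    }
    where
    Columns = Vector (Vector Carrier (suc n)) (suc n)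
    minorᶜ : Columns → Fin (suc n) → Carrier
    minorᶜ C k = det (λ i l → C (punchIn k l) (suc i))
    term : Columns → Vector Carrier (suc n)
    term C k = [-1]^ toℕ k * C k zero * minorᶜ C k
    term-linear : ∀ j {C C′ C″ : Columns} a → (∀ k → k ≢ j → C k ≈ⱽ C′ k) → (∀ k → k ≢ j → C k ≈ⱽ C″ k) →
      (∀ i → C j i ≈ C′ j i + a * C″ j i) → ∀ k → term C k ≈ term C′ k + a * term C″ k
    term-linear j {C} {C′} {C″} a p q r k with k ≟ j
    ... | yes ≡.refl = begin
      [-1]^ toℕ k * C k zero * minorᶜ C k
        ≈⟨ *-congʳ (*-congˡ (r zero)) ⟩
      [-1]^ toℕ k * (C′ k zero + a * C″ k zero) * minorᶜ C k
        ≈⟨ solve 5 (λ s x a y m → (s :* (x :+ a :* y) :* m) := (s :* x :* m :+ a :* (s :* y :* m))) refl _ _ _ _ _ ⟩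
      [-1]^ toℕ k * C′ k zero * minorᶜ C k + a * ([-1]^ toℕ k * C″ k zero * minorᶜ C k)
        ≈⟨ +-cong (*-congˡ (det-cong (λ i l → p (punchIn k l) (punchInᵢ≢i k l) (suc i))))
                  (*-congˡ (*-congˡ (det-cong (λ i l → q (punchIn k l) (punchInᵢ≢i k l) (suc i))))) ⟩
      term C′ k + a * term C″ k ∎
    ... | no k≢j = begin
      [-1]^ toℕ k * C k zero * minorᶜ C k
        ≈⟨ *-congˡ (IsMultilinear.linear det-multilinear (punchOut k≢j) a
             (λ l l≢ i → p (punchIn k l) (avoids l l≢) (suc i)) (λ l l≢ i → q (punchIn k l) (avoids l l≢) (suc i))
             (λ i → ≡.subst (λ h → C h (suc i) ≈ C′ h (suc i) + a * C″ h (suc i)) (≡.sym (punchIn-punchOut k≢j)) (r (suc i)))) ⟩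
      [-1]^ toℕ k * C k zero * (minorᶜ C′ k + a * minorᶜ C″ k)
        ≈⟨ solve 4 (λ t a m n → (t :* (m :+ a :* n)) := (t :* m :+ a :* (t :* n))) refl _ _ _ _ ⟩
      [-1]^ toℕ k * C k zero * minorᶜ C′ k + a * ([-1]^ toℕ k * C k zero * minorᶜ C″ k)
        ≈⟨ +-cong (*-congʳ (*-congˡ (p k k≢j zero))) (*-congˡ (*-congʳ (*-congˡ (q k k≢j zero)))) ⟩
      term C′ k + a * term C″ k ∎
      where
      avoids : ∀ l → l ≢ punchOut k≢j → punchIn k l ≢ j
      avoids l l≢ eq = l≢ (punchIn-injective k _ _ (≡.trans eq (≡.sym (punchIn-punchOut k≢j))))

  sum-adjacent-cancel : ∀ {n} {p q : Fin n} → Adjacent p q → (f : Vector Carrier n) → f p + f q ≈ 0# →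
    (∀ k → k ≢ p → k ≢ q → f k ≈ 0#) → sum f ≈ 0#
  sum-adjacent-cancel here f pq rest = begin
    f zero + (f (suc zero) + sum (λ k → f (suc (suc k)))) ≈⟨ +-assoc _ _ _ ⟨
    f zero + f (suc zero) + sum (λ k → f (suc (suc k)))   ≈⟨ +-cong pq (sum-0 (λ k → rest (suc (suc k)) (λ ()) (λ ()))) ⟩
    0# + 0#                                               ≈⟨ +-identityˡ _ ⟩
    0#                                                    ∎
  sum-adjacent-cancel (there adj) f pq rest = begin
    f zero + sum (f ∘ suc) ≈⟨ +-cong (rest zero (λ ()) (λ ())) (sum-adjacent-cancel adj (f ∘ suc) pq
                                (λ k k≢p k≢q → rest (suc k) (k≢p ∘ suc-injective) (k≢q ∘ suc-injective))) ⟩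
    0# + 0#                ≈⟨ +-identityˡ _ ⟩
    0#                     ∎

  -- Terms `p` and `q` have equal minors and opposite signs; every other minor again has equal
  -- neighbouring columns.
  det-repeated : ∀ {n} {p q : Fin n} → Adjacent p q → (A : Matrix Carrier n) → (∀ i → A i p ≈ A i q) → det A ≈ 0#
  det-repeated {suc n} {p} {q} adj A eq = sum-adjacent-cancel adj term cancel others
    where
    term : Vector Carrier (suc n)
    term k = [-1]^ toℕ k * A zero k * det (minor A k)
    minors : ∀ i l → A (suc i) (punchIn q l) ≈ A (suc i) (punchIn p l)
    minors i l with adjacent-punchIn adj l
    ... | inj₁ e rewrite e = refl
    ... | inj₂ (e , e′) rewrite e | e′ = eq (suc i)
    cancel : term p + term q ≈ 0#
    cancel = begin
      term p + [-1]^ toℕ q * A zero q * det (minor A q)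
        ≈⟨ +-congˡ (*-cong (*-cong (reflexive (≡.cong [-1]^_ (adjacent-toℕ adj))) (sym (eq zero))) (det-cong minors)) ⟩
      term p + - ([-1]^ toℕ p) * A zero p * det (minor A p)
        ≈⟨ +-congˡ (trans (*-congʳ (sym (-‿distribˡ-* _ _))) (sym (-‿distribˡ-* _ _))) ⟩
      term p + - term p
        ≈⟨ -‿inverseʳ _ ⟩
      0# ∎
    others : ∀ k → k ≢ p → k ≢ q → term k ≈ 0#
    others k k≢p k≢q with adjacent-punchIn⁻¹ adj k k≢p k≢q
    ... | _ , _ , adj′ , ≡.refl , ≡.refl =
      trans (*-congˡ (det-repeated adj′ (minor A k) (λ i → eq (suc i)))) (zeroʳ _)

  det-alternating : ∀ {n} → IsAlternating {n} {n} (λ C → det (λ i j → C j i))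
  det-alternating = record
    { isMultilinear = det-multilinear
    ; repeated      = λ adj {C} p → det-repeated adj (λ i j → C j i) p
    }

  -- The difference of the two sides is alternating in the columns of `B` and zero at the unit
  -- vectors, so `alternating-vanishes` applies.
  det-* : ∀ {n} (A B : Matrix Carrier n) → det (A *ᴹ B) ≈ det A * det B
  det-* {n} A B = x∙y⁻¹≈ε⇒x≈y _ _
    (trans (+-congˡ (-‿distribˡ-* _ _)) (alternating-vanishes alt atUnits (λ j i → B i j)))
    where
    apply : Vector Carrier n → Vector Carrier n
    apply u i = sum (λ k → A i k * u k)
    apply-cong : ∀ {u v} → u ≈ⱽ v → apply u ≈ⱽ apply v
    apply-cong p i = sum-cong (λ k → *-congˡ (p k))
    apply-linear : ∀ a {u v w} → (∀ k → u k ≈ v k + a * w k) → ∀ i → apply u i ≈ apply v i + a * apply w i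
    apply-linear a {u} {v} {w} p i = begin
      sum (λ k → A i k * u k)
        ≈⟨ sum-cong (λ k → trans (*-congˡ (p k))
             (solve 4 (λ x y a z → (x :* (y :+ a :* z)) := (x :* y :+ a :* (x :* z))) refl _ _ _ _)) ⟩
      sum (λ k → A i k * v k + a * (A i k * w k))
        ≈⟨ ∑-distrib-+ (λ k → A i k * v k) (λ k → a * (A i k * w k)) ⟩
      apply v i + sum (λ k → a * (A i k * w k))
        ≈⟨ +-congˡ (*-distribˡ-sum a (λ k → A i k * w k)) ⟨
      apply v i + a * apply w i ∎
    D : Vector (Vector Carrier n) n → Carrier
    D C = det (λ i j → apply (C j) i) + - det A * det (λ i j → C j i)
    module det = IsAlternating (det-alternating {n})
    alt : IsAlternating D
    alt = record
      { isMultilinear = record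
        { cong   = λ p → +-cong (det.cong (λ j → apply-cong (p j))) (*-congˡ (det.cong p))
        ; linear = λ j {C} {C′} {C″} a p q r → begin
            D C
              ≈⟨ +-cong (det.linear j a (λ k k≢j → apply-cong (p k k≢j)) (λ k k≢j → apply-cong (q k k≢j)) (apply-linear a r))
                        (*-congˡ (det.linear j a p q r)) ⟩
            (det (λ i k → apply (C′ k) i) + a * det (λ i k → apply (C″ k) i)) + - det A * (det (λ i k → C′ k i) + a * det (λ i k → C″ k i))
              ≈⟨ solve 6 (λ x a y d z w → (x :+ a :* y :+ d :* (z :+ a :* w)) := (x :+ d :* z :+ a :* (y :+ d :* w))) refl _ _ _ _ _ _ ⟩
            D C′ + a * D C″ ∎
        }
      ; repeated = λ adj {C} p → begin
          D C                                                    ≈⟨ +-cong (det.repeated adj (apply-cong p)) (*-congˡ (det.repeated adj p)) ⟩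
          0# + - det A * 0#                                      ≈⟨ trans (+-identityˡ _) (zeroʳ _) ⟩
          0#                                                     ∎
      }
    atUnits : D (1ᴹ {n}) ≈ 0#
    atUnits = begin
      det (λ i j → apply (1ᴹ j) i) + - det A * det {n} (λ i j → 1ᴹ j i)
        ≈⟨ +-cong (det-cong (λ i j → trans (sum-cong (λ k → *-congˡ (reflexive (1ᴹ-sym j k)))) (*ᴹ-identityʳ A i j)))
             (*-congˡ (trans (det-cong {n} (λ i j → reflexive (1ᴹ-sym j i))) (det-1ᴹ n))) ⟩
      det A + - det A * 1#
        ≈⟨ +-congˡ (*-identityʳ _) ⟩
      det A - det A
        ≈⟨ -‿inverseʳ _ ⟩
      0# ∎

-- Polynomials and matrix pencils

module PolynomialProperties {c ℓ} (R : CommutativeRing c ℓ) where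
  open CommutativeRing R hiding (zero)
  open PolynomialOver rawRing public
  open RingProperties ring using (-0#≈0#)
  open SemiringSolver commutativeSemiring using (solve; _:=_; _:+_; _:*_)

  ≈ᴾ-isEquivalence : IsEquivalence _≈ᴾ_
  ≈ᴾ-isEquivalence = record
    { refl = λ n → refl ; sym = λ p n → sym (p n) ; trans = λ p q n → trans (p n) (q n) }

  ≈ᴾ-setoid : Setoid c ℓ
  ≈ᴾ-setoid = record { isEquivalence = ≈ᴾ-isEquivalence }

  private
    module Coeff = SetoidReasoning setoid
    module Polys = SetoidReasoning ≈ᴾ-setoid
  open IsEquivalence ≈ᴾ-isEquivalence using () renaming (refl to ≈ᴾ-refl; sym to ≈ᴾ-sym; trans to ≈ᴾ-trans)

  scale : Carrier → Poly → Poly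
  scale a = List.map (a *_)

  coeff-+ : ∀ p q n → coeff (p +ᴾ q) n ≈ coeff p n + coeff q n
  coeff-+ []      q       n       = sym (+-identityˡ _)
  coeff-+ (a ∷ p) []      n       = sym (+-identityʳ _)
  coeff-+ (a ∷ p) (b ∷ q) zero    = refl
  coeff-+ (a ∷ p) (b ∷ q) (suc n) = coeff-+ p q n

  coeff-scale : ∀ a p n → coeff (scale a p) n ≈ a * coeff p n
  coeff-scale a []      n       = sym (zeroʳ a)
  coeff-scale a (b ∷ p) zero    = refl
  coeff-scale a (b ∷ p) (suc n) = coeff-scale a p n

  coeff-neg : ∀ p n → coeff (-ᴾ p) n ≈ - coeff p n
  coeff-neg []      n       = sym -0#≈0#
  coeff-neg (b ∷ p) zero    = refl
  coeff-neg (b ∷ p) (suc n) = coeff-neg p n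

  +ᴾ-cong : ∀ {p p′ q q′} → p ≈ᴾ p′ → q ≈ᴾ q′ → p +ᴾ q ≈ᴾ p′ +ᴾ q′
  +ᴾ-cong {p} {p′} {q} {q′} e f n = trans (coeff-+ p q n) (trans (+-cong (e n) (f n)) (sym (coeff-+ p′ q′ n)))

  ∷-cong : ∀ {a b p q} → a ≈ b → p ≈ᴾ q → a ∷ p ≈ᴾ b ∷ q
  ∷-cong e f zero    = e
  ∷-cong e f (suc n) = f n

  scale-cong : ∀ {a b p q} → a ≈ b → p ≈ᴾ q → scale a p ≈ᴾ scale b q
  scale-cong {a} {b} {p} {q} e f n = trans (coeff-scale a p n) (trans (*-cong e (f n)) (sym (coeff-scale b q n)))

  +ᴾ-assoc : ∀ p q r → (p +ᴾ q) +ᴾ r ≈ᴾ p +ᴾ (q +ᴾ r)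
  +ᴾ-assoc p q r n = begin
    coeff ((p +ᴾ q) +ᴾ r) n               ≈⟨ coeff-+ (p +ᴾ q) r n ⟩
    coeff (p +ᴾ q) n + coeff r n          ≈⟨ +-congʳ (coeff-+ p q n) ⟩
    (coeff p n + coeff q n) + coeff r n   ≈⟨ +-assoc _ _ _ ⟩
    coeff p n + (coeff q n + coeff r n)   ≈⟨ +-congˡ (coeff-+ q r n) ⟨
    coeff p n + coeff (q +ᴾ r) n          ≈⟨ coeff-+ p (q +ᴾ r) n ⟨
    coeff (p +ᴾ (q +ᴾ r)) n               ∎
    where open Coeff

  +ᴾ-comm : ∀ p q → p +ᴾ q ≈ᴾ q +ᴾ p
  +ᴾ-comm p q n = trans (coeff-+ p q n) (trans (+-comm _ _) (sym (coeff-+ q p n)))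

  +ᴾ-identityʳ : ∀ p → p +ᴾ [] ≈ᴾ p
  +ᴾ-identityʳ p n = trans (coeff-+ p [] n) (+-identityʳ _)

  -ᴾ-inverseˡ : ∀ p → (-ᴾ p) +ᴾ p ≈ᴾ []
  -ᴾ-inverseˡ p n = trans (coeff-+ (-ᴾ p) p n) (trans (+-congʳ (coeff-neg p n)) (-‿inverseˡ _))

  +ᴾ-isAbelianGroup : IsAbelianGroup _≈ᴾ_ _+ᴾ_ [] -ᴾ_
  +ᴾ-isAbelianGroup = record
    { isGroup = record
      { isMonoid = record
        { isSemigroup = record
          { isMagma = record { isEquivalence = ≈ᴾ-isEquivalence ; ∙-cong = λ {p} {p′} {q} {q′} → +ᴾ-cong {p} {p′} {q} {q′} }
          ; assoc = +ᴾ-assoc }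
        ; identity = (λ p → ≈ᴾ-refl {p}) , +ᴾ-identityʳ }
      ; inverse = -ᴾ-inverseˡ , λ p → ≈ᴾ-trans {p +ᴾ (-ᴾ p)} {(-ᴾ p) +ᴾ p} {[]} (+ᴾ-comm p (-ᴾ p)) (-ᴾ-inverseˡ p)
      ; ⁻¹-cong = λ {p} {q} e n → trans (coeff-neg p n) (trans (-‿cong (e n)) (sym (coeff-neg q n))) }
    ; comm = +ᴾ-comm }

  coeff-*-zero : ∀ a p q → coeff ((a ∷ p) *ᴾ q) zero ≈ a * coeff q zero
  coeff-*-zero a p q =
    trans (coeff-+ (scale a q) (0# ∷ p *ᴾ q) zero) (trans (+-identityʳ _) (coeff-scale a q zero))

  coeff-*-suc : ∀ a p q n → coeff ((a ∷ p) *ᴾ q) (suc n) ≈ a * coeff q (suc n) + coeff (p *ᴾ q) n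
  coeff-*-suc a p q n = trans (coeff-+ (scale a q) (0# ∷ p *ᴾ q) (suc n)) (+-congʳ (coeff-scale a q (suc n)))

  -- A nonempty list of zeros also represents the zero polynomial, so `*ᴾ-cong` has to compare lists
  -- of different lengths.
  *ᴾ-≈[] : ∀ p q → p ≈ᴾ [] → p *ᴾ q ≈ᴾ []
  *ᴾ-≈[] []      q e n       = refl
  *ᴾ-≈[] (a ∷ p) q e zero    = trans (coeff-*-zero a p q) (trans (*-congʳ (e zero)) (zeroˡ _))
  *ᴾ-≈[] (a ∷ p) q e (suc n) = begin
    coeff ((a ∷ p) *ᴾ q) (suc n)           ≈⟨ coeff-*-suc a p q n ⟩
    a * coeff q (suc n) + coeff (p *ᴾ q) n ≈⟨ +-cong (trans (*-congʳ (e zero)) (zeroˡ _)) (*ᴾ-≈[] p q (e ∘ suc) n) ⟩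
    0# + 0#                                ≈⟨ +-identityˡ _ ⟩
    0#                                     ∎
    where open Coeff

  *ᴾ-cong : ∀ {p p′ q q′} → p ≈ᴾ p′ → q ≈ᴾ q′ → p *ᴾ q ≈ᴾ p′ *ᴾ q′
  *ᴾ-cong {[]}    {p′}     {q} {q′} e f = ≈ᴾ-sym {p′ *ᴾ q′} {[]} (*ᴾ-≈[] p′ q′ (≈ᴾ-sym {[]} {p′} e))
  *ᴾ-cong {a ∷ p} {[]}     {q} {q′} e f = *ᴾ-≈[] (a ∷ p) q e
  *ᴾ-cong {a ∷ p} {b ∷ p′} {q} {q′} e f =
    +ᴾ-cong {scale a q} {scale b q′} {0# ∷ p *ᴾ q} {0# ∷ p′ *ᴾ q′} (scale-cong {a} {b} {q} {q′} (e zero) f)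
      (∷-cong refl (*ᴾ-cong {p} {p′} {q} {q′} (e ∘ suc) f))

  *ᴾ-distribʳ : ∀ r p q → (p +ᴾ q) *ᴾ r ≈ᴾ (p *ᴾ r) +ᴾ (q *ᴾ r)
  *ᴾ-distribʳ r []      q       n = refl
  *ᴾ-distribʳ r (a ∷ p) []      n = sym (+ᴾ-identityʳ ((a ∷ p) *ᴾ r) n)
  *ᴾ-distribʳ r (a ∷ p) (b ∷ q) zero = begin
    coeff ((a + b ∷ p +ᴾ q) *ᴾ r) zero                  ≈⟨ coeff-*-zero (a + b) (p +ᴾ q) r ⟩
    (a + b) * coeff r zero                              ≈⟨ distribʳ _ _ _ ⟩
    a * coeff r zero + b * coeff r zero                 ≈⟨ +-cong (coeff-*-zero a p r) (coeff-*-zero b q r) ⟨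
    coeff ((a ∷ p) *ᴾ r) zero + coeff ((b ∷ q) *ᴾ r) zero ≈⟨ coeff-+ ((a ∷ p) *ᴾ r) ((b ∷ q) *ᴾ r) zero ⟨
    coeff (((a ∷ p) *ᴾ r) +ᴾ ((b ∷ q) *ᴾ r)) zero       ∎
    where open Coeff
  *ᴾ-distribʳ r (a ∷ p) (b ∷ q) (suc n) = begin
    coeff ((a + b ∷ p +ᴾ q) *ᴾ r) (suc n)
      ≈⟨ coeff-*-suc (a + b) (p +ᴾ q) r n ⟩
    (a + b) * coeff r (suc n) + coeff ((p +ᴾ q) *ᴾ r) n
      ≈⟨ +-congˡ (trans (*ᴾ-distribʳ r p q n) (coeff-+ (p *ᴾ r) (q *ᴾ r) n)) ⟩
    (a + b) * coeff r (suc n) + (coeff (p *ᴾ r) n + coeff (q *ᴾ r) n)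
      ≈⟨ solve 5 (λ a b x y z → ((a :+ b) :* x :+ (y :+ z)) := ((a :* x :+ y) :+ (b :* x :+ z))) refl _ _ _ _ _ ⟩
    (a * coeff r (suc n) + coeff (p *ᴾ r) n) + (b * coeff r (suc n) + coeff (q *ᴾ r) n)
      ≈⟨ +-cong (coeff-*-suc a p r n) (coeff-*-suc b q r n) ⟨
    coeff ((a ∷ p) *ᴾ r) (suc n) + coeff ((b ∷ q) *ᴾ r) (suc n)
      ≈⟨ coeff-+ ((a ∷ p) *ᴾ r) ((b ∷ q) *ᴾ r) (suc n) ⟨
    coeff (((a ∷ p) *ᴾ r) +ᴾ ((b ∷ q) *ᴾ r)) (suc n) ∎
    where open Coeff

  *ᴾ-zeroʳ : ∀ p → p *ᴾ [] ≈ᴾ []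
  *ᴾ-zeroʳ []      n       = refl
  *ᴾ-zeroʳ (a ∷ p) zero    = refl
  *ᴾ-zeroʳ (a ∷ p) (suc n) = *ᴾ-zeroʳ p n

  -- Mirrors the recursion that defines the product, this time on the right factor; commutativity
  -- follows by induction.
  *ᴾ-∷ʳ : ∀ p b q → p *ᴾ (b ∷ q) ≈ᴾ scale b p +ᴾ (0# ∷ p *ᴾ q)
  *ᴾ-∷ʳ []      b q zero    = refl
  *ᴾ-∷ʳ []      b q (suc n) = refl
  *ᴾ-∷ʳ (a ∷ p) b q zero    = +-congʳ (*-comm a b)
  *ᴾ-∷ʳ (a ∷ p) b q (suc n) = begin
    coeff ((a ∷ p) *ᴾ (b ∷ q)) (suc n)
      ≈⟨ coeff-*-suc a p (b ∷ q) n ⟩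
    a * coeff q n + coeff (p *ᴾ (b ∷ q)) n
      ≈⟨ +-congˡ (trans (*ᴾ-∷ʳ p b q n) (coeff-+ (scale b p) (0# ∷ p *ᴾ q) n)) ⟩
    a * coeff q n + (coeff (scale b p) n + coeff (0# ∷ p *ᴾ q) n)
      ≈⟨ solve 3 (λ x y z → (x :+ (y :+ z)) := (y :+ (x :+ z))) refl _ _ _ ⟩
    coeff (scale b p) n + (a * coeff q n + coeff (0# ∷ p *ᴾ q) n)
      ≈⟨ +-congˡ (trans (coeff-+ (scale a q) (0# ∷ p *ᴾ q) n) (+-congʳ (coeff-scale a q n))) ⟨
    coeff (scale b p) n + coeff ((a ∷ p) *ᴾ q) n
      ≈⟨ coeff-+ (scale b p) ((a ∷ p) *ᴾ q) n ⟨
    coeff (scale b p +ᴾ ((a ∷ p) *ᴾ q)) n ∎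
    where open Coeff

  *ᴾ-comm : ∀ p q → p *ᴾ q ≈ᴾ q *ᴾ p
  *ᴾ-comm []      q = ≈ᴾ-sym {q *ᴾ []} {[]} (*ᴾ-zeroʳ q)
  *ᴾ-comm (a ∷ p) q = begin
    scale a q +ᴾ (0# ∷ p *ᴾ q) ≈⟨ +ᴾ-cong {scale a q} {scale a q} {0# ∷ p *ᴾ q} {0# ∷ q *ᴾ p} (λ n → refl) (∷-cong refl (*ᴾ-comm p q)) ⟩
    scale a q +ᴾ (0# ∷ q *ᴾ p) ≈⟨ *ᴾ-∷ʳ q a p ⟨
    q *ᴾ (a ∷ p)               ∎
    where open Polys

  scale-*ᴾ : ∀ a p q → scale a p *ᴾ q ≈ᴾ scale a (p *ᴾ q)
  scale-*ᴾ a []      q n    = refl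
  scale-*ᴾ a (b ∷ p) q zero = begin
    coeff ((a * b ∷ scale a p) *ᴾ q) zero ≈⟨ coeff-*-zero (a * b) (scale a p) q ⟩
    a * b * coeff q zero                  ≈⟨ *-assoc _ _ _ ⟩
    a * (b * coeff q zero)                ≈⟨ *-congˡ (coeff-*-zero b p q) ⟨
    a * coeff ((b ∷ p) *ᴾ q) zero         ≈⟨ coeff-scale a ((b ∷ p) *ᴾ q) zero ⟨
    coeff (scale a ((b ∷ p) *ᴾ q)) zero   ∎
    where open Coeff
  scale-*ᴾ a (b ∷ p) q (suc n) = begin
    coeff ((a * b ∷ scale a p) *ᴾ q) (suc n)           ≈⟨ coeff-*-suc (a * b) (scale a p) q n ⟩
    a * b * coeff q (suc n) + coeff (scale a p *ᴾ q) n ≈⟨ +-congˡ (trans (scale-*ᴾ a p q n) (coeff-scale a (p *ᴾ q) n)) ⟩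
    a * b * coeff q (suc n) + a * coeff (p *ᴾ q) n
      ≈⟨ solve 4 (λ a b x y → (a :* b :* x :+ a :* y) := (a :* (b :* x :+ y))) refl _ _ _ _ ⟩
    a * (b * coeff q (suc n) + coeff (p *ᴾ q) n)       ≈⟨ *-congˡ (coeff-*-suc b p q n) ⟨
    a * coeff ((b ∷ p) *ᴾ q) (suc n)                   ≈⟨ coeff-scale a ((b ∷ p) *ᴾ q) (suc n) ⟨
    coeff (scale a ((b ∷ p) *ᴾ q)) (suc n)             ∎
    where open Coeff

  shift-*ᴾ : ∀ p q → (0# ∷ p) *ᴾ q ≈ᴾ 0# ∷ p *ᴾ q
  shift-*ᴾ p q n = begin
    coeff (scale 0# q +ᴾ (0# ∷ p *ᴾ q)) n         ≈⟨ coeff-+ (scale 0# q) (0# ∷ p *ᴾ q) n ⟩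
    coeff (scale 0# q) n + coeff (0# ∷ p *ᴾ q) n  ≈⟨ +-congʳ (trans (coeff-scale 0# q n) (zeroˡ _)) ⟩
    0# + coeff (0# ∷ p *ᴾ q) n                    ≈⟨ +-identityˡ _ ⟩
    coeff (0# ∷ p *ᴾ q) n                         ∎
    where open Coeff

  *ᴾ-assoc : ∀ p q r → (p *ᴾ q) *ᴾ r ≈ᴾ p *ᴾ (q *ᴾ r)
  *ᴾ-assoc []      q r n = refl
  *ᴾ-assoc (a ∷ p) q r   = begin
    (scale a q +ᴾ (0# ∷ p *ᴾ q)) *ᴾ r             ≈⟨ *ᴾ-distribʳ r (scale a q) (0# ∷ p *ᴾ q) ⟩
    (scale a q *ᴾ r) +ᴾ ((0# ∷ p *ᴾ q) *ᴾ r)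
      ≈⟨ +ᴾ-cong {scale a q *ᴾ r} {scale a (q *ᴾ r)} {(0# ∷ p *ᴾ q) *ᴾ r} {0# ∷ (p *ᴾ q) *ᴾ r} (scale-*ᴾ a q r) (shift-*ᴾ (p *ᴾ q) r) ⟩
    scale a (q *ᴾ r) +ᴾ (0# ∷ (p *ᴾ q) *ᴾ r)
      ≈⟨ +ᴾ-cong {scale a (q *ᴾ r)} {scale a (q *ᴾ r)} {0# ∷ (p *ᴾ q) *ᴾ r} {0# ∷ p *ᴾ (q *ᴾ r)} (λ n → refl) (∷-cong refl (*ᴾ-assoc p q r)) ⟩
    scale a (q *ᴾ r) +ᴾ (0# ∷ p *ᴾ (q *ᴾ r))      ∎
    where open Polys

  const-* : ∀ a q → const a *ᴾ q ≈ᴾ scale a q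
  const-* a q n = trans (coeff-+ (scale a q) (0# ∷ []) n) (trans (+-congˡ (zeros n)) (+-identityʳ _))
    where
    zeros : ∀ n → coeff (0# ∷ []) n ≈ 0#
    zeros zero    = refl
    zeros (suc n) = refl

  *ᴾ-identityˡ : ∀ p → const 1# *ᴾ p ≈ᴾ p
  *ᴾ-identityˡ p n = trans (const-* 1# p n) (trans (coeff-scale 1# p n) (*-identityˡ _))

  polyIsCommutativeRing : IsCommutativeRing _≈ᴾ_ _+ᴾ_ _*ᴾ_ -ᴾ_ [] (const 1#)
  polyIsCommutativeRing = record
    { isRing = record
      { +-isAbelianGroup = +ᴾ-isAbelianGroup
      ; *-cong     = λ {p} {p′} {q} {q′} → *ᴾ-cong {p} {p′} {q} {q′}
      ; *-assoc    = *ᴾ-assoc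
      ; *-identity = *ᴾ-identityˡ ,
                     λ p → ≈ᴾ-trans {p *ᴾ const 1#} {const 1# *ᴾ p} {p} (*ᴾ-comm p (const 1#)) (*ᴾ-identityˡ p)
      ; distrib    = (λ r p q → begin
                        r *ᴾ (p +ᴾ q)            ≈⟨ *ᴾ-comm r (p +ᴾ q) ⟩
                        (p +ᴾ q) *ᴾ r            ≈⟨ *ᴾ-distribʳ r p q ⟩
                        (p *ᴾ r) +ᴾ (q *ᴾ r)     ≈⟨ +ᴾ-cong {p *ᴾ r} {r *ᴾ p} {q *ᴾ r} {r *ᴾ q} (*ᴾ-comm p r) (*ᴾ-comm q r) ⟩
                        (r *ᴾ p) +ᴾ (r *ᴾ q)     ∎) ,
                     *ᴾ-distribʳ
      }
    ; *-comm = *ᴾ-comm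
    }
    where open Polys

  polyRing : CommutativeRing c ℓ
  polyRing = record { isCommutativeRing = polyIsCommutativeRing }

-- Compatibility of determinants and products with ring homomorphisms

module MatrixHomomorphism {a b ℓ′ ℓ} (R : RawRing a ℓ′) (S : CommutativeRing b ℓ)
  {φ : RawRing.Carrier R → CommutativeRing.Carrier S} (φ-homo : IsRingHomomorphism R (CommutativeRing.rawRing S) φ) where
  private
    module R = RawRing R
    module MR = MatrixOver R
    module MS = MatrixProperties S
  open CommutativeRing S hiding (zero)
  open IsRingHomomorphism φ-homo using (+-homo; 0#-homo; *-homo; 1#-homo; -‿homo)

  sum-homo : ∀ {n} (f : Vector R.Carrier n) → φ (MR.sum f) ≈ MS.sum (φ ∘ f)
  sum-homo {zero}  f = 0#-homo
  sum-homo {suc n} f = trans (+-homo _ _) (+-congˡ (sum-homo (f ∘ suc)))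

  *ᴹ-homo : ∀ {n} (A B : Matrix R.Carrier n) i j → φ ((A MR.*ᴹ B) i j) ≈ ((λ k l → φ (A k l)) MS.*ᴹ (λ k l → φ (B k l))) i j
  *ᴹ-homo A B i j = trans (sum-homo (λ k → A i k R.* B k j)) (MS.sum-cong (λ k → *-homo (A i k) (B k j)))

  1ᴹ-homo : ∀ {n} (i j : Fin n) → φ (MR.1ᴹ i j) ≈ MS.1ᴹ i j
  1ᴹ-homo i j with i ≟ j
  ... | yes _ = 1#-homo
  ... | no  _ = 0#-homo

  sign-homo : ∀ n → φ (MR.[-1]^ n) ≈ MS.[-1]^ n
  sign-homo zero    = 1#-homo
  sign-homo (suc n) = trans (-‿homo _) (-‿cong (sign-homo n))

  det-homo : ∀ {n} (A : Matrix R.Carrier n) → φ (MR.det A) ≈ MS.det (λ i j → φ (A i j))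
  det-homo {zero}  A = 1#-homo
  det-homo {suc n} A =
    trans (sum-homo (λ j → MR.[-1]^ toℕ j R.* A zero j R.* MR.det (λ i k → A (suc i) (punchIn j k))))
      (MS.sum-cong (λ j → trans (*-homo _ _)
        (*-cong (trans (*-homo _ (A zero j)) (*-congʳ (sign-homo (toℕ j)))) (det-homo (λ i k → A (suc i) (punchIn j k))))))

module _ {a b ℓ₁ ℓ₂} {R : RawRing a ℓ₁} {S : RawRing b ℓ₂} where
  private
    module R = RawRing R
    module S = RawRing S

  mkRingHomomorphism : (φ : R.Carrier → S.Carrier) →
    (∀ {x y} → x R.≈ y → φ x S.≈ φ y) →
    (∀ x y → φ (x R.+ y) S.≈ φ x S.+ φ y) →
    (∀ x y → φ (x R.* y) S.≈ φ x S.* φ y) →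
    (∀ x → φ (R.- x) S.≈ S.- φ x) →
    φ R.0# S.≈ S.0# → φ R.1# S.≈ S.1# → IsRingHomomorphism R S φ
  mkRingHomomorphism φ φ-cong φ-+ φ-* φ-neg φ-0 φ-1 = record
    { isSemiringHomomorphism = record
      { isNearSemiringHomomorphism = record
        { +-isMonoidHomomorphism = record
          { isMagmaHomomorphism = record { isRelHomomorphism = record { cong = φ-cong } ; homo = φ-+ }
          ; ε-homo = φ-0 }
        ; *-homo = φ-* }
      ; 1#-homo = φ-1 }
    ; -‿homo = φ-neg }

-- The zero entry is an argument so that ⊕ over ℤ and over ℤ/m agree definitionally.
blockDiagonal : ∀ {a} {A : Set a} {n} → A → A → Matrix A n → Matrix A (suc n)
blockDiagonal z a M zero    zero    = a
blockDiagonal z a M zero    (suc j) = z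
blockDiagonal z a M (suc i) zero    = z
blockDiagonal z a M (suc i) (suc j) = M i j

module BlockMatrix {c ℓ} (R : CommutativeRing c ℓ) where
  open CommutativeRing R hiding (zero)
  open MatrixProperties R

  infixr 6 _⊕_
  _⊕_ : ∀ {n} → Carrier → Matrix Carrier n → Matrix Carrier (suc n)
  a ⊕ M = blockDiagonal 0# a M

  det-⊕ : ∀ {n} a (M : Matrix Carrier n) → det (a ⊕ M) ≈ a * det M
  det-⊕ a M = det-blockˡ (a ⊕ M) (λ j → refl)

  ⊕-*ᴹ-zero : ∀ {n} a (M : Matrix Carrier n) (B : Fin (suc n) → Carrier) →
    sum (λ k → (a ⊕ M) zero k * B k) ≈ a * B zero
  ⊕-*ᴹ-zero a M B = trans (+-congˡ (sum-0 (λ k → zeroˡ (B (suc k))))) (+-identityʳ _)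

  ⊕-*ᴹ-suc : ∀ {n} a (M : Matrix Carrier n) (B : Fin (suc n) → Carrier) i →
    sum (λ k → (a ⊕ M) (suc i) k * B k) ≈ sum (λ k → M i k * B (suc k))
  ⊕-*ᴹ-suc a M B i = trans (+-congʳ (zeroˡ _)) (+-identityˡ _)

  *ᴹ-⊕-zero : ∀ {n} a (M : Matrix Carrier n) (B : Fin (suc n) → Carrier) →
    sum (λ k → B k * (a ⊕ M) k zero) ≈ B zero * a
  *ᴹ-⊕-zero a M B = trans (+-congˡ (sum-0 (λ k → zeroʳ (B (suc k))))) (+-identityʳ _)

  *ᴹ-⊕-suc : ∀ {n} a (M : Matrix Carrier n) (B : Fin (suc n) → Carrier) j →
    sum (λ k → B k * (a ⊕ M) k (suc j)) ≈ sum (λ k → B (suc k) * M k j)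
  *ᴹ-⊕-suc a M B j = trans (+-congʳ (zeroʳ _)) (+-identityˡ _)

  ⊕-inverse : ∀ {n} {M N : Matrix Carrier n} → M *ᴹ N ≈ᴹ 1ᴹ → (1# ⊕ M) *ᴹ (1# ⊕ N) ≈ᴹ 1ᴹ
  ⊕-inverse {M = M} {N} e zero    zero    = trans (⊕-*ᴹ-zero 1# M (λ k → (1# ⊕ N) k zero)) (*-identityˡ _)
  ⊕-inverse {M = M} {N} e zero    (suc j) = trans (⊕-*ᴹ-zero 1# M (λ k → (1# ⊕ N) k (suc j))) (zeroʳ _)
  ⊕-inverse {M = M} {N} e (suc i) zero    =
    trans (⊕-*ᴹ-suc 1# M (λ k → (1# ⊕ N) k zero) i) (sum-0 (λ k → zeroʳ (M i k)))
  ⊕-inverse {M = M} {N} e (suc i) (suc j) =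
    trans (⊕-*ᴹ-suc 1# M (λ k → (1# ⊕ N) k (suc j)) i) (trans (e i j) (reflexive (≡.sym (1ᴹ-suc i j))))

  *ᴹ-inverse : ∀ {n} {A A′ B B′ : Matrix Carrier n} → A *ᴹ A′ ≈ᴹ 1ᴹ → B *ᴹ B′ ≈ᴹ 1ᴹ → (A *ᴹ B) *ᴹ (B′ *ᴹ A′) ≈ᴹ 1ᴹ
  *ᴹ-inverse {n} {A} {A′} {B} {B′} p q i j = begin
    ((A *ᴹ B) *ᴹ (B′ *ᴹ A′)) i j   ≈⟨ *ᴹ-assoc A B (B′ *ᴹ A′) i j ⟩
    (A *ᴹ (B *ᴹ (B′ *ᴹ A′))) i j   ≈⟨ *ᴹ-cong {A = A} ≈ᴹ-refl (≈ᴹ-sym (*ᴹ-assoc B B′ A′)) i j ⟩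
    (A *ᴹ ((B *ᴹ B′) *ᴹ A′)) i j   ≈⟨ *ᴹ-cong {A = A} ≈ᴹ-refl (*ᴹ-cong {B = A′} q ≈ᴹ-refl) i j ⟩
    (A *ᴹ (1ᴹ *ᴹ A′)) i j          ≈⟨ *ᴹ-cong {A = A} ≈ᴹ-refl (*ᴹ-identityˡ A′) i j ⟩
    (A *ᴹ A′) i j                  ≈⟨ p i j ⟩
    1ᴹ i j                         ∎
    where open SetoidReasoning setoid

  IsInverse-⊕ : ∀ {n} (M N : Matrix Carrier n) → IsInverse M N → IsInverse (1# ⊕ M) (1# ⊕ N)
  IsInverse-⊕ M N (p , q) = ⊕-inverse p , ⊕-inverse q

  IsInverse-* : ∀ {n} (A A′ B B′ : Matrix Carrier n) → IsInverse A A′ → IsInverse B B′ → IsInverse (A *ᴹ B) (B′ *ᴹ A′)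
  IsInverse-* A A′ B B′ (p , p′) (q , q′) =
    *ᴹ-inverse {A = A} {A′} {B} {B′} p q , *ᴹ-inverse {A = B′} {B} {A′} {A} q′ p′

  IsInverse-ᵀ : ∀ {n} (A B : Matrix Carrier n) → IsInverse A B → IsInverse (λ i j → A j i) (λ i j → B j i)
  IsInverse-ᵀ A B (p , q) = transposed q , transposed p
    where
    transposed : ∀ {n} {A B : Matrix Carrier n} → A *ᴹ B ≈ᴹ 1ᴹ → (λ i j → B j i) *ᴹ (λ i j → A j i) ≈ᴹ 1ᴹ
    transposed {A = A} {B} p i j = trans (sum-cong (λ k → *-comm (B k i) (A j k))) (trans (p j i) (reflexive (1ᴹ-sym j i)))

  IsInverse-1 : ∀ {n} → IsInverse (1ᴹ {n}) 1ᴹ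
  IsInverse-1 = *ᴹ-identityˡ 1ᴹ , *ᴹ-identityˡ 1ᴹ

  det-inverse : ∀ {n} (A B : Matrix Carrier n) → IsInverse A B → det A * det B ≈ 1#
  det-inverse {n} A B (p , _) = trans (sym (det-* A B)) (trans (det-cong p) (det-1ᴹ n))

-- Determinants of matrix pencils

module PencilProperties {c ℓ} (R : CommutativeRing c ℓ) where
  open CommutativeRing R hiding (zero)
  open PolynomialProperties R
  open MatrixProperties R using (_*ᴹ_; _≈ᴹ_; 1ᴹ; sum; sum-cong; sum-0; det)
  private
    module Polys = CommutativeRing polyRing
    module Matᴾ = MatrixProperties polyRing

  -- The matrix `x P + Q`, constant terms first; `det (x P - Q)` arises by passing the negative of
  -- `Q`.
  pencil : ∀ {n} → Matrix Carrier n → Matrix Carrier n → Matrix Poly n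
  pencil P Q i j = Q i j ∷ P i j ∷ []

  constᴹ : ∀ {n} → Matrix Carrier n → Matrix Poly n
  constᴹ A i j = const (A i j)

  pencil-cong : ∀ {n} {P P′ Q Q′ : Matrix Carrier n} → P ≈ᴹ P′ → Q ≈ᴹ Q′ → pencil P Q Matᴾ.≈ᴹ pencil P′ Q′
  pencil-cong p q i j zero          = q i j
  pencil-cong p q i j (suc zero)    = p i j
  pencil-cong p q i j (suc (suc n)) = refl

  coeff-sum : ∀ {m} (f : Vector Poly m) n → coeff (Matᴾ.sum f) n ≈ sum (λ k → coeff (f k) n)
  coeff-sum {zero}  f n = refl
  coeff-sum {suc m} f n = trans (coeff-+ (f zero) (Matᴾ.sum (f ∘ suc)) n) (+-congˡ (coeff-sum (f ∘ suc) n))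

  coeff-const-* : ∀ a p n → coeff (const a *ᴾ p) n ≈ a * coeff p n
  coeff-const-* a p n = trans (const-* a p n) (coeff-scale a p n)

  coeff-*-const : ∀ a p n → coeff (p *ᴾ const a) n ≈ coeff p n * a
  coeff-*-const a p n = trans (*ᴾ-comm p (const a) n) (trans (coeff-const-* a p n) (*-comm _ _))

  const-homo : IsRingHomomorphism rawRing polyRawRing const
  const-homo = mkRingHomomorphism const (λ { e zero → e ; e (suc n) → refl })
    (λ x y n → refl)
    (λ { x y zero → sym (+-identityʳ _) ; x y (suc n) → refl })
    (λ x n → refl)
    (λ { zero → refl ; (suc n) → refl }) (λ n → refl)

  -- Evaluation at `x = 0`, which turns the pencil into `Q`.
  coeff₀-homo : IsRingHomomorphism polyRawRing rawRing (λ p → coeff p zero)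
  coeff₀-homo = mkRingHomomorphism (λ p → coeff p zero) (λ e → e zero)
    (λ p q → coeff-+ p q zero) coeff₀-* (λ p → coeff-neg p zero) refl refl
    where
    coeff₀-* : ∀ p q → coeff (p *ᴾ q) zero ≈ coeff p zero * coeff q zero
    coeff₀-* []      q = sym (zeroˡ _)
    coeff₀-* (a ∷ p) q = coeff-*-zero a p q

  pencil-*ˡ : ∀ {n} (A P Q : Matrix Carrier n) → constᴹ A Matᴾ.*ᴹ pencil P Q Matᴾ.≈ᴹ pencil (A *ᴹ P) (A *ᴹ Q)
  pencil-*ˡ A P Q i j n = trans (coeff-sum (λ k → const (A i k) *ᴾ pencil P Q k j) n)
    (trans (sum-cong (λ k → coeff-const-* (A i k) (pencil P Q k j) n)) (atCoeff n))
    where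
    atCoeff : ∀ n → sum (λ k → A i k * coeff (pencil P Q k j) n) ≈ coeff (pencil (A *ᴹ P) (A *ᴹ Q) i j) n
    atCoeff zero          = refl
    atCoeff (suc zero)    = refl
    atCoeff (suc (suc n)) = sum-0 (λ k → zeroʳ (A i k))

  pencil-*ʳ : ∀ {n} (P Q A : Matrix Carrier n) → pencil P Q Matᴾ.*ᴹ constᴹ A Matᴾ.≈ᴹ pencil (P *ᴹ A) (Q *ᴹ A)
  pencil-*ʳ P Q A i j n = trans (coeff-sum (λ k → pencil P Q i k *ᴾ const (A k j)) n)
    (trans (sum-cong (λ k → coeff-*-const (A k j) (pencil P Q i k) n)) (atCoeff n))
    where
    atCoeff : ∀ n → sum (λ k → coeff (pencil P Q i k) n * A k j) ≈ coeff (pencil (P *ᴹ A) (Q *ᴹ A) i j) n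
    atCoeff zero          = refl
    atCoeff (suc zero)    = refl
    atCoeff (suc (suc n)) = sum-0 (λ k → zeroˡ (A k j))

  detᴾ : ∀ {n} → Matrix Carrier n → Matrix Carrier n → Poly
  detᴾ P Q = Matᴾ.det (pencil P Q)

  coeff-detᴾ-zero : ∀ {n} (P Q : Matrix Carrier n) → coeff (detᴾ P Q) zero ≈ det Q
  coeff-detᴾ-zero P Q = MatrixHomomorphism.det-homo polyRawRing R coeff₀-homo (pencil P Q)

  detᴾ-cong : ∀ {n} {P P′ Q Q′ : Matrix Carrier n} → P ≈ᴹ P′ → Q ≈ᴹ Q′ → detᴾ P Q ≈ᴾ detᴾ P′ Q′
  detᴾ-cong p q = Matᴾ.det-cong (pencil-cong p q)

  -- A constant matrix multiplies the pencil as a whole, so multiplicativity over the polynomial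
  -- ring extracts the constant `det A`.
  coeff-detᴾ-*ˡ : ∀ {n} (A P Q : Matrix Carrier n) k → coeff (detᴾ (A *ᴹ P) (A *ᴹ Q)) k ≈ det A * coeff (detᴾ P Q) k
  coeff-detᴾ-*ˡ A P Q k = begin
    coeff (detᴾ (A *ᴹ P) (A *ᴹ Q)) k                       ≈⟨ Matᴾ.det-cong (pencil-*ˡ A P Q) k ⟨
    coeff (Matᴾ.det (constᴹ A Matᴾ.*ᴹ pencil P Q)) k       ≈⟨ Matᴾ.det-* (constᴹ A) (pencil P Q) k ⟩
    coeff (Matᴾ.det (constᴹ A) *ᴾ detᴾ P Q) k
      ≈⟨ Polys.*-congʳ {detᴾ P Q} {const (det A)} {Matᴾ.det (constᴹ A)} (MatrixHomomorphism.det-homo rawRing polyRing const-homo A) k ⟨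
    coeff (const (det A) *ᴾ detᴾ P Q) k                    ≈⟨ coeff-const-* (det A) (detᴾ P Q) k ⟩
    det A * coeff (detᴾ P Q) k                             ∎
    where open SetoidReasoning setoid

  coeff-detᴾ-*ʳ : ∀ {n} (P Q A : Matrix Carrier n) k → coeff (detᴾ (P *ᴹ A) (Q *ᴹ A)) k ≈ coeff (detᴾ P Q) k * det A
  coeff-detᴾ-*ʳ P Q A k = begin
    coeff (detᴾ (P *ᴹ A) (Q *ᴹ A)) k                       ≈⟨ Matᴾ.det-cong (pencil-*ʳ P Q A) k ⟨
    coeff (Matᴾ.det (pencil P Q Matᴾ.*ᴹ constᴹ A)) k       ≈⟨ Matᴾ.det-* (pencil P Q) (constᴹ A) k ⟩
    coeff (detᴾ P Q *ᴾ Matᴾ.det (constᴹ A)) k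
      ≈⟨ Polys.*-congˡ {detᴾ P Q} {const (det A)} {Matᴾ.det (constᴹ A)} (MatrixHomomorphism.det-homo rawRing polyRing const-homo A) k ⟨
    coeff (detᴾ P Q *ᴾ const (det A)) k                    ≈⟨ coeff-*-const (det A) (detᴾ P Q) k ⟩
    coeff (detᴾ P Q) k * det A                             ∎
    where open SetoidReasoning setoid

  charPoly-detᴾ : ∀ {n} (A : Matrix Carrier n) → charPoly A ≈ᴾ detᴾ 1ᴹ (λ i j → - A i j)
  charPoly-detᴾ {n} A = Matᴾ.det-cong entry
    where
    one : ∀ (i j : Fin n) → Matᴾ.1ᴹ i j ≈ᴾ const (1ᴹ i j)
    one i j with i ≟ j
    ... | yes _ = λ _ → refl
    ... | no  _ = λ { zero → refl ; (suc _) → refl }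
    X*-coeff : ∀ p → X *ᴾ p ≈ᴾ 0# ∷ p
    X*-coeff p k = trans (shift-*ᴾ (const 1#) p k) (∷-cong {p = const 1# *ᴾ p} refl (*ᴾ-identityˡ p) k)
    entry : ∀ i j → (X *ᴾ Matᴾ.1ᴹ i j) +ᴾ (-ᴾ const (A i j)) ≈ᴾ pencil 1ᴹ (λ i j → - A i j) i j
    entry i j k = trans (coeff-+ (X *ᴾ Matᴾ.1ᴹ i j) (-ᴾ const (A i j)) k)
      (trans (+-congʳ (trans (X*-coeff (Matᴾ.1ᴹ i j) k) (∷-cong {p = Matᴾ.1ᴹ i j} refl (one i j) k))) (atCoeff k))
      where
      atCoeff : ∀ k → coeff (0# ∷ 1ᴹ i j ∷ []) k + coeff (-ᴾ const (A i j)) k ≈ coeff (pencil 1ᴹ (λ i j → - A i j) i j) k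
      atCoeff zero          = +-identityˡ _
      atCoeff (suc zero)    = +-identityʳ _
      atCoeff (suc (suc k)) = +-identityʳ _

module PolynomialMap {a b ℓ₁ ℓ₂} (R : CommutativeRing a ℓ₁) (S : CommutativeRing b ℓ₂)
  {φ : CommutativeRing.Carrier R → CommutativeRing.Carrier S}
  (φ-homo : IsRingHomomorphism (CommutativeRing.rawRing R) (CommutativeRing.rawRing S) φ) where
  private
    module R  = CommutativeRing R
    module PR = PolynomialProperties R
    module PS = PolynomialProperties S
  open CommutativeRing S hiding (zero)
  open IsRingHomomorphism φ-homo using (+-homo; 0#-homo; *-homo; 1#-homo; -‿homo; ⟦⟧-cong)

  coeff-map : ∀ p n → PS.coeff (List.map φ p) n ≈ φ (PR.coeff p n)
  coeff-map []      n       = sym 0#-homo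
  coeff-map (x ∷ p) zero    = refl
  coeff-map (x ∷ p) (suc n) = coeff-map p n

  map-* : ∀ p q → List.map φ (p PR.*ᴾ q) PS.≈ᴾ List.map φ p PS.*ᴾ List.map φ q
  map-* []      q n    = refl
  map-* (x ∷ p) q zero = begin
    PS.coeff (List.map φ ((x ∷ p) PR.*ᴾ q)) zero     ≈⟨ coeff-map ((x ∷ p) PR.*ᴾ q) zero ⟩
    φ (PR.coeff ((x ∷ p) PR.*ᴾ q) zero)              ≈⟨ ⟦⟧-cong (PR.coeff-*-zero x p q) ⟩
    φ (x R.* PR.coeff q zero)                        ≈⟨ *-homo _ _ ⟩
    φ x * φ (PR.coeff q zero)                        ≈⟨ *-congˡ (coeff-map q zero) ⟨
    φ x * PS.coeff (List.map φ q) zero               ≈⟨ PS.coeff-*-zero (φ x) (List.map φ p) (List.map φ q) ⟨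
    PS.coeff ((φ x ∷ List.map φ p) PS.*ᴾ List.map φ q) zero ∎
    where open SetoidReasoning setoid
  map-* (x ∷ p) q (suc n) = begin
    PS.coeff (List.map φ ((x ∷ p) PR.*ᴾ q)) (suc n)                    ≈⟨ coeff-map ((x ∷ p) PR.*ᴾ q) (suc n) ⟩
    φ (PR.coeff ((x ∷ p) PR.*ᴾ q) (suc n))                             ≈⟨ ⟦⟧-cong (PR.coeff-*-suc x p q n) ⟩
    φ (x R.* PR.coeff q (suc n) R.+ PR.coeff (p PR.*ᴾ q) n)            ≈⟨ trans (+-homo _ _) (+-congʳ (*-homo _ _)) ⟩
    φ x * φ (PR.coeff q (suc n)) + φ (PR.coeff (p PR.*ᴾ q) n)          ≈⟨ +-cong (*-congˡ (coeff-map q (suc n))) (coeff-map (p PR.*ᴾ q) n) ⟨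
    φ x * PS.coeff (List.map φ q) (suc n) + PS.coeff (List.map φ (p PR.*ᴾ q)) n ≈⟨ +-congˡ (map-* p q n) ⟩
    φ x * PS.coeff (List.map φ q) (suc n) + PS.coeff (List.map φ p PS.*ᴾ List.map φ q) n
      ≈⟨ PS.coeff-*-suc (φ x) (List.map φ p) (List.map φ q) n ⟨
    PS.coeff ((φ x ∷ List.map φ p) PS.*ᴾ List.map φ q) (suc n)         ∎
    where open SetoidReasoning setoid

  map-homo : IsRingHomomorphism PR.polyRawRing PS.polyRawRing (List.map φ)
  map-homo = mkRingHomomorphism (List.map φ)
    (λ {p} {q} e n → trans (coeff-map p n) (trans (⟦⟧-cong (e n)) (sym (coeff-map q n))))
    (λ p q n → trans (coeff-map (p PR.+ᴾ q) n) (trans (⟦⟧-cong (PR.coeff-+ p q n)) (trans (+-homo _ _)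
      (trans (sym (+-cong (coeff-map p n) (coeff-map q n))) (sym (PS.coeff-+ (List.map φ p) (List.map φ q) n))))))
    map-*
    (λ p n → trans (coeff-map (PR.-ᴾ p) n) (trans (⟦⟧-cong (PR.coeff-neg p n)) (trans (-‿homo _)
      (trans (-‿cong (sym (coeff-map p n))) (sym (PS.coeff-neg (List.map φ p) n))))))
    (λ n → refl)
    (λ { zero → 1#-homo ; (suc n) → refl })

  -- Base change of the pencil determinant, used from ℤ to ℚ and from ℤ to ℤ modulo a prime.
  coeff-detᴾ-homo : ∀ {n} (P Q : Matrix R.Carrier n) k →
    φ (PR.coeff (PencilProperties.detᴾ R P Q) k) ≈
    PS.coeff (PencilProperties.detᴾ S (λ i j → φ (P i j)) (λ i j → φ (Q i j))) k
  coeff-detᴾ-homo P Q k = trans (sym (coeff-map (PencilProperties.detᴾ R P Q) k))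
    (MatrixHomomorphism.det-homo PR.polyRawRing PS.polyRing map-homo (PencilProperties.pencil R P Q) k)

-- Singular pencils modulo a prime

module ColumnReduction {c ℓ₁} (A : CommutativeRing c ℓ₁) where
  private
    module A = CommutativeRing A
    module MA = MatrixProperties A
    module BA = BlockMatrix A

  -- A prime congruence ≈′ on a ring A over which every column can be reduced by
  -- an invertible matrix: for us A = ℤ, and ≈′ is congruence modulo a prime or 0.
  module PrimeCongruence {ℓ₂} (_≈′_ : Rel A.Carrier ℓ₂)
    (isCommutativeRing′ : IsCommutativeRing _≈′_ A._+_ A._*_ A.-_ A.0# A.1#)
    (coarser : ∀ {x y} → x A.≈ y → x ≈′ y)
    (integral : ∀ x y → (x A.* y) ≈′ A.0# → x ≈′ A.0# ⊎ y ≈′ A.0#)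
    (1≉0 : ¬ (A.1# ≈′ A.0#)) (_≈0? : ∀ x → Dec (x ≈′ A.0#))
    (reduceColumn : ∀ {n} (v : Vector A.Carrier (suc n)) →
      Σ (Matrix A.Carrier (suc n)) λ R → Σ (Matrix A.Carrier (suc n)) λ R′ →
      MA.IsInverse R R′ × (∀ i → (R MA.*ⱽ v) (suc i) A.≈ A.0#)) where

    modularRing : CommutativeRing c ℓ₂
    modularRing = record { isCommutativeRing = isCommutativeRing′ }

    open CommutativeRing modularRing hiding (zero; isCommutativeRing)
    open MatrixProperties modularRing
    open BlockMatrix modularRing
    open PencilProperties modularRing
    open PolynomialProperties modularRing using (Poly; coeff; _*ᴾ_; coeff-*-suc; polyRing)
    open SetoidReasoning setoid

    reduceRow : ∀ {n} (v : Vector Carrier (suc n)) →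
      Σ (Matrix Carrier (suc n)) λ S → Σ (Matrix Carrier (suc n)) λ S′ →
      MA.IsInverse S S′ × (∀ j → MA.sum (λ k → v k * S k (suc j)) A.≈ 0#)
    reduceRow v =
      let R , R′ , inv , kills = reduceColumn v
      in  (λ i j → R j i) , (λ i j → R′ j i) , BA.IsInverse-ᵀ R R′ inv ,
          λ j → A.trans (MA.sum-cong (λ k → A.*-comm (v k) (R (suc j) k))) (kills j)

    -- Rows and columns are counted separately, since the elimination meets matrices with more
    -- columns than rows.
    Kernel : ∀ {m n} → (Fin m → Fin n → Carrier) → Set (c ⊔ ℓ₂)
    Kernel {n = n} Q = Σ (Vector Carrier n) λ v → ¬ (∀ k → v k ≈ 0#) × (∀ i → sum (λ k → Q i k * v k) ≈ 0#)

    inverse-nonzero : ∀ {n} (S S′ : Matrix Carrier n) → MA.IsInverse S S′ → ∀ w →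
      ¬ (∀ k → w k ≈ 0#) → ¬ (∀ k → (S *ⱽ w) k ≈ 0#)
    inverse-nonzero S S′ (_ , S′S≡1) w w≉0 Sw≈0 = w≉0 λ k → begin
      w k                              ≈⟨ sum-1ᴹˡ k w ⟨
      sum (λ l → 1ᴹ k l * w l)         ≈⟨ sum-cong (λ l → *-congʳ {w l} (coarser (S′S≡1 k l))) ⟨
      sum (λ l → (S′ *ᴹ S) k l * w l)  ≈⟨ *ᴹ-*ⱽ-assoc S′ S w k ⟩
      sum (λ l → S′ k l * (S *ⱽ w) l)  ≈⟨ sum-0 (λ l → trans (*-congˡ (Sw≈0 l)) (zeroʳ _)) ⟩
      0#                               ∎

    -- The first row of `Q S` is zero beyond its corner, so a kernel vector of the lower right
    -- block, extended by a leading 0, is killed whatever the corner is; `S` carries it back to `Q`.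
    kernel-lift : ∀ {m n} (Q : Fin (suc m) → Fin (suc n) → Carrier) (S S′ : Matrix Carrier (suc n)) → MA.IsInverse S S′ →
      (∀ j → sum (λ k → Q zero k * S k (suc j)) ≈ 0#) →
      Kernel (λ i j → sum (λ k → Q (suc i) k * S k (suc j))) → Kernel Q
    kernel-lift Q S S′ inv row≈0 (w , w≉0 , Qw≈0) =
      S *ⱽ (0# ∷ᵛ w) , inverse-nonzero S S′ inv (0# ∷ᵛ w) (λ z → w≉0 (z ∘ suc)) , λ i → begin
        sum (λ k → Q i k * (S *ⱽ (0# ∷ᵛ w)) k)
          ≈⟨ *ᴹ-*ⱽ-assoc Q S (0# ∷ᵛ w) i ⟨
        sum (λ k → Q i k * S k zero) * 0# + sum (λ j → sum (λ k → Q i k * S k (suc j)) * w j)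
          ≈⟨ +-cong (zeroʳ (sum (λ k → Q i k * S k zero))) (rest i) ⟩
        0# + 0#
          ≈⟨ +-identityˡ _ ⟩
        0# ∎
      where
      rest : ∀ i → sum (λ j → sum (λ k → Q i k * S k (suc j)) * w j) ≈ 0#
      rest zero    = sum-0 (λ j → trans (*-congʳ (row≈0 j)) (zeroˡ (w j)))
      rest (suc i) = Qw≈0 i

    -- Each elimination step removes one row and one column. When the rows run out a column is left,
    -- and its unit vector lies in the kernel.
    kernel-wide : ∀ {m n} → m ℕ.≤ n → (Q : Fin m → Fin (suc n) → Carrier) → Kernel Q
    kernel-wide z≤n       Q = 1ᴹ zero , (λ z → 1≉0 (z zero)) , λ ()
    kernel-wide (s≤s m≤n) Q with reduceRow (Q zero)
    ... | S , S′ , inv , kills = kernel-lift Q S S′ inv (coarser ∘ kills) (kernel-wide m≤n (λ i j → sum (λ k → Q (suc i) k * S k (suc j))))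

    cancelˡ : ∀ {x y} → ¬ x ≈ 0# → x * y ≈ 0# → y ≈ 0#
    cancelˡ {x} {y} x≉0 xy≈0 = [ (λ x≈0 → contradiction x≈0 x≉0) , id ]′ (integral x y xy≈0)

    -- If the corner of `Q S` is nonzero, cancelling it makes the remaining block singular and the
    -- induction goes on. If it is zero, the first row of `Q` vanishes and the other rows form a
    -- matrix wide enough for `kernel-wide`.
    kernel-singular : ∀ {n} (Q : Matrix Carrier n) → det Q ≈ 0# → Kernel Q
    kernel-singular {zero}  Q detQ≈0 = contradiction detQ≈0 1≉0
    kernel-singular {suc n} Q detQ≈0 = result (QS zero zero ≈0?)
      where
      reduced = reduceRow (Q zero)
      S  = proj₁ reduced
      S′ = proj₁ (proj₂ reduced)
      inv : MA.IsInverse S S′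
      inv = proj₁ (proj₂ (proj₂ reduced))
      QS : Matrix Carrier (suc n)
      QS = Q *ᴹ S
      row≈0 : ∀ j → QS zero (suc j) ≈ 0#
      row≈0 j = coarser (proj₂ (proj₂ (proj₂ reduced)) j)

      result : Dec (QS zero zero ≈ 0#) → Kernel Q
      result (no g≉0) = kernel-lift Q S S′ inv row≈0 (kernel-singular (submatrix QS) (cancelˡ g≉0 (begin
        QS zero zero * det (submatrix QS) ≈⟨ det-blockˡ QS row≈0 ⟨
        det QS                            ≈⟨ det-* Q S ⟩
        det Q * det S                     ≈⟨ *-congʳ detQ≈0 ⟩
        0# * det S                        ≈⟨ zeroˡ (det S) ⟩
        0#                                ∎)))
      result (yes g≈0) =
        let v , v≉0 , Qv≈0 = kernel-wide ℕ.≤-refl (λ i → Q (suc i))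
        in  v , v≉0 , λ { zero → sum-0 (λ k → trans (*-congʳ (Q≈0 k)) (zeroˡ (v k))) ; (suc i) → Qv≈0 i }
        where
        QS≈0 : ∀ j → QS zero j ≈ 0#
        QS≈0 zero    = g≈0
        QS≈0 (suc j) = row≈0 j
        Q≈0 : ∀ j → Q zero j ≈ 0#
        Q≈0 j = begin
          Q zero j                           ≈⟨ *ᴹ-identityʳ Q zero j ⟨
          (Q *ᴹ 1ᴹ) zero j                   ≈⟨ *ᴹ-cong {A = Q} {Q} ≈ᴹ-refl (λ k l → coarser (proj₁ inv k l)) zero j ⟨
          (Q *ᴹ (S *ᴹ S′)) zero j            ≈⟨ *ᴹ-assoc Q S S′ zero j ⟨
          sum (λ k → QS zero k * S′ k j)     ≈⟨ sum-0 (λ k → trans (*-congʳ (QS≈0 k)) (zeroˡ (S′ k j))) ⟩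
          0#                                 ∎

    -- `S′` sends a kernel vector `v` to `(g, 0, …, 0)`, so `g` times the first column of `Q S` is
    -- `Q v = 0`. Here `g` is nonzero because `v` is, and it cancels although it may be no unit of
    -- `A`.
    singular-column : ∀ {n} (Q : Matrix Carrier (suc n)) → det Q ≈ 0# →
      Σ (Matrix Carrier (suc n)) λ S → Σ (Matrix Carrier (suc n)) λ S′ → MA.IsInverse S S′ × (∀ i → (Q *ᴹ S) i zero ≈ 0#)
    singular-column Q detQ≈0 with kernel-singular Q detQ≈0
    ... | v , v≉0 , Qv≈0 with reduceColumn v
    ...   | S′ , S , inv@(_ , SS′≡1) , kills = S , S′ , (SS′≡1 , proj₁ inv) , λ i → cancelˡ g≉0 (begin
      g * (Q *ᴹ S) i zero               ≈⟨ *-comm g ((Q *ᴹ S) i zero) ⟩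
      (Q *ᴹ S) i zero * g               ≈⟨ +-identityʳ _ ⟨
      (Q *ᴹ S) i zero * g + 0#
        ≈⟨ +-congˡ (sum-0 (λ k → trans (*-congˡ (S′v≈0 k)) (zeroʳ ((Q *ᴹ S) i (suc k))))) ⟨
      sum (λ k → (Q *ᴹ S) i k * (S′ *ⱽ v) k)       ≈⟨ *ᴹ-*ⱽ-assoc Q S (S′ *ⱽ v) i ⟩
      sum (λ k → Q i k * sum (λ l → S k l * (S′ *ⱽ v) l))
        ≈⟨ sum-cong (λ k → *-congˡ {Q i k} (trans (sym (*ᴹ-*ⱽ-assoc S S′ v k))
             (trans (sum-cong (λ l → *-congʳ {v l} (coarser (SS′≡1 k l)))) (sum-1ᴹˡ k v)))) ⟩
      sum (λ k → Q i k * v k)           ≈⟨ Qv≈0 i ⟩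
      0#                                ∎)
      where
      g = (S′ *ⱽ v) zero
      S′v≈0 : ∀ k → (S′ *ⱽ v) (suc k) ≈ 0#
      S′v≈0 k = coarser (kills k)
      g≉0 : ¬ g ≈ 0#
      g≉0 g≈0 = inverse-nonzero S′ S inv v v≉0 λ { zero → g≈0 ; (suc k) → S′v≈0 k }

    regroup : ∀ {n} (A B P C D : Matrix Carrier n) → ((A *ᴹ B) *ᴹ P) *ᴹ (C *ᴹ D) ≈ᴹ (A *ᴹ ((B *ᴹ P) *ᴹ C)) *ᴹ D
    regroup A B P C D i j = begin
      (((A *ᴹ B) *ᴹ P) *ᴹ (C *ᴹ D)) i j ≈⟨ *ᴹ-cong {B = C *ᴹ D} (*ᴹ-assoc A B P) ≈ᴹ-refl i j ⟩
      ((A *ᴹ (B *ᴹ P)) *ᴹ (C *ᴹ D)) i j ≈⟨ *ᴹ-assoc (A *ᴹ (B *ᴹ P)) C D i j ⟨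
      (((A *ᴹ (B *ᴹ P)) *ᴹ C) *ᴹ D) i j ≈⟨ *ᴹ-cong {B = D} (*ᴹ-assoc A (B *ᴹ P) C) ≈ᴹ-refl i j ⟩
      ((A *ᴹ ((B *ᴹ P) *ᴹ C)) *ᴹ D) i j ∎

    -- Invertibility in `A` itself rather than modulo the congruence: over ℤ these are 1 and -1, so
    -- absolute values of determinants stay exact.
    Unit : Carrier → Set (c ⊔ ℓ₁)
    Unit u = ∃[ u′ ] u * u′ A.≈ 1#

    Unit-* : ∀ {u v} → Unit u → Unit v → Unit (u * v)
    Unit-* {u} {v} (u′ , uu′≈1) (v′ , vv′≈1) = u′ * v′ ,
      A.trans (solve 4 (λ u v u′ v′ → (u :* v :* (u′ :* v′)) := (u :* u′ :* (v :* v′))) A.refl u v u′ v′)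
        (A.trans (A.*-cong uu′≈1 vv′≈1) (A.*-identityˡ 1#))
      where open SemiringSolver A.commutativeSemiring

    det-Unit : ∀ {n} (R R′ : Matrix Carrier n) → MA.IsInverse R R′ → Unit (MA.det R)
    det-Unit R R′ inv = MA.det R′ , BA.det-inverse R R′ inv

    module _ (π : Carrier) (π≈0 : π ≈ 0#) where

      -- Its determinant plays the part of `π` to the power `n`, with `det-scalar` as the recursion
      -- of the power.
      scalar : ∀ n → Matrix Carrier n
      scalar n i j = π * 1ᴹ i j

      det-scalar : ∀ n → MA.det (scalar (suc n)) A.≈ π * MA.det (scalar n)
      det-scalar n = A.trans (MA.det-blockˡ (scalar (suc n)) (λ j → A.zeroʳ π))
        (A.*-cong (A.*-identityʳ π) (MA.det-cong {n} {submatrix (scalar (suc n))} {scalar n} (λ i j → A.*-congˡ {π} (A.reflexive (1ᴹ-suc i j)))))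

      -- `π ⊕ R` multiplies the first row by `π` and so kills it. No other row of `B` has an entry
      -- in the first column, which therefore vanishes too; `R` and `T` deal with the rest.
      block-vanishes : ∀ {n} (B : Matrix Carrier (suc n)) (R T : Matrix Carrier n) → (∀ i → B (suc i) zero ≈ 0#) →
        (R *ᴹ submatrix B) *ᴹ T ≈ᴹ 0ᴹ → ((π ⊕ R) *ᴹ B) *ᴹ (1# ⊕ T) ≈ᴹ 0ᴹ
      block-vanishes B R T column≈0 RBT≈0 = entry
        where
        X = (π ⊕ R) *ᴹ B
        X-zero : ∀ j → X zero j ≈ 0#
        X-zero j = begin
          X zero j        ≈⟨ ⊕-*ᴹ-zero (π) R (λ k → B k j) ⟩
          π * B zero j  ≈⟨ *-congʳ {B zero j} π≈0 ⟩
          0# * B zero j   ≈⟨ zeroˡ (B zero j) ⟩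
          0#              ∎
        X-suc : ∀ i j → X (suc i) j ≈ sum (λ k → R i k * B (suc k) j)
        X-suc i j = ⊕-*ᴹ-suc (π) R (λ k → B k j) i
        X-column : ∀ i → X i zero ≈ 0#
        X-column zero    = X-zero zero
        X-column (suc i) = trans (X-suc i zero) (sum-0 (λ k → trans (*-congˡ (column≈0 k)) (zeroʳ (R i k))))
        entry : X *ᴹ (1# ⊕ T) ≈ᴹ 0ᴹ
        entry i zero = begin
          (X *ᴹ (1# ⊕ T)) i zero ≈⟨ *ᴹ-⊕-zero 1# T (X i) ⟩
          X i zero * 1#          ≈⟨ *-identityʳ (X i zero) ⟩
          X i zero               ≈⟨ X-column i ⟩
          0#                     ∎
        entry zero (suc j) = begin
          (X *ᴹ (1# ⊕ T)) zero (suc j)         ≈⟨ *ᴹ-⊕-suc 1# T (X zero) j ⟩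
          sum (λ k → X zero (suc k) * T k j)   ≈⟨ sum-0 (λ k → trans (*-congʳ (X-zero (suc k))) (zeroˡ (T k j))) ⟩
          0#                                   ∎
        entry (suc i) (suc j) = begin
          (X *ᴹ (1# ⊕ T)) (suc i) (suc j)        ≈⟨ *ᴹ-⊕-suc 1# T (X (suc i)) j ⟩
          sum (λ k → X (suc i) (suc k) * T k j)  ≈⟨ sum-cong (λ k → *-congʳ {T k j} (X-suc i (suc k))) ⟩
          ((R *ᴹ submatrix B) *ᴹ T) i j          ≈⟨ RBT≈0 i j ⟩
          0#                                     ∎

      -- Divided by `π`, the right factor becomes `diag (1/π, 1, …, 1)`: this is the division of the
      -- first column by `π`, written without fractions.
      column-vanishes : ∀ {n} (B : Matrix Carrier (suc n)) → (∀ i → B i zero ≈ 0#) → B *ᴹ (1# ⊕ scalar n) ≈ᴹ 0ᴹ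
      column-vanishes {n} B column≈0 i zero = begin
        (B *ᴹ (1# ⊕ scalar n)) i zero ≈⟨ *ᴹ-⊕-zero 1# (scalar n) (B i) ⟩
        B i zero * 1#                 ≈⟨ *-identityʳ (B i zero) ⟩
        B i zero                      ≈⟨ column≈0 i ⟩
        0#                            ∎
      column-vanishes {n} B column≈0 i (suc j) = begin
        (B *ᴹ (1# ⊕ scalar n)) i (suc j)             ≈⟨ *ᴹ-⊕-suc 1# (scalar n) (B i) j ⟩
        sum (λ k → B i (suc k) * scalar n k j)       ≈⟨ sum-0 (λ k → trans (*-congˡ (trans (*-congʳ π≈0) (zeroˡ (1ᴹ k j)))) (zeroʳ (B i (suc k)))) ⟩
        0#                                           ∎

      -- Up to the congruence the factor is `u x`, which shifts coefficients by one; hence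
      -- coefficient `suc k` of the product is compared with coefficient `k` of `g`.
      linear-factor : ∀ q u (g : Poly) → q ≈ 0# → ¬ u ≈ 0# → (∀ k → coeff ((q ∷ u ∷ []) *ᴾ g) k ≈ 0#) → ∀ k → coeff g k ≈ 0#
      linear-factor q u g q≈0 u≉0 vanishes k = cancelˡ u≉0 (begin
        u * coeff g k                                    ≈⟨ coeff-const-* u g k ⟨
        coeff ((u ∷ []) *ᴾ g) k                          ≈⟨ +-identityˡ _ ⟨
        0# + coeff ((u ∷ []) *ᴾ g) k
          ≈⟨ +-congʳ (trans (*-congʳ q≈0) (zeroˡ (coeff g (suc k)))) ⟨
        q * coeff g (suc k) + coeff ((u ∷ []) *ᴾ g) k    ≈⟨ coeff-*-suc q (u ∷ []) g k ⟨
        coeff ((q ∷ u ∷ []) *ᴾ g) (suc k)                ≈⟨ vanishes (suc k) ⟩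
        0#                                               ∎)

      -- The extra factor `π` avoids the exponent `n - 1`. In terms of `S = T / π` the equation says
      -- that `det R det S` is `u / π`.
      ReducesModulo : ∀ {n} → Matrix Carrier n → Matrix Carrier n → Set (c ⊔ ℓ₁ ⊔ ℓ₂)
      ReducesModulo {n} P Q = Σ (Matrix Carrier n) λ R → Σ (Matrix Carrier n) λ T → (R *ᴹ P) *ᴹ T ≈ᴹ 0ᴹ × (R *ᴹ Q) *ᴹ T ≈ᴹ 0ᴹ ×
        (∃[ u ] (Unit u × MA.det R * MA.det T * π A.≈ u * MA.det (scalar n)))

      module _ {n} (R₀ R₀′ S₀ S₀′ : Matrix Carrier (suc n))
        (R₀-inv : MA.IsInverse R₀ R₀′) (S₀-inv : MA.IsInverse S₀ S₀′) (P Q : Matrix Carrier (suc n)) where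
        private
          P₂ Q₂ : Matrix Carrier (suc n)
          P₂ = (R₀ *ᴹ P) *ᴹ S₀
          Q₂ = (R₀ *ᴹ Q) *ᴹ S₀

          unit₀ : Unit (MA.det R₀ * MA.det S₀)
          unit₀ = Unit-* (det-Unit R₀ R₀′ R₀-inv) (det-Unit S₀ S₀′ S₀-inv)

        -- Where the recursion stops. `D` has size `n + 1` and determinant `π` to the power `n`, one
        -- factor short of `scalar`; the other matrices contribute the unit.
        reduces-zero-column : (∀ i → P₂ i zero ≈ 0#) → (∀ i → Q₂ i zero ≈ 0#) → ReducesModulo P Q
        reduces-zero-column P₂≈0 Q₂≈0 = R₀ , S₀ *ᴹ D , vanish P P₂≈0 , vanish Q Q₂≈0 , MA.det R₀ * MA.det S₀ , unit₀ , count
          where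
          open SemiringSolver A.commutativeSemiring
          D : Matrix Carrier (suc n)
          D = 1# ⊕ scalar n
          vanish : ∀ B → (∀ i → ((R₀ *ᴹ B) *ᴹ S₀) i zero ≈ 0#) → (R₀ *ᴹ B) *ᴹ (S₀ *ᴹ D) ≈ᴹ 0ᴹ
          vanish B column≈0 i j = trans (sym (*ᴹ-assoc (R₀ *ᴹ B) S₀ D i j)) (column-vanishes ((R₀ *ᴹ B) *ᴹ S₀) column≈0 i j)
          count : MA.det R₀ * MA.det (S₀ MA.*ᴹ D) * π A.≈ MA.det R₀ * MA.det S₀ * MA.det (scalar (suc n))
          count = A.trans (A.*-congʳ (A.*-congˡ (A.trans (MA.det-* S₀ D) (A.*-congˡ (BA.det-⊕ 1# (scalar n))))))
            (A.trans (solve 4 (λ r s t p → (r :* (s :* (con 1 :* t)) :* p) := (r :* s :* (p :* t))) A.refl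
              (MA.det R₀) (MA.det S₀) (MA.det (scalar n)) π) (A.*-congˡ (A.sym (det-scalar n))))

        -- Passing from size `n` to `n + 1` adds one factor `π` to each side of the determinant
        -- equation; on the left it comes from `π ⊕ R`.
        reduces-submatrix : (∀ i → P₂ (suc i) zero ≈ 0#) → (∀ i → Q₂ (suc i) zero ≈ 0#) →
          ReducesModulo (submatrix P₂) (submatrix Q₂) → ReducesModulo P Q
        reduces-submatrix P₂≈0 Q₂≈0 (R , T , RPT≈0 , RQT≈0 , u , unit , count) =
          R₁ *ᴹ R₀ , S₀ *ᴹ T₁ , vanish P P₂≈0 RPT≈0 , vanish Q Q₂≈0 RQT≈0 , MA.det R₀ * MA.det S₀ * u , Unit-* unit₀ unit , count′
          where
          open SemiringSolver A.commutativeSemiring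
          R₁ T₁ : Matrix Carrier (suc n)
          R₁ = π ⊕ R
          T₁ = 1# ⊕ T
          vanish : ∀ B → (∀ i → ((R₀ *ᴹ B) *ᴹ S₀) (suc i) zero ≈ 0#) →
            (R *ᴹ submatrix ((R₀ *ᴹ B) *ᴹ S₀)) *ᴹ T ≈ᴹ 0ᴹ → ((R₁ *ᴹ R₀) *ᴹ B) *ᴹ (S₀ *ᴹ T₁) ≈ᴹ 0ᴹ
          vanish B column≈0 RBT≈0 i j = trans (regroup R₁ R₀ B S₀ T₁ i j)
            (block-vanishes ((R₀ *ᴹ B) *ᴹ S₀) R T column≈0 RBT≈0 i j)
          count′ : MA.det (R₁ MA.*ᴹ R₀) * MA.det (S₀ MA.*ᴹ T₁) * π A.≈ MA.det R₀ * MA.det S₀ * u * MA.det (scalar (suc n))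
          count′ = A.trans (A.*-congʳ (A.*-cong
              (A.trans (MA.det-* R₁ R₀) (A.*-congʳ (BA.det-⊕ π R)))
              (A.trans (MA.det-* S₀ T₁) (A.*-congˡ (BA.det-⊕ 1# T)))))
            (A.trans (solve 5 (λ r r₀ s₀ t p → (p :* r :* r₀ :* (s₀ :* (con 1 :* t)) :* p) := (r₀ :* s₀ :* p :* (r :* t :* p))) A.refl
              (MA.det R) (MA.det R₀) (MA.det S₀) (MA.det T) π)
            (A.trans (A.*-congˡ count)
            (A.trans (solve 5 (λ r₀ s₀ p u t → (r₀ :* s₀ :* p :* (u :* t)) := (r₀ :* s₀ :* u :* (p :* t))) A.refl
              (MA.det R₀) (MA.det S₀) π u (MA.det (scalar n)))
            (A.*-congˡ (A.sym (det-scalar n))))))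

        -- The transformed pencil still has zero determinant. Its first column splits off the factor
        -- `Q₂ zero zero + x P₂ zero zero`, whose constant term is zero and whose leading
        -- coefficient is not.
        detᴾ-submatrix : (∀ k → coeff (detᴾ P Q) k ≈ 0#) → (∀ i → P₂ (suc i) zero ≈ 0#) → (∀ i → Q₂ i zero ≈ 0#) →
          ¬ (P₂ zero zero ≈ 0#) → ∀ k → coeff (detᴾ (submatrix P₂) (submatrix Q₂)) k ≈ 0#
        detᴾ-submatrix det≈0 P₂≈0 Q₂≈0 u≉0 =
          linear-factor (Q₂ zero zero) (P₂ zero zero) (detᴾ (submatrix P₂) (submatrix Q₂)) (Q₂≈0 zero) u≉0 λ k → begin
            coeff ((Q₂ zero zero ∷ P₂ zero zero ∷ []) *ᴾ detᴾ (submatrix P₂) (submatrix Q₂)) k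
              ≈⟨ MatrixProperties.det-blockᵘ polyRing (pencil P₂ Q₂) column≈0 k ⟨
            coeff (detᴾ P₂ Q₂) k                          ≈⟨ coeff-detᴾ-*ʳ (R₀ *ᴹ P) (R₀ *ᴹ Q) S₀ k ⟩
            coeff (detᴾ (R₀ *ᴹ P) (R₀ *ᴹ Q)) k * det S₀   ≈⟨ *-congʳ (coeff-detᴾ-*ˡ R₀ P Q k) ⟩
            det R₀ * coeff (detᴾ P Q) k * det S₀          ≈⟨ *-congʳ (trans (*-congˡ (det≈0 k)) (zeroʳ (det R₀))) ⟩
            0# * det S₀                                   ≈⟨ zeroˡ (det S₀) ⟩
            0#                                            ∎
          where
          column≈0 : ∀ i k → coeff (pencil P₂ Q₂ (suc i) zero) k ≈ 0#
          column≈0 i zero          = Q₂≈0 (suc i)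
          column≈0 i (suc zero)    = P₂≈0 i
          column≈0 i (suc (suc _)) = refl

      -- The constant coefficient gives `det Q = 0`, hence a vanishing first column of `Q S₀`. `R₀`
      -- is chosen for the first column of `P S₀`; as it acts on rows, the zero column of `Q S₀`
      -- survives.
      singular-pencil : ∀ {n} (P Q : Matrix Carrier n) → (∀ k → coeff (detᴾ P Q) k ≈ 0#) → ReducesModulo P Q
      -- The empty determinant is 1, so its constant coefficient is not zero.
      singular-pencil {zero}  P Q det≈0 = contradiction (det≈0 zero) 1≉0
      singular-pencil {suc n} P Q det≈0 = fromColumn (singular-column Q (trans (sym (coeff-detᴾ-zero P Q)) (det≈0 zero)))
        where
        fromColumn : (Σ (Matrix Carrier (suc n)) λ S₀ → Σ (Matrix Carrier (suc n)) λ S₀′ →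
          MA.IsInverse S₀ S₀′ × (∀ i → (Q *ᴹ S₀) i zero ≈ 0#)) → ReducesModulo P Q
        fromColumn (S₀ , S₀′ , S₀-inv , QS₀≈0) = fromRows (reduceColumn (λ k → (P *ᴹ S₀) k zero))
          where
          fromRows : (Σ (Matrix Carrier (suc n)) λ R₀ → Σ (Matrix Carrier (suc n)) λ R₀′ →
            MA.IsInverse R₀ R₀′ × (∀ i → (R₀ MA.*ⱽ (λ k → (P *ᴹ S₀) k zero)) (suc i) A.≈ 0#)) → ReducesModulo P Q
          fromRows (R₀ , R₀′ , R₀-inv , kills) = decide (((R₀ *ᴹ P) *ᴹ S₀) zero zero ≈0?)
            where
            P₂≈0 : ∀ i → ((R₀ *ᴹ P) *ᴹ S₀) (suc i) zero ≈ 0#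
            P₂≈0 i = trans (*ᴹ-assoc R₀ P S₀ (suc i) zero) (coarser (kills i))
            Q₂≈0 : ∀ i → ((R₀ *ᴹ Q) *ᴹ S₀) i zero ≈ 0#
            Q₂≈0 i = trans (*ᴹ-assoc R₀ Q S₀ i zero) (sum-0 (λ k → trans (*-congˡ (QS₀≈0 k)) (zeroʳ (R₀ i k))))
            decide : Dec (((R₀ *ᴹ P) *ᴹ S₀) zero zero ≈ 0#) → ReducesModulo P Q
            decide (yes u≈0) = reduces-zero-column R₀ R₀′ S₀ S₀′ R₀-inv S₀-inv P Q
              (λ { zero → u≈0 ; (suc i) → P₂≈0 i }) Q₂≈0
            decide (no u≉0) = reduces-submatrix R₀ R₀′ S₀ S₀′ R₀-inv S₀-inv P Q P₂≈0 (Q₂≈0 ∘ suc)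
              (singular-pencil (submatrix ((R₀ *ᴹ P) *ᴹ S₀)) (submatrix ((R₀ *ᴹ Q) *ᴹ S₀))
                (detᴾ-submatrix R₀ R₀′ S₀ S₀′ R₀-inv S₀-inv P Q det≈0 P₂≈0 Q₂≈0 u≉0))

-- Matrices over a ring of fractions

module BlockInverse {c ℓ} (R : CommutativeRing c ℓ) where
  open CommutativeRing R hiding (zero)
  open MatrixProperties R
  open RingProperties ring using (-‿distribˡ-*; -‿distribʳ-*)
  open SemiringSum semiring using (∑-distrib-+; *-distribʳ-sum)
  open SetoidReasoning setoid

  module _ {n} (L : Matrix Carrier (suc n)) (row≈0 : ∀ j → L zero (suc j) ≈ 0#)
    (h : Carrier) (gh≈1 : L zero zero * h ≈ 1#) (N : Matrix Carrier n) (N-inv : IsInverse (submatrix L) N) where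

    column : Vector Carrier n
    column k = - (L (suc k) zero * h)

    -- For `L = (g 0; c M)`, with `h` inverse to `g` and `N` inverse to `M`, this is the triangular
    -- inverse with lower left block `- N c h`.
    blockInverse : Matrix Carrier (suc n)
    blockInverse zero    zero    = h
    blockInverse zero    (suc j) = 0#
    blockInverse (suc i) zero    = sum (λ k → N i k * column k)
    blockInverse (suc i) (suc j) = N i j

    blockInverseʳ : L *ᴹ blockInverse ≈ᴹ 1ᴹ
    blockInverseʳ zero zero = begin
      L zero zero * h + sum (λ k → L zero (suc k) * blockInverse (suc k) zero)
        ≈⟨ +-cong gh≈1 (sum-0 (λ k → trans (*-congʳ (row≈0 k)) (zeroˡ (blockInverse (suc k) zero)))) ⟩
      1# + 0# ≈⟨ +-identityʳ 1# ⟩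
      1# ∎
    blockInverseʳ zero (suc j) = begin
      L zero zero * 0# + sum (λ k → L zero (suc k) * N k j)
        ≈⟨ +-cong (zeroʳ (L zero zero)) (sum-0 (λ k → trans (*-congʳ (row≈0 k)) (zeroˡ (N k j)))) ⟩
      0# + 0# ≈⟨ +-identityʳ 0# ⟩
      0# ∎
    blockInverseʳ (suc i) zero = begin
      L (suc i) zero * h + sum (λ k → submatrix L i k * sum (λ l → N k l * column l))
        ≈⟨ +-congˡ (*ᴹ-*ⱽ-assoc (submatrix L) N column i) ⟨
      L (suc i) zero * h + sum (λ k → (submatrix L *ᴹ N) i k * column k)
        ≈⟨ +-congˡ (sum-cong (λ k → *-congʳ {column k} (proj₁ N-inv i k))) ⟩
      L (suc i) zero * h + sum (λ k → 1ᴹ i k * column k)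
        ≈⟨ +-congˡ (sum-1ᴹˡ i column) ⟩
      L (suc i) zero * h - L (suc i) zero * h
        ≈⟨ -‿inverseʳ (L (suc i) zero * h) ⟩
      0# ∎
    blockInverseʳ (suc i) (suc j) = begin
      L (suc i) zero * 0# + (submatrix L *ᴹ N) i j ≈⟨ +-cong (zeroʳ (L (suc i) zero)) (proj₁ N-inv i j) ⟩
      0# + 1ᴹ i j                                  ≈⟨ +-identityˡ (1ᴹ i j) ⟩
      1ᴹ i j                                       ≈⟨ reflexive (1ᴹ-suc i j) ⟨
      1ᴹ (suc i) (suc j)                           ∎

    blockInverseˡ : blockInverse *ᴹ L ≈ᴹ 1ᴹ
    blockInverseˡ zero zero = begin
      h * L zero zero + sum (λ k → 0# * L (suc k) zero)
        ≈⟨ +-cong (trans (*-comm h (L zero zero)) gh≈1) (sum-0 (λ k → zeroˡ (L (suc k) zero))) ⟩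
      1# + 0# ≈⟨ +-identityʳ 1# ⟩
      1# ∎
    blockInverseˡ zero (suc j) = begin
      h * L zero (suc j) + sum (λ k → 0# * L (suc k) (suc j))
        ≈⟨ +-cong (trans (*-congˡ (row≈0 j)) (zeroʳ h)) (sum-0 (λ k → zeroˡ (L (suc k) (suc j)))) ⟩
      0# + 0# ≈⟨ +-identityʳ 0# ⟩
      0# ∎
    blockInverseˡ (suc i) zero = begin
      sum (λ k → N i k * column k) * L zero zero + sum (λ k → N i k * L (suc k) zero)
        ≈⟨ +-congʳ (*-distribʳ-sum (L zero zero) (λ k → N i k * column k)) ⟩
      sum (λ k → N i k * column k * L zero zero) + sum (λ k → N i k * L (suc k) zero)
        ≈⟨ ∑-distrib-+ (λ k → N i k * column k * L zero zero) (λ k → N i k * L (suc k) zero) ⟨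
      sum (λ k → N i k * column k * L zero zero + N i k * L (suc k) zero)
        ≈⟨ sum-0 cancel ⟩
      0# ∎
      where
      cancel : ∀ k → N i k * column k * L zero zero + N i k * L (suc k) zero ≈ 0#
      cancel k = begin
        N i k * - (L (suc k) zero * h) * L zero zero + N i k * L (suc k) zero
          ≈⟨ +-congʳ (trans (*-congʳ (sym (-‿distribʳ-* (N i k) (L (suc k) zero * h)))) (sym (-‿distribˡ-* _ (L zero zero)))) ⟩
        - (N i k * (L (suc k) zero * h) * L zero zero) + N i k * L (suc k) zero
          ≈⟨ +-congʳ (-‿cong (solve 4 (λ n l h g → (n :* (l :* h) :* g) := (n :* l :* (g :* h))) refl
               (N i k) (L (suc k) zero) h (L zero zero))) ⟩
        - (N i k * L (suc k) zero * (L zero zero * h)) + N i k * L (suc k) zero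
          ≈⟨ +-congʳ (-‿cong (trans (*-congˡ gh≈1) (*-identityʳ _))) ⟩
        - (N i k * L (suc k) zero) + N i k * L (suc k) zero
          ≈⟨ -‿inverseˡ (N i k * L (suc k) zero) ⟩
        0# ∎
        where open SemiringSolver commutativeSemiring
    blockInverseˡ (suc i) (suc j) = begin
      blockInverse (suc i) zero * L zero (suc j) + (N *ᴹ submatrix L) i j
        ≈⟨ +-cong (trans (*-congˡ (row≈0 j)) (zeroʳ (blockInverse (suc i) zero))) (proj₂ N-inv i j) ⟩
      0# + 1ᴹ i j        ≈⟨ +-identityˡ (1ᴹ i j) ⟩
      1ᴹ i j             ≈⟨ reflexive (1ᴹ-suc i j) ⟨
      1ᴹ (suc i) (suc j) ∎

module NegatedMatrix {c ℓ} (R : CommutativeRing c ℓ) where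
  open CommutativeRing R hiding (zero)
  open MatrixProperties R
  open RingProperties ring using (-‿distribˡ-*; -‿distribʳ-*; -‿+-comm; -0#≈0#)

  negᴹ : ∀ {n} → Matrix Carrier n → Matrix Carrier n
  negᴹ M i j = - M i j

  sum-neg : ∀ {n} (f : Vector Carrier n) → sum (λ k → - f k) ≈ - sum f
  sum-neg {zero}  f = sym -0#≈0#
  sum-neg {suc n} f = trans (+-congˡ (sum-neg (f ∘ suc))) (-‿+-comm (f zero) (sum (f ∘ suc)))

  *ᴹ-negʳ : ∀ {n} (M N : Matrix Carrier n) → M *ᴹ negᴹ N ≈ᴹ negᴹ (M *ᴹ N)
  *ᴹ-negʳ M N i j = trans (sum-cong (λ k → sym (-‿distribʳ-* (M i k) (N k j)))) (sum-neg (λ k → M i k * N k j))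

  *ᴹ-neg-middle : ∀ {n} (L M N : Matrix Carrier n) → (L *ᴹ negᴹ M) *ᴹ N ≈ᴹ negᴹ ((L *ᴹ M) *ᴹ N)
  *ᴹ-neg-middle L M N i j = trans
    (sum-cong (λ k → trans (*-congʳ {N k j} (*ᴹ-negʳ L M i k)) (sym (-‿distribˡ-* ((L *ᴹ M) i k) (N k j)))))
    (sum-neg (λ k → (L *ᴹ M) i k * N k j))

module ScaledMatrix {c ℓ} (R : CommutativeRing c ℓ) where
  open CommutativeRing R hiding (zero)
  open MatrixProperties R
  open SemiringSum semiring using (*-distribˡ-sum)
  open SemiringSolver commutativeSemiring using (solve; _:=_; _:*_)
  open SetoidReasoning setoid

  scaleᴹ : ∀ {n} → Carrier → Matrix Carrier n → Matrix Carrier n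
  scaleᴹ h M i j = h * M i j

  *ᴹ-scaleᴹ : ∀ {n} h (M N : Matrix Carrier n) → M *ᴹ scaleᴹ h N ≈ᴹ scaleᴹ h (M *ᴹ N)
  *ᴹ-scaleᴹ h M N i j = trans
    (sum-cong (λ k → solve 3 (λ m h n → (m :* (h :* n)) := (h :* (m :* n))) refl (M i k) h (N k j)))
    (sym (*-distribˡ-sum h (λ k → M i k * N k j)))

  scaleᴹ-inverse : ∀ {n} h l (M N : Matrix Carrier n) → h * l ≈ 1# → IsInverse M N → IsInverse (scaleᴹ h M) (scaleᴹ l N)
  scaleᴹ-inverse h l M N hl≈1 (p , q) = cancel h l M N hl≈1 p , cancel l h N M (trans (*-comm l h) hl≈1) q
    where
    cancel : ∀ {n} h l (M N : Matrix Carrier n) → h * l ≈ 1# → M *ᴹ N ≈ᴹ 1ᴹ → scaleᴹ h M *ᴹ scaleᴹ l N ≈ᴹ 1ᴹ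
    cancel h l M N hl≈1 p i j = begin
      sum (λ k → h * M i k * (l * N k j))
        ≈⟨ sum-cong (λ k → solve 4 (λ h m l n → (h :* m :* (l :* n)) := (h :* l :* (m :* n))) refl h (M i k) l (N k j)) ⟩
      sum (λ k → h * l * (M i k * N k j)) ≈⟨ *-distribˡ-sum (h * l) (λ k → M i k * N k j) ⟨
      h * l * (M *ᴹ N) i j                ≈⟨ *-cong hl≈1 (p i j) ⟩
      1# * 1ᴹ i j                         ≈⟨ *-identityˡ (1ᴹ i j) ⟩
      1ᴹ i j                              ∎

  -- The factor `l` to the power `n` is kept as the determinant of a scalar matrix, the shape in
  -- which the reduction modulo a prime supplies it.
  det-unscale : ∀ {n} h l (M : Matrix Carrier n) → l * h ≈ 1# → det M ≈ det (scaleᴹ l (1ᴹ {n})) * det (scaleᴹ h M)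
  det-unscale h l M lh≈1 = trans (det-cong unscale) (det-* (scaleᴹ l 1ᴹ) (scaleᴹ h M))
    where
    unscale : M ≈ᴹ scaleᴹ l 1ᴹ *ᴹ scaleᴹ h M
    unscale i j = begin
      M i j                                   ≈⟨ *-identityˡ (M i j) ⟨
      1# * M i j                              ≈⟨ *-cong lh≈1 (*ᴹ-identityˡ M i j) ⟨
      l * h * (1ᴹ *ᴹ M) i j                   ≈⟨ *-distribˡ-sum (l * h) (λ k → 1ᴹ i k * M k j) ⟩
      sum (λ k → l * h * (1ᴹ i k * M k j))
        ≈⟨ sum-cong (λ k → solve 4 (λ l h e m → (l :* h :* (e :* m)) := (l :* e :* (h :* m))) refl l h (1ᴹ i k) (M k j)) ⟩
      sum (λ k → l * 1ᴹ i k * (h * M k j))    ∎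

module Fractions {a b ℓ₁ ℓ₂} (A : CommutativeRing a ℓ₁) (K : CommutativeRing b ℓ₂)
  {ι : CommutativeRing.Carrier A → CommutativeRing.Carrier K}
  (ι-homo : IsRingHomomorphism (CommutativeRing.rawRing A) (CommutativeRing.rawRing K) ι) where
  private
    module A  = CommutativeRing A
    module MA = MatrixProperties A
    module PA = PencilProperties A
    module BA = BlockMatrix A
    module BK = BlockMatrix K
    module Hom = MatrixHomomorphism A.rawRing K ι-homo
  open CommutativeRing K hiding (zero)
  open MatrixProperties K
  open PencilProperties K
  open NegatedMatrix K
  open PolynomialProperties K using (coeff; charPoly)
  open SetoidReasoning setoid
  open IsRingHomomorphism ι-homo using (⟦⟧-cong; 0#-homo; -‿homo)

  ιᴹ : ∀ {n} → Matrix A.Carrier n → Matrix Carrier n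
  ιᴹ M i j = ι (M i j)

  ιᴹ-inverse : ∀ {n} (S S′ : Matrix A.Carrier n) → MA.IsInverse S S′ → IsInverse (ιᴹ S) (ιᴹ S′)
  ιᴹ-inverse S S′ (p , q) = transfer S S′ p , transfer S′ S q
    where
    transfer : ∀ {n} (S S′ : Matrix A.Carrier n) → S MA.*ᴹ S′ MA.≈ᴹ MA.1ᴹ → ιᴹ S *ᴹ ιᴹ S′ ≈ᴹ 1ᴹ
    transfer S S′ p i j = trans (sym (Hom.*ᴹ-homo S S′ i j)) (trans (⟦⟧-cong (p i j)) (Hom.1ᴹ-homo i j))

  IsInverse-cong : ∀ {n} (M M′ N : Matrix Carrier n) → M ≈ᴹ M′ → IsInverse M N → IsInverse M′ N
  IsInverse-cong M M′ N M≈M′ (p , q) =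
    (λ i j → trans (sum-cong (λ k → *-congʳ {N k j} (sym (M≈M′ i k)))) (p i j)) ,
    (λ i j → trans (sum-cong (λ k → *-congˡ {N i k} (sym (M≈M′ k j)))) (q i j))

  HasInverse : ∀ {n} → Matrix Carrier n → Set (b ⊔ ℓ₂)
  HasInverse {n} M = Σ (Matrix Carrier n) (IsInverse M)

  module _ (integral : ∀ x y → x A.* y A.≈ A.0# → x A.≈ A.0# ⊎ y A.≈ A.0#)
    (reciprocal : ∀ x → ¬ (x A.≈ A.0#) → ∃[ h ] ι x * h ≈ 1#)
    (reduceRow : ∀ {n} (v : Vector A.Carrier (suc n)) →
      Σ (Matrix A.Carrier (suc n)) λ S → Σ (Matrix A.Carrier (suc n)) λ S′ →
      MA.IsInverse S S′ × (∀ j → MA.sum (λ k → v k A.* S k (suc j)) A.≈ A.0#)) where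

    -- A unimodular `S` makes `P S` block lower triangular. Both diagonal blocks are nonsingular,
    -- the smaller matrix is inverted by induction, and `S` times the inverse of `P S` inverts `P`.
    nonsingular⇒invertible : ∀ {n} (P : Matrix A.Carrier n) → ¬ (MA.det P A.≈ A.0#) → HasInverse (ιᴹ P)
    nonsingular⇒invertible {zero}  P det≉0 = ιᴹ P , (λ ()) , (λ ())
    nonsingular⇒invertible {suc n} P det≉0 = fromReduced (reduceRow (P zero))
      where
      fromReduced : (Σ (Matrix A.Carrier (suc n)) λ S → Σ (Matrix A.Carrier (suc n)) λ S′ →
        MA.IsInverse S S′ × (∀ j → MA.sum (λ k → P zero k A.* S k (suc j)) A.≈ A.0#)) → HasInverse (ιᴹ P)
      fromReduced (S , S′ , inv , row≈0) =
        fromBlocks (reciprocal (L zero zero) g≉0) (nonsingular⇒invertible (MA.submatrix L) sub≉0)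
        where
        L : Matrix A.Carrier (suc n)
        L = P MA.*ᴹ S
        detL : MA.det L A.≈ L zero zero A.* MA.det (MA.submatrix L)
        detL = MA.det-blockˡ L row≈0
        detL≉0 : ¬ (L zero zero A.* MA.det (MA.submatrix L) A.≈ A.0#)
        detL≉0 e = det≉0 (A.trans (A.sym (A.*-identityʳ (MA.det P)))
          (A.trans (A.*-congˡ (A.sym (BA.det-inverse S S′ inv)))
          (A.trans (A.sym (A.*-assoc (MA.det P) (MA.det S) (MA.det S′)))
          (A.trans (A.*-congʳ (A.trans (A.sym (MA.det-* P S)) (A.trans detL e))) (A.zeroˡ (MA.det S′))))))
        g≉0 : ¬ (L zero zero A.≈ A.0#)
        g≉0 e = detL≉0 (A.trans (A.*-congʳ e) (A.zeroˡ (MA.det (MA.submatrix L))))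
        sub≉0 : ¬ (MA.det (MA.submatrix L) A.≈ A.0#)
        sub≉0 e = detL≉0 (A.trans (A.*-congˡ e) (A.zeroʳ (L zero zero)))
        fromBlocks : (∃[ h ] ι (L zero zero) * h ≈ 1#) → HasInverse (ιᴹ (MA.submatrix L)) → HasInverse (ιᴹ P)
        fromBlocks (h , gh≈1) (N , N-inv) = ιᴹ S *ᴹ X , IsInverse-cong (ιᴹ L *ᴹ ιᴹ S′) (ιᴹ P) (ιᴹ S *ᴹ X) LS′≈P
          (BK.IsInverse-* (ιᴹ L) X (ιᴹ S′) (ιᴹ S)
            (BlockInverse.blockInverseʳ K (ιᴹ L) ιrow≈0 h gh≈1 N N-inv , BlockInverse.blockInverseˡ K (ιᴹ L) ιrow≈0 h gh≈1 N N-inv)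
            (ιᴹ-inverse S′ S (proj₂ inv , proj₁ inv)))
          where
          ιrow≈0 : ∀ j → ι (L zero (suc j)) ≈ 0#
          ιrow≈0 j = trans (⟦⟧-cong (row≈0 j)) 0#-homo
          X : Matrix Carrier (suc n)
          X = BlockInverse.blockInverse K (ιᴹ L) ιrow≈0 h gh≈1 N N-inv
          LS′≈P : ιᴹ L *ᴹ ιᴹ S′ ≈ᴹ ιᴹ P
          LS′≈P i j = trans (sym (Hom.*ᴹ-homo L S′ i j)) (⟦⟧-cong
            (A.trans (MA.*ᴹ-assoc P S S′ i j)
            (A.trans (MA.sum-cong (λ k → A.*-congˡ {P i k} (proj₁ inv k j))) (MA.*ᴹ-identityʳ P i j))))

  ι-det : ∀ {n} (P : Matrix A.Carrier n) → ι (MA.det P) ≈ det (ιᴹ P)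
  ι-det = Hom.det-homo

  ι-detᴾ : ∀ {n} (P Q : Matrix A.Carrier n) k →
    ι (PolynomialOver.coeff A.rawRing (PA.detᴾ P (λ i j → A.- Q i j)) k) ≈ coeff (detᴾ (ιᴹ P) (negᴹ (ιᴹ Q))) k
  ι-detᴾ P Q k = trans (PolynomialMap.coeff-detᴾ-homo A K ι-homo P (λ i j → A.- Q i j) k)
    (detᴾ-cong {P = ιᴹ P} {ιᴹ P} {ιᴹ (λ i j → A.- Q i j)} {negᴹ (ιᴹ Q)} (λ i j → refl) (λ i j → -‿homo (Q i j)) k)

  -- This is `P (x - P⁻¹ Q) = x P - Q`, read through multiplicativity of the pencil determinant.
  det-charPoly : ∀ {n} (P P⁻¹ Q : Matrix Carrier n) → IsInverse P P⁻¹ → ∀ k →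
    det P * coeff (charPoly (P⁻¹ *ᴹ Q)) k ≈ coeff (detᴾ P (negᴹ Q)) k
  det-charPoly P P⁻¹ Q inv k = begin
    det P * coeff (charPoly (P⁻¹ *ᴹ Q)) k
      ≈⟨ *-congˡ (charPoly-detᴾ (P⁻¹ *ᴹ Q) k) ⟩
    det P * coeff (detᴾ 1ᴹ (negᴹ (P⁻¹ *ᴹ Q))) k
      ≈⟨ coeff-detᴾ-*ˡ P 1ᴹ (negᴹ (P⁻¹ *ᴹ Q)) k ⟨
    coeff (detᴾ (P *ᴹ 1ᴹ) (P *ᴹ negᴹ (P⁻¹ *ᴹ Q))) k
      ≈⟨ detᴾ-cong {P = P *ᴹ 1ᴹ} {P} {P *ᴹ negᴹ (P⁻¹ *ᴹ Q)} {negᴹ Q} (*ᴹ-identityʳ P) Q-eq k ⟩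
    coeff (detᴾ P (negᴹ Q)) k ∎
    where
    Q-eq : P *ᴹ negᴹ (P⁻¹ *ᴹ Q) ≈ᴹ negᴹ Q
    Q-eq i j = trans (*ᴹ-negʳ P (P⁻¹ *ᴹ Q) i j) (-‿cong (begin
      (P *ᴹ (P⁻¹ *ᴹ Q)) i j  ≈⟨ *ᴹ-assoc P P⁻¹ Q i j ⟨
      ((P *ᴹ P⁻¹) *ᴹ Q) i j  ≈⟨ sum-cong (λ k → *-congʳ {Q k j} (proj₁ inv i k)) ⟩
      (1ᴹ *ᴹ Q) i j          ≈⟨ *ᴹ-identityˡ Q i j ⟩
      Q i j                  ∎))

  detᴾ-*-* : ∀ {n} (R P Q S : Matrix Carrier n) k →
    coeff (detᴾ ((R *ᴹ P) *ᴹ S) (negᴹ ((R *ᴹ Q) *ᴹ S))) k ≈ det R * det S * coeff (detᴾ P (negᴹ Q)) k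
  detᴾ-*-* R P Q S k = begin
    coeff (detᴾ ((R *ᴹ P) *ᴹ S) (negᴹ ((R *ᴹ Q) *ᴹ S))) k
      ≈⟨ detᴾ-cong {P = (R *ᴹ P) *ᴹ S} {(R *ᴹ P) *ᴹ S} {negᴹ ((R *ᴹ Q) *ᴹ S)} {(R *ᴹ negᴹ Q) *ᴹ S} (λ i j → refl) (≈ᴹ-sym (*ᴹ-neg-middle R Q S)) k ⟩
    coeff (detᴾ ((R *ᴹ P) *ᴹ S) ((R *ᴹ negᴹ Q) *ᴹ S)) k
      ≈⟨ coeff-detᴾ-*ʳ (R *ᴹ P) (R *ᴹ negᴹ Q) S k ⟩
    coeff (detᴾ (R *ᴹ P) (R *ᴹ negᴹ Q)) k * det S
      ≈⟨ *-congʳ (coeff-detᴾ-*ˡ R P (negᴹ Q) k) ⟩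
    det R * coeff (detᴾ P (negᴹ Q)) k * det S
      ≈⟨ solve 3 (λ r c s → (r :* c :* s) := (r :* s :* c)) refl (det R) (coeff (detᴾ P (negᴹ Q)) k) (det S) ⟩
    det R * det S * coeff (detᴾ P (negᴹ Q)) k ∎
    where
    open SemiringSolver commutativeSemiring using (solve; _:=_; _:*_)

  pencil-transform : ∀ {n} (R S : Matrix Carrier n) (P Q P₂ Q₂ : Matrix A.Carrier n) →
    (R *ᴹ ιᴹ P) *ᴹ S ≈ᴹ ιᴹ P₂ → (R *ᴹ ιᴹ Q) *ᴹ S ≈ᴹ ιᴹ Q₂ → ∀ k →
    det R * det S * ι (PolynomialOver.coeff A.rawRing (PA.detᴾ P (λ i j → A.- Q i j)) k) ≈
    ι (PolynomialOver.coeff A.rawRing (PA.detᴾ P₂ (λ i j → A.- Q₂ i j)) k)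
  pencil-transform R S P Q P₂ Q₂ RPS≈P₂ RQS≈Q₂ k = begin
    det R * det S * ι (PolynomialOver.coeff A.rawRing (PA.detᴾ P (λ i j → A.- Q i j)) k)
      ≈⟨ *-congˡ (ι-detᴾ P Q k) ⟩
    det R * det S * coeff (detᴾ (ιᴹ P) (negᴹ (ιᴹ Q))) k
      ≈⟨ detᴾ-*-* R (ιᴹ P) (ιᴹ Q) S k ⟨
    coeff (detᴾ ((R *ᴹ ιᴹ P) *ᴹ S) (negᴹ ((R *ᴹ ιᴹ Q) *ᴹ S))) k
      ≈⟨ detᴾ-cong {P = (R *ᴹ ιᴹ P) *ᴹ S} {ιᴹ P₂} {negᴹ ((R *ᴹ ιᴹ Q) *ᴹ S)} {negᴹ (ιᴹ Q₂)}
           RPS≈P₂ (λ i j → -‿cong (RQS≈Q₂ i j)) k ⟩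
    coeff (detᴾ (ιᴹ P₂) (negᴹ (ιᴹ Q₂))) k
      ≈⟨ ι-detᴾ P₂ Q₂ k ⟨
    ι (PolynomialOver.coeff A.rawRing (PA.detᴾ P₂ (λ i j → A.- Q₂ i j)) k) ∎

-- Integers and rationals

open ≡ using (refl; sym; trans; cong; cong₂; subst; module ≡-Reasoning)

ℤ-ring ℚ-ring : CommutativeRing 0ℓ 0ℓ
ℤ-ring = ℤ.+-*-commutativeRing
ℚ-ring = ℚ.+-*-commutativeRing

private
  module Mℤ = MatrixProperties ℤ-ring
  module Mℚ = MatrixProperties ℚ-ring
  module Bℤ = BlockMatrix ℤ-ring

-- Euclidean column reduction over ℤ and congruences

module IntegerReduction where
  open import Data.Integer.Base using (_+_; _*_; -_; _-_)
  open import Data.Integer.Divisibility.Signed using (∣m∣n⇒∣m+n; ∣m⇒∣-m; ∣m⇒∣m*n; ∣n⇒∣m*n)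

  -- Euclid's algorithm on `(x, y)`, with the row operations collected in a matrix of determinant 1.
  -- The bound `n` on the absolute value of `y` drives the recursion.
  bezout : ∀ x y → ∃[ a ] ∃[ b ] ∃[ c ] ∃[ d ] (a * d - b * c ≡ 1ℤ × c * x + d * y ≡ 0ℤ)
  bezout x y = go ∣ y ∣ x y ℕ.≤-refl
    where
    Result : ℤ → ℤ → Set
    Result x y = ∃[ a ] ∃[ b ] ∃[ c ] ∃[ d ] (a * d - b * c ≡ 1ℤ × c * x + d * y ≡ 0ℤ)
    go : ∀ n x y → ∣ y ∣ ℕ.≤ n → Result x y
    divide : ∀ n x y .{{_ : ℤ.NonZero y}} → ∣ y ∣ ℕ.≤ suc n → Result x y
    go n       x (+ zero)      _   = 1ℤ , 0ℤ , 0ℤ , 1ℤ , refl , refl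
    go (suc n) x y@(+ suc _)   y≤n = divide n x y y≤n
    go (suc n) x y@(-[1+ _ ])  y≤n = divide n x y y≤n
    divide n x y y≤n =
      let q = x ℤ./ y ; r = + (x ℤ.% y)
          a , b , c , d , unit , kill = go n y r (ℕ.s≤s⁻¹ (ℕ.≤-trans (ℤ.n%d<d x y) y≤n))
      -- The remainder step is the matrix `(0 1; 1 -q)`, which sends `(x, y)` to `(y, r)`. Its
      -- determinant is -1; negating the first row of the product restores 1.
      in  - b , - (a - b * q) , d , c - d * q
          , trans (det-step a b c d q) unit
          , trans (trans (cong (λ z → d * z + (c - d * q) * y) (ℤ.a≡a%n+[a/n]*n x y)) (kill-step c d q r y)) kill
      where
      det-step : ∀ a b c d q → - b * (c - d * q) - (- (a - b * q)) * d ≡ a * d - b * c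
      det-step = solve-∀
      kill-step : ∀ c d q r y → d * (r + q * y) + (c - d * q) * y ≡ c * y + d * r
      kill-step = solve-∀

  rotation : ∀ {n} → ℤ → ℤ → ℤ → ℤ → Matrix ℤ (suc (suc n))
  rotation a b c d zero          zero          = a
  rotation a b c d zero          (suc zero)    = b
  rotation a b c d zero          (suc (suc j)) = 0ℤ
  rotation a b c d (suc zero)    zero          = c
  rotation a b c d (suc zero)    (suc zero)    = d
  rotation a b c d (suc zero)    (suc (suc j)) = 0ℤ
  rotation a b c d (suc (suc i)) zero          = 0ℤ
  rotation a b c d (suc (suc i)) (suc zero)    = 0ℤ
  rotation a b c d (suc (suc i)) (suc (suc j)) = Mℤ.1ᴹ i j

  rotation-zero : ∀ {n} a b c d (v : Vector ℤ (suc (suc n))) →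
    Mℤ.sum (λ k → rotation a b c d zero k * v k) ≡ a * v zero + b * v (suc zero)
  rotation-zero a b c d v = cong (_+_ (a * v zero))
    (trans (cong (_+_ (b * v (suc zero))) (Mℤ.sum-0 (λ k → ℤ.*-zeroˡ (v (suc (suc k)))))) (ℤ.+-identityʳ _))

  rotation-one : ∀ {n} a b c d (v : Vector ℤ (suc (suc n))) →
    Mℤ.sum (λ k → rotation a b c d (suc zero) k * v k) ≡ c * v zero + d * v (suc zero)
  rotation-one a b c d v = cong (_+_ (c * v zero))
    (trans (cong (_+_ (d * v (suc zero))) (Mℤ.sum-0 (λ k → ℤ.*-zeroˡ (v (suc (suc k)))))) (ℤ.+-identityʳ _))

  rotation-rest : ∀ {n} a b c d (v : Vector ℤ (suc (suc n))) i →
    Mℤ.sum (λ k → rotation a b c d (suc (suc i)) k * v k) ≡ v (suc (suc i))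
  rotation-rest a b c d v i =
    trans (cong₂ _+_ (ℤ.*-zeroˡ (v zero)) (cong₂ _+_ (ℤ.*-zeroˡ (v (suc zero))) (Mℤ.sum-1ᴹˡ i (λ k → v (suc (suc k))))))
      (trans (ℤ.+-identityˡ _) (ℤ.+-identityˡ _))

  rotation-* : ∀ {n} {a b c d a′ b′ c′ d′} →
    a * a′ + b * c′ ≡ 1ℤ → a * b′ + b * d′ ≡ 0ℤ → c * a′ + d * c′ ≡ 0ℤ → c * b′ + d * d′ ≡ 1ℤ →
    rotation {n} a b c d Mℤ.*ᴹ rotation a′ b′ c′ d′ Mℤ.≈ᴹ Mℤ.1ᴹ
  rotation-* {a = a} {b} {c} {d} {a′} {b′} {c′} {d′} e₁ e₂ e₃ e₄ = entry
    where
    M′ = rotation a′ b′ c′ d′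
    zeros : ∀ x y → x * 0ℤ + y * 0ℤ ≡ 0ℤ
    zeros = solve-∀
    entry : rotation a b c d Mℤ.*ᴹ M′ Mℤ.≈ᴹ Mℤ.1ᴹ
    entry zero          zero          = trans (rotation-zero a b c d (λ k → M′ k zero)) e₁
    entry zero          (suc zero)    = trans (rotation-zero a b c d (λ k → M′ k (suc zero))) e₂
    entry zero          (suc (suc j)) = trans (rotation-zero a b c d (λ k → M′ k (suc (suc j)))) (zeros a b)
    entry (suc zero)    zero          = trans (rotation-one a b c d (λ k → M′ k zero)) e₃
    entry (suc zero)    (suc zero)    = trans (rotation-one a b c d (λ k → M′ k (suc zero))) e₄
    entry (suc zero)    (suc (suc j)) = trans (rotation-one a b c d (λ k → M′ k (suc (suc j)))) (zeros c d)
    entry (suc (suc i)) zero          = rotation-rest a b c d (λ k → M′ k zero) i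
    entry (suc (suc i)) (suc zero)    = rotation-rest a b c d (λ k → M′ k (suc zero)) i
    entry (suc (suc i)) (suc (suc j)) = trans (rotation-rest a b c d (λ k → M′ k (suc (suc j))) i)
      (sym (trans (Mℤ.1ᴹ-suc (suc i) (suc j)) (Mℤ.1ᴹ-suc i j)))

  rotation-inverse : ∀ {n} a b c d → a * d - b * c ≡ 1ℤ → Mℤ.IsInverse (rotation {n} a b c d) (rotation d (- b) (- c) a)
  rotation-inverse a b c d unit =
    rotation-* (trans (e₁ a b c d) unit) (e₂ a b) (e₃ c d) (trans (e₄ a b c d) unit) ,
    rotation-* (trans (e₅ a b c d) unit) (e₆ b d) (e₇ a c) (trans (e₈ a b c d) unit)
    where
    e₁ : ∀ a b c d → a * d + b * - c ≡ a * d - b * c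
    e₁ = solve-∀
    e₂ : ∀ a b → a * - b + b * a ≡ 0ℤ
    e₂ = solve-∀
    e₃ : ∀ c d → c * d + d * - c ≡ 0ℤ
    e₃ = solve-∀
    e₄ : ∀ a b c d → c * - b + d * a ≡ a * d - b * c
    e₄ = solve-∀
    e₅ : ∀ a b c d → d * a + - b * c ≡ a * d - b * c
    e₅ = solve-∀
    e₆ : ∀ b d → d * b + - b * d ≡ 0ℤ
    e₆ = solve-∀
    e₇ : ∀ a c → - c * a + a * c ≡ 0ℤ
    e₇ = solve-∀
    e₈ : ∀ a b c d → - c * b + a * d ≡ a * d - b * c
    e₈ = solve-∀

  -- The recursion clears the tail of `v` down to its first entry, and a `bezout` matrix in the
  -- first two coordinates clears that one.
  reduceColumn : ∀ {n} (v : Vector ℤ (suc n)) →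
    ∃[ R ] ∃[ R′ ] (Mℤ.IsInverse R R′ × (∀ i → (R Mℤ.*ⱽ v) (suc i) ≡ 0ℤ))
  reduceColumn {zero}  v = Mℤ.1ᴹ , Mℤ.1ᴹ , Bℤ.IsInverse-1 , λ ()
  reduceColumn {suc n} v with reduceColumn (v ∘ suc)
  ... | R , R′ , inv , R-kills with bezout (v zero) ((R Mℤ.*ⱽ (v ∘ suc)) zero)
  ...   | a , b , c , d , unit , kill =
    rot Mℤ.*ᴹ R₁ , R₁′ Mℤ.*ᴹ rot′ ,
    Bℤ.IsInverse-* rot rot′ R₁ R₁′ (rotation-inverse a b c d unit) (Bℤ.IsInverse-⊕ R R′ inv) , kills
    where
    rot  = rotation a b c d
    rot′ = rotation d (- b) (- c) a
    R₁   = 1ℤ Bℤ.⊕ R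
    R₁′  = 1ℤ Bℤ.⊕ R′
    w : Vector ℤ (suc (suc n))
    w k = Mℤ.sum (λ l → R₁ k l * v l)
    w-zero : w zero ≡ v zero
    w-zero = trans (Bℤ.⊕-*ᴹ-zero 1ℤ R v) (ℤ.*-identityˡ _)
    w-suc : ∀ k → w (suc k) ≡ (R Mℤ.*ⱽ (v ∘ suc)) k
    w-suc = Bℤ.⊕-*ᴹ-suc 1ℤ R v
    kills : ∀ i → ((rot Mℤ.*ᴹ R₁) Mℤ.*ⱽ v) (suc i) ≡ 0ℤ
    kills zero = begin
      ((rot Mℤ.*ᴹ R₁) Mℤ.*ⱽ v) (suc zero)       ≡⟨ Mℤ.*ᴹ-*ⱽ-assoc rot R₁ v (suc zero) ⟩
      Mℤ.sum (λ k → rot (suc zero) k * w k)     ≡⟨ rotation-one a b c d w ⟩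
      c * w zero + d * w (suc zero)             ≡⟨ cong₂ (λ x y → c * x + d * y) w-zero (w-suc zero) ⟩
      c * v zero + d * (R Mℤ.*ⱽ (v ∘ suc)) zero ≡⟨ kill ⟩
      0ℤ                                        ∎
      where open ≡-Reasoning
    kills (suc i) = begin
      ((rot Mℤ.*ᴹ R₁) Mℤ.*ⱽ v) (suc (suc i))      ≡⟨ Mℤ.*ᴹ-*ⱽ-assoc rot R₁ v (suc (suc i)) ⟩
      Mℤ.sum (λ k → rot (suc (suc i)) k * w k)    ≡⟨ rotation-rest a b c d w i ⟩
      w (suc (suc i))                             ≡⟨ w-suc (suc i) ⟩
      (R Mℤ.*ⱽ (v ∘ suc)) (suc i)                 ≡⟨ R-kills i ⟩
      0ℤ                                          ∎
      where open ≡-Reasoning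

  -- Residues are integers under a coarser equality, so one integer matrix can be read over ℤ and
  -- modulo `m`. The value 0 is allowed for `m` and gives back equality.
  module Modular (m : ℤ) where

    infix 4 _≈ₘ_
    -- A record, so that Agda can recover x and y from x ≈ₘ y.
    record _≈ₘ_ (x y : ℤ) : Set where
      constructor congruent
      field difference : m Signed.∣ x - y
    open _≈ₘ_

    ≡⇒≈ₘ : ∀ {x y} → x ≡ y → x ≈ₘ y
    ≡⇒≈ₘ {x} refl = congruent (Signed.divides 0ℤ (trans (ℤ.+-inverseʳ x) (sym (ℤ.*-zeroˡ m))))

    private
      via : ∀ {x y z} → z ≡ x - y → m Signed.∣ z → x ≈ₘ y
      via e d = congruent (subst (m Signed.∣_) e d)

    isCommutativeRing : IsCommutativeRing _≈ₘ_ _+_ _*_ -_ 0ℤ 1ℤ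
    isCommutativeRing = record
      { isRing = record
        { +-isAbelianGroup = record
          { isGroup = record
            { isMonoid = record
              { isSemigroup = record
                { isMagma = record
                  { isEquivalence = record
                    { refl  = ≡⇒≈ₘ refl
                    ; sym   = λ {x} {y} p → via (sym-eq x y) (∣m⇒∣-m (difference p))
                    ; trans = λ {x} {y} {z} p q → via (trans-eq x y z) (∣m∣n⇒∣m+n (difference p) (difference q))
                    }
                  ; ∙-cong = λ {x} {y} {u} {v} p q → via (+-eq x y u v) (∣m∣n⇒∣m+n (difference p) (difference q))
                  }
                ; assoc = λ x y z → ≡⇒≈ₘ (ℤ.+-assoc x y z)
                }
              ; identity = (λ x → ≡⇒≈ₘ (ℤ.+-identityˡ x)) , (λ x → ≡⇒≈ₘ (ℤ.+-identityʳ x))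
              }
            ; inverse = (λ x → ≡⇒≈ₘ (ℤ.+-inverseˡ x)) , (λ x → ≡⇒≈ₘ (ℤ.+-inverseʳ x))
            ; ⁻¹-cong = λ {x} {y} p → via (neg-eq x y) (∣m⇒∣-m (difference p))
            }
          ; comm = λ x y → ≡⇒≈ₘ (ℤ.+-comm x y)
          }
        ; *-cong = λ {x} {y} {u} {v} p q →
            via (*-eq x y u v) (∣m∣n⇒∣m+n (∣m⇒∣m*n u (difference p)) (∣n⇒∣m*n y (difference q)))
        ; *-assoc = λ x y z → ≡⇒≈ₘ (ℤ.*-assoc x y z)
        ; *-identity = (λ x → ≡⇒≈ₘ (ℤ.*-identityˡ x)) , (λ x → ≡⇒≈ₘ (ℤ.*-identityʳ x))
        ; distrib = (λ x y z → ≡⇒≈ₘ (ℤ.*-distribˡ-+ x y z)) , (λ x y z → ≡⇒≈ₘ (ℤ.*-distribʳ-+ x y z))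
        }
      ; *-comm = λ x y → ≡⇒≈ₘ (ℤ.*-comm x y)
      }
      where
      sym-eq : ∀ x y → - (x - y) ≡ y - x
      sym-eq = solve-∀
      trans-eq : ∀ x y z → (x - y) + (y - z) ≡ x - z
      trans-eq = solve-∀
      +-eq : ∀ x y u v → (x - y) + (u - v) ≡ (x + u) - (y + v)
      +-eq = solve-∀
      neg-eq : ∀ x y → - (x - y) ≡ (- x) - (- y)
      neg-eq = solve-∀
      *-eq : ∀ x y u v → (x - y) * u + y * (u - v) ≡ x * u - y * v
      *-eq = solve-∀

    modularRing : CommutativeRing 0ℓ 0ℓ
    modularRing = record { isCommutativeRing = isCommutativeRing }

    ∣⇒≈0 : ∀ {x} → m Signed.∣ x → x ≈ₘ 0ℤ
    ∣⇒≈0 {x} = via (sym (ℤ.+-identityʳ x))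

    ≈0⇒∣ : ∀ {x} → x ≈ₘ 0ℤ → m Signed.∣ x
    ≈0⇒∣ {x} p = subst (m Signed.∣_) (ℤ.+-identityʳ x) (difference p)

    m≈0 : m ≈ₘ 0ℤ
    m≈0 = ∣⇒≈0 (Signed.divides 1ℤ (sym (ℤ.*-identityˡ m)))

    _≈0? : ∀ x → Dec (x ≈ₘ 0ℤ)
    x ≈0? = map′ ∣⇒≈0 ≈0⇒∣ (m Signed.∣? x)

    -- The identity on integers; as a homomorphism it carries determinants over ℤ to determinants
    -- modulo `m`.
    reduction-homo : IsRingHomomorphism ℤ.+-*-rawRing (CommutativeRing.rawRing modularRing) id
    reduction-homo = mkRingHomomorphism id ≡⇒≈ₘ
      (λ _ _ → ≡⇒≈ₘ refl) (λ _ _ → ≡⇒≈ₘ refl) (λ _ → ≡⇒≈ₘ refl) (≡⇒≈ₘ refl) (≡⇒≈ₘ refl)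

open IntegerReduction

-- The embedding of ℤ into ℚ

toℚᵘ-fromℤ : ∀ z → ℚ.toℚᵘ (fromℤ z) ℚᵘ.≃ mkℚᵘ z 0
toℚᵘ-fromℤ z = ℚ.toℚᵘ-fromℚᵘ (mkℚᵘ z 0)

fromℤ-injective : ∀ {x y} → fromℤ x ≡ fromℤ y → x ≡ y
fromℤ-injective {x} {y} e with ℚ.fromℚᵘ-injective {mkℚᵘ x 0} {mkℚᵘ y 0} e
... | *≡* x*1≡y*1 = trans (sym (ℤ.*-identityʳ x)) (trans x*1≡y*1 (ℤ.*-identityʳ y))

fromℤ-+ : ∀ x y → fromℤ (x ℤ.+ y) ≡ fromℤ x ℚ.+ fromℤ y
fromℤ-+ x y = ℚ.toℚᵘ-injective (begin
  ℚ.toℚᵘ (fromℤ (x ℤ.+ y))                   ≈⟨ toℚᵘ-fromℤ (x ℤ.+ y) ⟩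
  mkℚᵘ (x ℤ.+ y) 0                           ≈⟨ *≡* (eq x y) ⟩
  mkℚᵘ x 0 ℚᵘ.+ mkℚᵘ y 0                     ≈⟨ ℚᵘ.+-cong (toℚᵘ-fromℤ x) (toℚᵘ-fromℤ y) ⟨
  ℚ.toℚᵘ (fromℤ x) ℚᵘ.+ ℚ.toℚᵘ (fromℤ y)     ≈⟨ ℚ.toℚᵘ-homo-+ (fromℤ x) (fromℤ y) ⟨
  ℚ.toℚᵘ (fromℤ x ℚ.+ fromℤ y)               ∎)
  where
  open ℚᵘ.≃-Reasoning
  eq : ∀ x y → (x ℤ.+ y) ℤ.* 1ℤ ≡ (x ℤ.* 1ℤ ℤ.+ y ℤ.* 1ℤ) ℤ.* 1ℤ
  eq = solve-∀

fromℤ-* : ∀ x y → fromℤ (x ℤ.* y) ≡ fromℤ x ℚ.* fromℤ y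
fromℤ-* x y = ℚ.toℚᵘ-injective (begin
  ℚ.toℚᵘ (fromℤ (x ℤ.* y))                   ≈⟨ toℚᵘ-fromℤ (x ℤ.* y) ⟩
  mkℚᵘ x 0 ℚᵘ.* mkℚᵘ y 0                     ≈⟨ ℚᵘ.*-cong (toℚᵘ-fromℤ x) (toℚᵘ-fromℤ y) ⟨
  ℚ.toℚᵘ (fromℤ x) ℚᵘ.* ℚ.toℚᵘ (fromℤ y)     ≈⟨ ℚ.toℚᵘ-homo-* (fromℤ x) (fromℤ y) ⟨
  ℚ.toℚᵘ (fromℤ x ℚ.* fromℤ y)               ∎)
  where open ℚᵘ.≃-Reasoning

fromℤ-neg : ∀ x → fromℤ (ℤ.- x) ≡ ℚ.- fromℤ x
fromℤ-neg x = ℚ.toℚᵘ-injective (begin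
  ℚ.toℚᵘ (fromℤ (ℤ.- x))      ≈⟨ toℚᵘ-fromℤ (ℤ.- x) ⟩
  ℚᵘ.- mkℚᵘ x 0               ≈⟨ ℚᵘ.-‿cong (toℚᵘ-fromℤ x) ⟨
  ℚᵘ.- ℚ.toℚᵘ (fromℤ x)       ≈⟨ ℚ.toℚᵘ-homo‿- (fromℤ x) ⟨
  ℚ.toℚᵘ (ℚ.- fromℤ x)        ∎)
  where open ℚᵘ.≃-Reasoning

fromℤ-abs : ∀ z → ℚ.∣ fromℤ z ∣ ≡ fromℤ (+ ∣ z ∣)
fromℤ-abs z = ℚ.toℚᵘ-injective (begin
  ℚ.toℚᵘ ℚ.∣ fromℤ z ∣       ≈⟨ ℚ.toℚᵘ-homo-∣-∣ (fromℤ z) ⟩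
  ℚᵘ.∣ ℚ.toℚᵘ (fromℤ z) ∣    ≈⟨ ℚᵘ.∣-∣-cong (toℚᵘ-fromℤ z) ⟩
  mkℚᵘ (+ ∣ z ∣) 0           ≈⟨ toℚᵘ-fromℤ (+ ∣ z ∣) ⟨
  ℚ.toℚᵘ (fromℤ (+ ∣ z ∣))   ∎)
  where open ℚᵘ.≃-Reasoning

fromℤ-mono-< : ∀ {m n} → m ℕ.< n → fromℤ (+ m) ℚ.< fromℤ (+ n)
fromℤ-mono-< {m} {n} m<n = ℚ.toℚᵘ-cancel-< (ℚᵘ.<-respˡ-≃ (ℚᵘ.≃-sym (toℚᵘ-fromℤ (+ m)))
  (ℚᵘ.<-respʳ-≃ (ℚᵘ.≃-sym (toℚᵘ-fromℤ (+ n)))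
    (*<* (ℤ.*-monoʳ-<-pos 1ℤ (ℤ.+<+ m<n)))))

fromℤ-mono-≤ : ∀ {m n} → m ℕ.≤ n → fromℤ (+ m) ℚ.≤ fromℤ (+ n)
fromℤ-mono-≤ {m} {n} m≤n with ℕ.m≤n⇒m<n∨m≡n m≤n
... | inj₁ m<n  = ℚ.<⇒≤ (fromℤ-mono-< m<n)
... | inj₂ refl = ℚ.≤-refl

fromℤ-homo : IsRingHomomorphism ℤ.+-*-rawRing ℚ.+-*-rawRing fromℤ
fromℤ-homo = mkRingHomomorphism fromℤ (cong fromℤ) fromℤ-+ fromℤ-* fromℤ-neg refl refl

fromℤ-reciprocal : ∀ x → x ≢ 0ℤ → ∃[ h ] fromℤ x ℚ.* h ≡ 1ℚ
fromℤ-reciprocal x x≢0 = ℚ.1/ fromℤ x , ℚ.*-inverseʳ (fromℤ x)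
  where instance _ = ℚ.≢-nonZero (x≢0 ∘ fromℤ-injective)

-- Prime factors

primeFactor : ∀ n → 1 ℕ.< n → ∃[ ℓ ] (Prime ℓ × ℓ ∣ n)
primeFactor n@(suc (suc _)) (s≤s _) with factorise n
... | record { factors = [] ; isFactorisation = () }
... | record { factors = ℓ ∷ ℓs ; isFactorisation = eq ; factorsPrime = ℓ-prime ∷ _ } =
  ℓ , ℓ-prime , subst (ℓ ∣_) (sym eq) (ℕ∣.m∣m*n _)

-- The prime ℓ divides c / gcd c c′.
excessPrime : ∀ c c′ → 0 ℕ.< c′ → c′ ℕ.< c → ∃[ ℓ ] (Prime ℓ × (∀ x → c ∣ c′ ℕ.* x → ℓ ∣ x))
excessPrime c c′ 0<c′ c′<c = fromQuotients (gcd[m,n]∣m c c′) (gcd[m,n]∣n c c′)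
  where
  g = gcd c c′
  instance
    c′-nonZero : ℕ.NonZero c′
    c′-nonZero = ℕ.>-nonZero 0<c′
    g-nonZero : ℕ.NonZero g
    g-nonZero = ℕ.≢-nonZero (gcd[m,n]≢0 c c′ (inj₂ (ℕ.≢-nonZero⁻¹ c′)))
  fromQuotients : g ∣ c → g ∣ c′ → ∃[ ℓ ] (Prime ℓ × (∀ x → c ∣ c′ ℕ.* x → ℓ ∣ x))
  fromQuotients (ℕ∣.divides q c≡qg) (ℕ∣.divides q′ c′≡q′g) =
    let ℓ , ℓ-prime , ℓ∣q = primeFactor q 1<q in ℓ , ℓ-prime , λ x c∣c′x → ℕ∣.∣-trans ℓ∣q (q∣ x c∣c′x)
    where
    coprime : Coprimality.Coprime q q′
    coprime {i} (i∣q , i∣q′) = ℕ∣.∣1⇒≡1 (ℕ∣.*-cancelʳ-∣ g (subst (i ℕ.* g ∣_) (sym (ℕ.*-identityˡ g))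
      (gcd-greatest (subst (i ℕ.* g ∣_) (sym c≡qg) (ℕ∣.*-monoˡ-∣ g i∣q))
                                 (subst (i ℕ.* g ∣_) (sym c′≡q′g) (ℕ∣.*-monoˡ-∣ g i∣q′)))))
    -- As a divisor of the positive `c′`, `g` is smaller than `c = q g`.
    1<q : 1 ℕ.< q
    1<q = ℕ.*-cancelʳ-< g 1 q (ℕ.≤-<-trans (ℕ.≤-reflexive (ℕ.*-identityˡ g))
      (ℕ.≤-<-trans (gcd[m,n]≤n c c′) (subst (c′ ℕ.<_) c≡qg c′<c)))
    -- Cancelling `g` in `q g ∣ q′ x g` leaves `q ∣ q′ x`, and `q` is coprime to `q′`.
    q∣ : ∀ x → c ∣ c′ ℕ.* x → q ∣ x
    q∣ x c∣c′x = Coprimality.coprime-divisor coprime (ℕ∣.*-cancelʳ-∣ g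
      (subst (q ℕ.* g ∣_) (rearrange x) (subst (_∣ c′ ℕ.* x) c≡qg c∣c′x)))
      where
      rearrange : ∀ x → c′ ℕ.* x ≡ q′ ℕ.* x ℕ.* g
      rearrange x = trans (cong (ℕ._* x) c′≡q′g) (trans (ℕ.*-assoc q′ g x)
        (trans (cong (q′ ℕ.*_) (ℕ.*-comm g x)) (sym (ℕ.*-assoc q′ x g))))

private
  module Fr = Fractions ℤ-ring ℚ-ring fromℤ-homo
  module Sc = ScaledMatrix ℚ-ring

ℚ-cancelˡ : ∀ a {y} → a ≢ 0ℚ → a ℚ.* y ≡ 0ℚ → y ≡ 0ℚ
ℚ-cancelˡ a {y} a≢0 ay≡0 = begin
  y                         ≡⟨ ℚ.*-identityˡ y ⟨
  1ℚ ℚ.* y                  ≡⟨ cong (ℚ._* y) (ℚ.*-inverseˡ a) ⟨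
  (ℚ.1/ a) ℚ.* a ℚ.* y      ≡⟨ ℚ.*-assoc (ℚ.1/ a) a y ⟩
  (ℚ.1/ a) ℚ.* (a ℚ.* y)    ≡⟨ cong ((ℚ.1/ a) ℚ.*_) ay≡0 ⟩
  (ℚ.1/ a) ℚ.* 0ℚ           ≡⟨ ℚ.*-zeroʳ (ℚ.1/ a) ⟩
  0ℚ                        ∎
  where
  open ≡-Reasoning
  instance _ = ℚ.≢-nonZero a≢0

-- Lines, kernel vectors and irreducibility

line : ∀ {d} → Vector ℚ d → Subspace d
line w = record
  { member   = λ u → ∃[ a ] u ≗ (a ·ⱽ w)
  ; resp     = λ { u≗v (a , e) → a , λ i → trans (sym (u≗v i)) (e i) }
  ; 0-closed = 0ℚ , λ i → sym (ℚ.*-zeroˡ (w i))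
  ; +-closed = λ { (a , e) (b , f) → a ℚ.+ b , λ i → trans (cong₂ ℚ._+_ (e i) (f i)) (sym (ℚ.*-distribʳ-+ (w i) a b)) }
  ; ·-closed = λ { c (a , e) → c ℚ.* a , λ i → trans (cong (c ℚ.*_) (e i)) (sym (ℚ.*-assoc c a (w i))) }
  }

∈-line : ∀ {d} (w : Vector ℚ d) → member (line w) w
∈-line w = 1ℚ , λ i → sym (ℚ.*-identityˡ (w i))

line-dimension : ∀ {d} (w : Vector ℚ d) → ¬ (w ≗ 0ⱽ) → HasDimension (line w) 1
line-dimension w w≢0 = (λ _ → w) , record
  { inside      = λ _ → ∈-line w
  ; independent = λ { a e zero → independent (a zero) (λ i → trans (sym (ℚ.+-identityʳ (a zero ℚ.* w i))) (e i)) }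
  ; spanning    = λ { (a , e) → (λ _ → a) , λ i → trans (e i) (sym (ℚ.+-identityʳ (a ℚ.* w i))) }
  }
  where
  independent : ∀ a → (∀ i → a ℚ.* w i ≡ 0ℚ) → a ≡ 0ℚ
  independent a e with a ℚ.≟ 0ℚ
  ... | yes a≡0 = a≡0
  ... | no  a≢0 = contradiction (λ i → ℚ-cancelˡ a a≢0 (e i)) w≢0

-- If the first unit vector is a multiple `a w`, then `a` is nonzero and the second coordinate of
-- `w` is zero, so the second unit vector lies off the line.
line-nonTrivial : ∀ {d} (w : Vector ℚ (suc (suc d))) → ¬ (w ≗ 0ⱽ) → NonTrivial (line w)
line-nonTrivial {d} w w≢0 = (λ zeros → w≢0 (zeros w (∈-line w))) , notAll
  where
  e₀ e₁ : Vector ℚ (suc (suc d))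
  e₀ = Mℚ.1ᴹ zero
  e₁ = Mℚ.1ᴹ (suc zero)
  notAll : ¬ (∀ u → member (line w) u)
  notAll all = 1≢0 (trans (proj₂ (all e₁) (suc zero))
    (trans (cong (proj₁ (all e₁) ℚ.*_) w₁≡0) (ℚ.*-zeroʳ (proj₁ (all e₁)))))
    where
    1≢0 : 1ℚ ≢ 0ℚ
    1≢0 ()
    a = proj₁ (all e₀)
    a≢0 : a ≢ 0ℚ
    a≢0 a≡0 = 1≢0 (trans (proj₂ (all e₀) zero) (trans (cong (ℚ._* w zero) a≡0) (ℚ.*-zeroˡ (w zero))))
    w₁≡0 : w (suc zero) ≡ 0ℚ
    w₁≡0 = ℚ-cancelˡ a a≢0 (sym (proj₂ (all e₀) (suc zero)))

*ⱽ-line : ∀ {d} (A : Matrix ℚ d) (w u : Vector ℚ d) a → u ≗ (a ·ⱽ w) → (A Matℚ.*ⱽ u) ≗ (a ·ⱽ (A Matℚ.*ⱽ w))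
*ⱽ-line A w u a e i = trans (Mℚ.sum-cong (λ k → trans (cong (A i k ℚ.*_) (e k)) (swap (A i k) a (w k))))
  (sym (*-distribˡ-sum a (λ k → A i k ℚ.* w k)))
  where
  open SemiringSum (CommutativeRing.semiring ℚ-ring) using (*-distribˡ-sum)
  swap : ∀ x y z → x ℚ.* (y ℚ.* z) ≡ y ℚ.* (x ℚ.* z)
  swap x y z = trans (sym (ℚ.*-assoc x y z)) (trans (cong (ℚ._* z) (ℚ.*-comm x y)) (ℚ.*-assoc y x z))

kernel⇒reducible : ∀ {d} (P Q : Matrix ℤ (suc (suc d))) (w : Vector ℚ (suc (suc d))) → ¬ (w ≗ 0ⱽ) →
  (toMatℚ P Matℚ.*ⱽ w) ≗ 0ⱽ → ¬ Irreducible P Q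
kernel⇒reducible {d} P Q w w≢0 Pw≡0 irr = decide (all? (λ i → (toMatℚ Q Matℚ.*ⱽ w) i ℚ.≟ 0ℚ))
  where
  Qw = toMatℚ Q Matℚ.*ⱽ w
  reducible : (V : Subspace (suc (suc d))) → NonTrivial V → HasDimension V 1 → member V Qw → _
  reducible V nonTrivial dim Qw∈V = irr (line w , V , line-nonTrivial w w≢0 , nonTrivial , (1 , line-dimension w w≢0 , dim) ,
    (λ { u (a , e) → Subspace.resp V (λ i → sym (trans (*ⱽ-line (toMatℚ P) w u a e i)
           (trans (cong (a ℚ.*_) (Pw≡0 i)) (ℚ.*-zeroʳ a)))) (Subspace.0-closed V) }) ,
    (λ { u (a , e) → Subspace.resp V (λ i → sym (*ⱽ-line (toMatℚ Q) w u a e i)) (Subspace.·-closed V a Qw∈V) }))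
  decide : Dec (∀ i → Qw i ≡ 0ℚ) → _
  -- With `Qw = 0` any line can serve as `V`; the line through `w` is at hand.
  decide (yes Qw≡0) = reducible (line w) (line-nonTrivial w w≢0) (line-dimension w w≢0)
    (0ℚ , λ i → trans (Qw≡0 i) (sym (ℚ.*-zeroˡ (w i))))
  decide (no Qw≢0) = reducible (line Qw) (line-nonTrivial Qw Qw≢0) (line-dimension Qw Qw≢0) (∈-line Qw)

-- These are the coefficients of `det (x P - Q)`; the sign is there because `pencil` adds its second
-- matrix.
pencilDet : ∀ {d} → Matrix ℤ d → Matrix ℤ d → ℕ → ℤ
pencilDet P Q k = PolynomialOver.coeff ℤ.+-*-rawRing (PencilProperties.detᴾ ℤ-ring P (λ i j → ℤ.- Q i j)) k

module PrimeModulus (m : ℤ) (integral : ∀ x y → Modular._≈ₘ_ m (x ℤ.* y) 0ℤ → Modular._≈ₘ_ m x 0ℤ ⊎ Modular._≈ₘ_ m y 0ℤ)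
  (1≉0 : ¬ Modular._≈ₘ_ m 1ℤ 0ℤ) =
  ColumnReduction.PrimeCongruence ℤ-ring (Modular._≈ₘ_ m) (Modular.isCommutativeRing m) (Modular.≡⇒≈ₘ m) integral 1≉0 (Modular._≈0? m) reduceColumn

-- Modulo 0 congruence is equality, and 0 generates a prime ideal of ℤ, so the elimination built for
-- primes also yields kernels over ℤ.
module Modulus0 where
  open Modular 0ℤ

  ≈0⇒≡0 : ∀ {x} → x ≈ₘ 0ℤ → x ≡ 0ℤ
  ≈0⇒≡0 p = Signed.0∣⇒≡0 (≈0⇒∣ p)

  integral : ∀ x y → x ℤ.* y ≈ₘ 0ℤ → x ≈ₘ 0ℤ ⊎ y ≈ₘ 0ℤ
  integral x y p = [ inj₁ ∘ ≡⇒≈ₘ , inj₂ ∘ ≡⇒≈ₘ ]′ (ℤ.i*j≡0⇒i≡0∨j≡0 x (≈0⇒≡0 p))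

  1≉0 : ¬ 1ℤ ≈ₘ 0ℤ
  1≉0 p with ≈0⇒≡0 p
  ... | ()

  open PrimeModulus 0ℤ integral 1≉0 public using (kernel-singular; reduceRow)

ℤ-kernel : ∀ {d} (P : Matrix ℤ d) → Mℤ.det P ≡ 0ℤ →
  Σ (Vector ℤ d) λ v → ¬ (∀ k → v k ≡ 0ℤ) × (∀ i → (P Mℤ.*ⱽ v) i ≡ 0ℤ)
ℤ-kernel P detP≡0 =
  let v , v≉0 , Pv≈0 = Modulus0.kernel-singular P
        (CommutativeRing.trans (Modular.modularRing 0ℤ)
          (CommutativeRing.sym (Modular.modularRing 0ℤ)
            (MatrixHomomorphism.det-homo ℤ.+-*-rawRing (Modular.modularRing 0ℤ) (Modular.reduction-homo 0ℤ) P))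
          (Modular.≡⇒≈ₘ 0ℤ detP≡0))
  in  v , (λ v≡0 → v≉0 (λ k → Modular.≡⇒≈ₘ 0ℤ (v≡0 k))) , (λ i → Modulus0.≈0⇒≡0 (Pv≈0 i))

-- For `d = 0` the determinant is 1. For `d = 1` there is no non-trivial subspace, so the conclusion
-- comes from `P ≠ 0`. From `d = 2` on, a kernel vector contradicts irreducibility.
irreducible⇒nonsingular : ∀ d (P Q : Matrix ℤ d) → Irreducible P Q → (d ≡ 1 → ¬ (P Matℤ.≈ᴹ Matℤ.0ᴹ)) → Mℤ.det P ≢ 0ℤ
irreducible⇒nonsingular zero          P Q irr P≢0 ()
irreducible⇒nonsingular (suc zero)    P Q irr P≢0 detP≡0 = P≢0 refl λ { zero zero → trans (sym det≡) detP≡0 }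
  where
  det≡ : Mℤ.det P ≡ P zero zero
  det≡ = trans (Mℤ.det-blockˡ P (λ ())) (ℤ.*-identityʳ (P zero zero))
irreducible⇒nonsingular (suc (suc d)) P Q irr P≢0 detP≡0 =
  let v , v≢0 , Pv≡0 = ℤ-kernel P detP≡0
  in  kernel⇒reducible P Q (fromℤ ∘ v) (λ e → v≢0 (λ k → fromℤ-injective (e k)))
        (λ i → trans (Mℚ.sum-cong (λ k → sym (fromℤ-* (P i k) (v k))))
          (trans (sym (MatrixHomomorphism.sum-homo ℤ.+-*-rawRing ℚ-ring fromℤ-homo (λ k → P i k ℤ.* v k))) (cong fromℤ (Pv≡0 i)))) irr

nonsingular⇒Invertible : ∀ {d} (P : Matrix ℤ d) → Mℤ.det P ≢ 0ℤ → Invertible (toMatℚ P)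
nonsingular⇒Invertible = Fr.nonsingular⇒invertible (λ x y → ℤ.i*j≡0⇒i≡0∨j≡0 x) fromℤ-reciprocal Modulus0.reduceRow

-- Denominators of the characteristic polynomial

det-charPoly : ∀ {d} (P Q : Matrix ℤ d) (P⁻¹ : Matrix ℚ d) → Matℚ.IsInverse (toMatℚ P) P⁻¹ → ∀ k →
  fromℤ (Mℤ.det P) ℚ.* Polyℚ.coeff (Polyℚ.charPoly (P⁻¹ Matℚ.*ᴹ toMatℚ Q)) k ≡ fromℤ (pencilDet P Q k)
det-charPoly P Q P⁻¹ inv k = begin
  fromℤ (Mℤ.det P) ℚ.* p                ≡⟨ cong (ℚ._* p) (Fr.ι-det P) ⟩
  Mℚ.det (toMatℚ P) ℚ.* p               ≡⟨ Fr.det-charPoly (toMatℚ P) P⁻¹ (toMatℚ Q) inv k ⟩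
  _                                     ≡⟨ Fr.ι-detᴾ P Q k ⟨
  fromℤ (pencilDet P Q k)               ∎
  where
  open ≡-Reasoning
  p = Polyℚ.coeff (Polyℚ.charPoly (P⁻¹ Matℚ.*ᴹ toMatℚ Q)) k

abs-multiple : ∀ z → ∃[ s ] + ∣ z ∣ ≡ s ℤ.* z
abs-multiple (+ n)      = 1ℤ , sym (ℤ.*-identityˡ (+ n))
abs-multiple (-[1+ n ]) = ℤ.-1ℤ , sym (ℤ.-1*i≡-i -[1+ n ])

clears-abs : ∀ {x} D f → fromℤ D ℚ.* x ≡ fromℤ f → IsInteger (fromℤ (+ ∣ D ∣) ℚ.* x)
clears-abs {x} D f Dx≡f = let s , eq = abs-multiple D in s ℤ.* f , (begin
  fromℤ (+ ∣ D ∣) ℚ.* x          ≡⟨ cong (λ z → fromℤ z ℚ.* x) eq ⟩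
  fromℤ (s ℤ.* D) ℚ.* x          ≡⟨ cong (ℚ._* x) (fromℤ-* s D) ⟩
  fromℤ s ℚ.* fromℤ D ℚ.* x      ≡⟨ ℚ.*-assoc (fromℤ s) (fromℤ D) x ⟩
  fromℤ s ℚ.* (fromℤ D ℚ.* x)    ≡⟨ cong (fromℤ s ℚ.*_) Dx≡f ⟩
  fromℤ s ℚ.* fromℤ f            ≡⟨ fromℤ-* s f ⟨
  fromℤ (s ℤ.* f)                ∎)
  where open ≡-Reasoning

-- With `x = f / D`, integrality of `c x = g` reads `c f = g D`.
∣-cross : ∀ {x} D f c g → fromℤ D ℚ.* x ≡ fromℤ f → fromℤ (+ c) ℚ.* x ≡ fromℤ g → ∣ D ∣ ∣ c ℕ.* ∣ f ∣
∣-cross {x} D f c g Dx≡f cx≡g = ℕ∣.divides ∣ g ∣ (begin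
  c ℕ.* ∣ f ∣           ≡⟨ ℤ.abs-* (+ c) f ⟨
  ∣ + c ℤ.* f ∣         ≡⟨ cong ∣_∣ (fromℤ-injective {+ c ℤ.* f} {g ℤ.* D} cf≡gD) ⟩
  ∣ g ℤ.* D ∣           ≡⟨ ℤ.abs-* g D ⟩
  ∣ g ∣ ℕ.* ∣ D ∣       ∎)
  where
  open ≡-Reasoning
  cf≡gD : fromℤ (+ c ℤ.* f) ≡ fromℤ (g ℤ.* D)
  cf≡gD = begin
    fromℤ (+ c ℤ.* f)                   ≡⟨ fromℤ-* (+ c) f ⟩
    fromℤ (+ c) ℚ.* fromℤ f             ≡⟨ cong (fromℤ (+ c) ℚ.*_) Dx≡f ⟨
    fromℤ (+ c) ℚ.* (fromℤ D ℚ.* x)     ≡⟨ cong (fromℤ (+ c) ℚ.*_) (ℚ.*-comm (fromℤ D) x) ⟩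
    fromℤ (+ c) ℚ.* (x ℚ.* fromℤ D)     ≡⟨ ℚ.*-assoc (fromℤ (+ c)) x (fromℤ D) ⟨
    fromℤ (+ c) ℚ.* x ℚ.* fromℤ D       ≡⟨ cong (ℚ._* fromℤ D) cx≡g ⟩
    fromℤ g ℚ.* fromℤ D                 ≡⟨ fromℤ-* g D ⟨
    fromℤ (g ℤ.* D)                     ∎

reciprocal-bounds : ∀ x ℓ → 1 ℕ.< ℓ → x ℚ.* fromℤ (+ ℓ) ≡ 1ℚ → 0ℚ ℚ.< x × x ℚ.< 1ℚ
reciprocal-bounds x ℓ 1<ℓ xℓ≡1 =
  ℚ.*-cancelʳ-<-nonNeg l (subst (ℚ._< x ℚ.* l) (sym (ℚ.*-zeroˡ l)) (subst (0ℚ ℚ.<_) (sym xℓ≡1) (fromℤ-mono-< {0} {1} (s≤s z≤n)))) ,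
  ℚ.*-cancelʳ-<-nonNeg l (subst (x ℚ.* l ℚ.<_) (sym (ℚ.*-identityˡ l)) (subst (ℚ._< l) (sym xℓ≡1) (fromℤ-mono-< {1} {ℓ} 1<ℓ)))
  where
  l = fromℤ (+ ℓ)
  instance
    l-nonNegative : ℚ.NonNegative l
    l-nonNegative = ℚ.nonNegative (ℚ.<⇒≤ (fromℤ-mono-< {0} {ℓ} (ℕ.<-trans (s≤s z≤n) 1<ℓ)))

-- Breaking coprimality at a prime

module _ (ℓ : ℕ) (ℓ-prime : Prime ℓ) where
  open Modular (+ ℓ)

  prime-integral : ∀ x y → x ℤ.* y ≈ₘ 0ℤ → x ≈ₘ 0ℤ ⊎ y ≈ₘ 0ℤ
  prime-integral x y p = [ inj₁ ∘ ∣⇒≈0 ∘ Signed.∣ᵤ⇒∣ , inj₂ ∘ ∣⇒≈0 ∘ Signed.∣ᵤ⇒∣ ]′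
    (euclidsLemma ∣ x ∣ ∣ y ∣ ℓ-prime (subst (ℓ ∣_) (ℤ.abs-* x y) (Signed.∣⇒∣ᵤ (≈0⇒∣ p))))

  prime-1≉0 : ¬ 1ℤ ≈ₘ 0ℤ
  prime-1≉0 p = ¬prime[1] (subst Prime (ℕ∣.∣1⇒≡1 (Signed.∣⇒∣ᵤ (≈0⇒∣ p))) ℓ-prime)

  private
    module PM = PrimeModulus (+ ℓ) prime-integral prime-1≉0
    l : ℚ
    l = fromℤ (+ ℓ)
    1<ℓ : 1 ℕ.< ℓ
    1<ℓ = ℕ.nonTrivial⇒n>1 ℓ {{prime⇒nonTrivial ℓ-prime}}
    ℓ≢0 : + ℓ ≢ 0ℤ
    ℓ≢0 refl = contradiction 1<ℓ λ ()
    h : ℚ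
    h = proj₁ (fromℤ-reciprocal (+ ℓ) ℓ≢0)
    lh≡1 : l ℚ.* h ≡ 1ℚ
    lh≡1 = proj₂ (fromℤ-reciprocal (+ ℓ) ℓ≢0)

  det-scalar≢0 : ∀ n → Mℤ.det (PM.scalar (+ ℓ) m≈0 n) ≢ 0ℤ
  det-scalar≢0 zero    ()
  det-scalar≢0 (suc n) e = [ ℓ≢0 , det-scalar≢0 n ]′ (ℤ.i*j≡0⇒i≡0∨j≡0 (+ ℓ) (trans (sym (PM.det-scalar (+ ℓ) m≈0 n)) e))

  unit-abs : ∀ u → PM.Unit u → ∣ u ∣ ≡ 1
  unit-abs u (u′ , uu′≡1) = ℕ.m*n≡1⇒m≡1 ∣ u ∣ ∣ u′ ∣ (trans (sym (ℤ.abs-* u u′)) (cong ∣_∣ uu′≡1))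

  -- The product `R A T` is `ℓ` times an integer matrix, and `h = 1/ℓ` removes this factor.
  scaled-integral : ∀ {d} (R A T : Matrix ℤ d) → (∀ i j → ((R Mℤ.*ᴹ A) Mℤ.*ᴹ T) i j ≈ₘ 0ℤ) →
    Integral (toMatℚ R Matℚ.*ᴹ toMatℚ A Matℚ.*ᴹ Sc.scaleᴹ h (toMatℚ T))
  scaled-integral R A T RAT≈0 i j = fromQuotient (≈0⇒∣ (RAT≈0 i j))
    where
    open ≡-Reasoning
    Z = (R Mℤ.*ᴹ A) Mℤ.*ᴹ T
    Z-homo : ((toMatℚ R Mℚ.*ᴹ toMatℚ A) Mℚ.*ᴹ toMatℚ T) i j ≡ fromℤ (Z i j)
    Z-homo = sym (trans (MatrixHomomorphism.*ᴹ-homo ℤ.+-*-rawRing ℚ-ring fromℤ-homo (R Mℤ.*ᴹ A) T i j)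
      (Mℚ.sum-cong (λ k → cong (ℚ._* fromℤ (T k j)) (MatrixHomomorphism.*ᴹ-homo ℤ.+-*-rawRing ℚ-ring fromℤ-homo R A i k))))
    fromQuotient : + ℓ Signed.∣ Z i j → IsInteger ((toMatℚ R Matℚ.*ᴹ toMatℚ A Matℚ.*ᴹ Sc.scaleᴹ h (toMatℚ T)) i j)
    fromQuotient (Signed.divides q Zij≡qℓ) = q , (begin
      ((toMatℚ R Mℚ.*ᴹ toMatℚ A) Mℚ.*ᴹ Sc.scaleᴹ h (toMatℚ T)) i j
        ≡⟨ Sc.*ᴹ-scaleᴹ h (toMatℚ R Mℚ.*ᴹ toMatℚ A) (toMatℚ T) i j ⟩
      h ℚ.* ((toMatℚ R Mℚ.*ᴹ toMatℚ A) Mℚ.*ᴹ toMatℚ T) i j   ≡⟨ cong (h ℚ.*_) Z-homo ⟩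
      h ℚ.* fromℤ (Z i j)                                    ≡⟨ cong (λ z → h ℚ.* fromℤ z) Zij≡qℓ ⟩
      h ℚ.* fromℤ (q ℤ.* + ℓ)                                ≡⟨ cong (h ℚ.*_) (fromℤ-* q (+ ℓ)) ⟩
      h ℚ.* (fromℤ q ℚ.* l)                                  ≡⟨ ℚ.*-comm h (fromℤ q ℚ.* l) ⟩
      fromℤ q ℚ.* l ℚ.* h                                    ≡⟨ ℚ.*-assoc (fromℤ q) l h ⟩
      fromℤ q ℚ.* (l ℚ.* h)                                  ≡⟨ cong (fromℤ q ℚ.*_) lh≡1 ⟩
      fromℤ q ℚ.* 1ℚ                                         ≡⟨ ℚ.*-identityʳ (fromℤ q) ⟩
      fromℤ q                                                ∎)

  module _ {d} (R T : Matrix ℤ d) (u : ℤ) (count : Mℤ.det R ℤ.* Mℤ.det T ℤ.* + ℓ ≡ u ℤ.* Mℤ.det (PM.scalar (+ ℓ) m≈0 d)) where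
    private
      δ : ℤ
      δ = Mℤ.det (PM.scalar (+ ℓ) m≈0 d)
      r s : ℚ
      r = Mℚ.det (toMatℚ R)
      s = Mℚ.det (Sc.scaleᴹ h (toMatℚ T))

    det-scaled : fromℤ (Mℤ.det T) ≡ fromℤ δ ℚ.* s
    det-scaled = begin
      fromℤ (Mℤ.det T)                             ≡⟨ Fr.ι-det T ⟩
      Mℚ.det (toMatℚ T)                            ≡⟨ Sc.det-unscale h l (toMatℚ T) lh≡1 ⟩
      Mℚ.det (Sc.scaleᴹ l (Mℚ.1ᴹ {d})) ℚ.* s       ≡⟨ cong (ℚ._* s) (Mℚ.det-cong {d} scalar-homo) ⟨
      Mℚ.det (toMatℚ (PM.scalar (+ ℓ) m≈0 d)) ℚ.* s ≡⟨ cong (ℚ._* s) (Fr.ι-det (PM.scalar (+ ℓ) m≈0 d)) ⟨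
      fromℤ δ ℚ.* s                                ∎
      where
      open ≡-Reasoning
      scalar-homo : ∀ i j → fromℤ (PM.scalar (+ ℓ) m≈0 d i j) ≡ l ℚ.* Mℚ.1ᴹ i j
      scalar-homo i j = trans (fromℤ-* (+ ℓ) (Mℤ.1ᴹ i j))
        (cong (l ℚ.*_) (MatrixHomomorphism.1ᴹ-homo ℤ.+-*-rawRing ℚ-ring fromℤ-homo i j))

    -- Inserting `det T = δ s` into `count` gives `δ (r s l) = u δ`, and `δ`, a power of `ℓ`,
    -- cancels through its reciprocal `η`.
    rsl≡u : r ℚ.* s ℚ.* l ≡ fromℤ u
    rsl≡u = begin
      r ℚ.* s ℚ.* l                                 ≡⟨ ℚ.*-identityʳ (r ℚ.* s ℚ.* l) ⟨
      r ℚ.* s ℚ.* l ℚ.* 1ℚ                          ≡⟨ cong (r ℚ.* s ℚ.* l ℚ.*_) δη≡1 ⟨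
      r ℚ.* s ℚ.* l ℚ.* (fromℤ δ ℚ.* η)
        ≡⟨ solve 5 (λ r s l δ η → (r :* s :* l :* (δ :* η)) := (r :* (δ :* s) :* l :* η)) refl r s l (fromℤ δ) η ⟩
      r ℚ.* (fromℤ δ ℚ.* s) ℚ.* l ℚ.* η
        ≡⟨ cong₂ (λ x y → x ℚ.* y ℚ.* l ℚ.* η) (Fr.ι-det R) det-scaled ⟨
      fromℤ (Mℤ.det R) ℚ.* fromℤ (Mℤ.det T) ℚ.* l ℚ.* η
        ≡⟨ cong (ℚ._* η) (trans (fromℤ-* (Mℤ.det R ℤ.* Mℤ.det T) (+ ℓ)) (cong (ℚ._* l) (fromℤ-* (Mℤ.det R) (Mℤ.det T)))) ⟨
      fromℤ (Mℤ.det R ℤ.* Mℤ.det T ℤ.* + ℓ) ℚ.* η   ≡⟨ cong (λ z → fromℤ z ℚ.* η) count ⟩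
      fromℤ (u ℤ.* δ) ℚ.* η                         ≡⟨ cong (ℚ._* η) (fromℤ-* u δ) ⟩
      fromℤ u ℚ.* fromℤ δ ℚ.* η                     ≡⟨ ℚ.*-assoc (fromℤ u) (fromℤ δ) η ⟩
      fromℤ u ℚ.* (fromℤ δ ℚ.* η)                   ≡⟨ cong (fromℤ u ℚ.*_) δη≡1 ⟩
      fromℤ u ℚ.* 1ℚ                                ≡⟨ ℚ.*-identityʳ (fromℤ u) ⟩
      fromℤ u                                       ∎
      where
      open ≡-Reasoning
      open SemiringSolver (CommutativeRing.commutativeSemiring ℚ-ring) using (solve; _:=_; _:*_)
      η = proj₁ (fromℤ-reciprocal δ (det-scalar≢0 d))
      δη≡1 = proj₂ (fromℤ-reciprocal δ (det-scalar≢0 d))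

    -- By `rsl≡u` the absolute value of `r s` is exactly `1/ℓ`.
    scaled-bounds : ∣ u ∣ ≡ 1 → 0ℚ ℚ.< ℚ.∣ r ℚ.* s ∣ × ℚ.∣ r ℚ.* s ∣ ℚ.< 1ℚ
    scaled-bounds ∣u∣≡1 = reciprocal-bounds ℚ.∣ r ℚ.* s ∣ ℓ 1<ℓ (begin
      ℚ.∣ r ℚ.* s ∣ ℚ.* l              ≡⟨ cong (ℚ.∣ r ℚ.* s ∣ ℚ.*_) (fromℤ-abs (+ ℓ)) ⟨
      ℚ.∣ r ℚ.* s ∣ ℚ.* ℚ.∣ l ∣        ≡⟨ ℚ.∣p*q∣≡∣p∣*∣q∣ (r ℚ.* s) l ⟨
      ℚ.∣ r ℚ.* s ℚ.* l ∣              ≡⟨ cong ℚ.∣_∣ rsl≡u ⟩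
      ℚ.∣ fromℤ u ∣                    ≡⟨ fromℤ-abs u ⟩
      fromℤ (+ ∣ u ∣)                  ≡⟨ cong (λ n → fromℤ (+ n)) ∣u∣≡1 ⟩
      1ℚ                               ∎)
      where open ≡-Reasoning

    dets≢0 : ∣ u ∣ ≡ 1 → Mℤ.det R ≢ 0ℤ × Mℤ.det T ≢ 0ℤ
    dets≢0 ∣u∣≡1 =
      (λ e → uδ≢0 (trans (sym count) (cong (λ z → z ℤ.* Mℤ.det T ℤ.* + ℓ) e))) ,
      (λ e → uδ≢0 (trans (sym count) (trans (cong (λ z → Mℤ.det R ℤ.* z ℤ.* + ℓ) e) (cong (ℤ._* + ℓ) (ℤ.*-zeroʳ (Mℤ.det R))))))
      where
      uδ≢0 : u ℤ.* δ ≢ 0ℤ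
      uδ≢0 e = [ (λ u≡0 → contradiction (trans (sym ∣u∣≡1) (cong ∣_∣ u≡0)) λ ()) , det-scalar≢0 d ]′ (ℤ.i*j≡0⇒i≡0∨j≡0 u e)

  -- Divisibility of all coefficients says that the pencil is singular modulo `ℓ`; the `T` found for
  -- it, divided by `ℓ`, is the `S` that breaks coprimality.
  pencil-divisible⇒¬coprime : ∀ {d} (P Q : Matrix ℤ d) → (∀ k → ℓ ∣ ∣ pencilDet P Q k ∣) → ¬ Coprime P Q
  pencil-divisible⇒¬coprime {d} P Q ℓ∣f coprime = refute (PM.singular-pencil (+ ℓ) m≈0 P -Q λ k →
      CommutativeRing.trans PM.modularRing
        (CommutativeRing.sym PM.modularRing (PolynomialMap.coeff-detᴾ-homo ℤ-ring PM.modularRing reduction-homo P -Q k))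
        (∣⇒≈0 (Signed.∣ᵤ⇒∣ (ℓ∣f k))))
    where
    -Q : Matrix ℤ d
    -Q i j = ℤ.- Q i j
    refute : ¬ PM.ReducesModulo (+ ℓ) m≈0 P -Q
    refute (R , T , RPT≈0 , RQT≈0 , u , unit , count) = coprime
      ( toMatℚ R , Sc.scaleᴹ h (toMatℚ T) , nonsingular⇒Invertible R (proj₁ nonzero)
      , (Sc.scaleᴹ l (proj₁ T⁻¹) , Sc.scaleᴹ-inverse h l (toMatℚ T) (proj₁ T⁻¹) (trans (ℚ.*-comm h l) lh≡1) (proj₂ T⁻¹))
      , proj₁ bounds , proj₂ bounds
      , scaled-integral R P T RPT≈0 , scaled-integral R Q T RQT≈0′ )
      where
      nonzero = dets≢0 R T u count (unit-abs u unit)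
      bounds  = scaled-bounds R T u count (unit-abs u unit)
      T⁻¹     = nonsingular⇒Invertible T (proj₂ nonzero)
      -- The reduction was applied to `P` and `-Q`; the sign is taken back here.
      RQT≈0′ : ∀ i j → ((R Mℤ.*ᴹ Q) Mℤ.*ᴹ T) i j ≈ₘ 0ℤ
      RQT≈0′ i j = ∣⇒≈0 (subst (+ ℓ Signed.∣_)
        (trans (cong ℤ.-_ (NegatedMatrix.*ᴹ-neg-middle ℤ-ring R Q T i j)) (ℤ.neg-involutive (((R Mℤ.*ᴹ Q) Mℤ.*ᴹ T) i j)))
        (Signed.∣m⇒∣-m (≈0⇒∣ (RQT≈0 i j))))

-- A smaller `c` that clears denominators makes `det P` divide `c` times each coefficient of
-- `det (x P - Q)`. The prime from `excessPrime` depends on `c` and `det P` only, so one prime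
-- divides all coefficients.
coprime⇒smallest : ∀ {d} (P Q : Matrix ℤ d) (P⁻¹ : Matrix ℚ d) → Matℚ.IsInverse (toMatℚ P) P⁻¹ → Mℤ.det P ≢ 0ℤ → Coprime P Q →
  IsSmallestPositive (ClearsDenominators (Polyℚ.charPoly (P⁻¹ Matℚ.*ᴹ toMatℚ Q))) ∣ Mℤ.det P ∣
coprime⇒smallest P Q P⁻¹ inv detP≢0 coprime =
  ℕ.n≢0⇒n>0 (detP≢0 ∘ ℤ.∣i∣≡0⇒i≡0) ,
  (λ k → clears-abs (Mℤ.det P) (pencilDet P Q k) (det-charPoly P Q P⁻¹ inv k)) ,
  minimal
  where
  minimal : ∀ c → 0 ℕ.< c → ClearsDenominators (Polyℚ.charPoly (P⁻¹ Matℚ.*ᴹ toMatℚ Q)) c → ∣ Mℤ.det P ∣ ℕ.≤ c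
  minimal c 0<c clears with ∣ Mℤ.det P ∣ ℕ.≤? c
  ... | yes ∣D∣≤c = ∣D∣≤c
  ... | no  ∣D∣≰c =
    let ℓ , ℓ-prime , ℓ∣ = excessPrime ∣ Mℤ.det P ∣ c 0<c (ℕ.≰⇒> ∣D∣≰c)
    in  contradiction coprime (pencil-divisible⇒¬coprime ℓ ℓ-prime P Q λ k →
          ℓ∣ ∣ pencilDet P Q k ∣ (∣-cross (Mℤ.det P) (pencilDet P Q k) c (proj₁ (clears k)) (det-charPoly P Q P⁻¹ inv k) (proj₂ (clears k))))

-- Minimality is applied to the determinant of `R P S`. Its absolute value must be positive as well
-- as smaller, and this is where the lower bound on `det R det S` enters.
smallest⇒coprime : ∀ {d} (P Q : Matrix ℤ d) (P⁻¹ : Matrix ℚ d) → Matℚ.IsInverse (toMatℚ P) P⁻¹ →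
  IsSmallestPositive (ClearsDenominators (Polyℚ.charPoly (P⁻¹ Matℚ.*ᴹ toMatℚ Q))) ∣ Mℤ.det P ∣ → Coprime P Q
smallest⇒coprime {d} P Q P⁻¹ inv (0<∣D∣ , _ , minimal) (R , S , _ , _ , 0<∣x∣ , ∣x∣<1 , RPS-integral , RQS-integral) =
  ℚ.<-irrefl refl (ℚ.<-≤-trans shrinks (fromℤ-mono-≤ {∣ D ∣} {∣ D₂ ∣} (minimal ∣ D₂ ∣ 0<∣D₂∣ clears)))
  where
  open ≡-Reasoning
  p : ℕ → ℚ
  p = Polyℚ.coeff (Polyℚ.charPoly (P⁻¹ Matℚ.*ᴹ toMatℚ Q))
  P₂ Q₂ : Matrix ℤ d
  P₂ i j = proj₁ (RPS-integral i j)
  Q₂ i j = proj₁ (RQS-integral i j)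
  D D₂ : ℤ
  D  = Mℤ.det P
  D₂ = Mℤ.det P₂
  x : ℚ
  x = Matℚ.det R ℚ.* Matℚ.det S

  D₂≡xD : fromℤ D₂ ≡ x ℚ.* fromℤ D
  D₂≡xD = begin
    fromℤ D₂                                              ≡⟨ Fr.ι-det P₂ ⟩
    Mℚ.det (toMatℚ P₂)                                    ≡⟨ Mℚ.det-cong {d} (λ i j → proj₂ (RPS-integral i j)) ⟨
    Mℚ.det ((R Mℚ.*ᴹ toMatℚ P) Mℚ.*ᴹ S)                   ≡⟨ Mℚ.det-* (R Mℚ.*ᴹ toMatℚ P) S ⟩
    Mℚ.det (R Mℚ.*ᴹ toMatℚ P) ℚ.* Mℚ.det S                ≡⟨ cong (ℚ._* Mℚ.det S) (Mℚ.det-* R (toMatℚ P)) ⟩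
    Mℚ.det R ℚ.* Mℚ.det (toMatℚ P) ℚ.* Mℚ.det S           ≡⟨ cong (λ z → Mℚ.det R ℚ.* z ℚ.* Mℚ.det S) (Fr.ι-det P) ⟨
    Mℚ.det R ℚ.* fromℤ D ℚ.* Mℚ.det S                     ≡⟨ ℚ.*-assoc (Mℚ.det R) (fromℤ D) (Mℚ.det S) ⟩
    Mℚ.det R ℚ.* (fromℤ D ℚ.* Mℚ.det S)                   ≡⟨ cong (Mℚ.det R ℚ.*_) (ℚ.*-comm (fromℤ D) (Mℚ.det S)) ⟩
    Mℚ.det R ℚ.* (Mℚ.det S ℚ.* fromℤ D)                   ≡⟨ ℚ.*-assoc (Mℚ.det R) (Mℚ.det S) (fromℤ D) ⟨
    Mℚ.det R ℚ.* Mℚ.det S ℚ.* fromℤ D                     ∎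

  -- `P₂⁻¹ Q₂` and `P⁻¹ Q` are conjugate by `S`, so the same `p` belongs to both pencils. Scaling
  -- the identity for `P` by `x` avoids inverting `P₂`.
  D₂p≡f₂ : ∀ k → fromℤ D₂ ℚ.* p k ≡ fromℤ (pencilDet P₂ Q₂ k)
  D₂p≡f₂ k = begin
    fromℤ D₂ ℚ.* p k                     ≡⟨ cong (ℚ._* p k) D₂≡xD ⟩
    x ℚ.* fromℤ D ℚ.* p k                ≡⟨ ℚ.*-assoc x (fromℤ D) (p k) ⟩
    x ℚ.* (fromℤ D ℚ.* p k)              ≡⟨ cong (x ℚ.*_) (det-charPoly P Q P⁻¹ inv k) ⟩
    x ℚ.* fromℤ (pencilDet P Q k)        ≡⟨ Fr.pencil-transform R S P Q P₂ Q₂ (λ i j → proj₂ (RPS-integral i j)) (λ i j → proj₂ (RQS-integral i j)) k ⟩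
    fromℤ (pencilDet P₂ Q₂ k)            ∎

  clears : ClearsDenominators (Polyℚ.charPoly (P⁻¹ Matℚ.*ᴹ toMatℚ Q)) ∣ D₂ ∣
  clears k = clears-abs D₂ (pencilDet P₂ Q₂ k) (D₂p≡f₂ k)

  ∣D₂∣≡ : fromℤ (+ ∣ D₂ ∣) ≡ ℚ.∣ x ∣ ℚ.* fromℤ (+ ∣ D ∣)
  ∣D₂∣≡ = begin
    fromℤ (+ ∣ D₂ ∣)                ≡⟨ fromℤ-abs D₂ ⟨
    ℚ.∣ fromℤ D₂ ∣                  ≡⟨ cong ℚ.∣_∣ D₂≡xD ⟩
    ℚ.∣ x ℚ.* fromℤ D ∣             ≡⟨ ℚ.∣p*q∣≡∣p∣*∣q∣ x (fromℤ D) ⟩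
    ℚ.∣ x ∣ ℚ.* ℚ.∣ fromℤ D ∣       ≡⟨ cong (ℚ.∣ x ∣ ℚ.*_) (fromℤ-abs D) ⟩
    ℚ.∣ x ∣ ℚ.* fromℤ (+ ∣ D ∣)     ∎

  instance
    ∣D∣-positive : ℚ.Positive (fromℤ (+ ∣ D ∣))
    ∣D∣-positive = ℚ.positive (fromℤ-mono-< {0} 0<∣D∣)

  shrinks : fromℤ (+ ∣ D₂ ∣) ℚ.< fromℤ (+ ∣ D ∣)
  shrinks = subst (ℚ._< fromℤ (+ ∣ D ∣)) (sym ∣D₂∣≡)
    (subst (ℚ.∣ x ∣ ℚ.* fromℤ (+ ∣ D ∣) ℚ.<_) (ℚ.*-identityˡ (fromℤ (+ ∣ D ∣))) (ℚ.*-monoˡ-<-pos (fromℤ (+ ∣ D ∣)) ∣x∣<1))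

  0<∣D₂∣ : 0 ℕ.< ∣ D₂ ∣
  0<∣D₂∣ = ℕ.n≢0⇒n>0 λ ∣D₂∣≡0 → ℚ.<-irrefl (trans (sym (cong (λ n → fromℤ (+ n)) ∣D₂∣≡0)) ∣D₂∣≡)
    (subst (ℚ._< ℚ.∣ x ∣ ℚ.* fromℤ (+ ∣ D ∣)) (ℚ.*-zeroˡ (fromℤ (+ ∣ D ∣))) (ℚ.*-monoˡ-<-pos (fromℤ (+ ∣ D ∣)) 0<∣x∣))

-- Invertibility is asserted separately so that the equivalence, stated for an arbitrary inverse
-- `P⁻¹`, is not vacuous. Excluding the zero matrix for `d = 1` secures invertibility where
-- irreducibility is an empty condition.
theorem5p4 : (d : ℕ) (P Q : Matrix ℤ d) →
    Irreducible P Q →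
    (d ≡ 1 → ¬ (P Matℤ.≈ᴹ Matℤ.0ᴹ)) →
    Invertible (toMatℚ P) ×
    ((P⁻¹ : Matrix ℚ d) → Matℚ.IsInverse (toMatℚ P) P⁻¹ →
    Coprime P Q ⇔
    IsSmallestPositive
    (ClearsDenominators (Polyℚ.charPoly (P⁻¹ Matℚ.*ᴹ toMatℚ Q)))
    ∣ Matℤ.det P ∣)
theorem5p4 d P Q irreducible P≢0 =
  nonsingular⇒Invertible P detP≢0 ,
  λ P⁻¹ inv → mk⇔ (coprime⇒smallest P Q P⁻¹ inv detP≢0) (smallest⇒coprime P Q P⁻¹ inv)
  where
  detP≢0 : Mℤ.det P ≢ 0ℤ
  detP≢0 = irreducible⇒nonsingular d P Q irreducible P≢0
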